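{- Let $k\ge 2$ be an integer, let $p_1,\dots,p_\ell$ be a fixed sequence of distinct primes, and let $\varepsilon_{p_1},\dots,\varepsilon_{p_\ell}$ be a sequence of signs with $\varepsilon_{p_i}\in\{0,\pm1\}$ for $1\le i\le \ell$. For $x>0$ let $\mathcal D=\mathcal{D}(x)$ be the set of pairs $(D_1,D_2)$ of fundamental discriminants of real quadratic fields with $|D_1D_2|\le x$, and for such a pair let $\chi_1,\chi_2$ be the quadratic characters associated to $D_1,D_2$. Then, as $x\to\infty$, $$\frac{1}{|\mathcal D|}\#\{(D_1,D_2)\in\mathcal D:\ \mathrm{sgn}\,\sigma_{\chi_1,\chi_2}^{k-1}(p_i)=\varepsilon_{p_i},\ 1\le i\le \ell\}\ \longrightarrow\ \Bigg(\prod_{\substack{1\le i\le \ell\\ \varepsilon_{p_i}=0}}\frac{1}{(p_i+1)^2}\Bigg)\Bigg(\prod_{\substack{1\le i\le \ell\\ \varepsilon_{p_i}\ne0}}\frac{p_i(p_i+2)}{2(p_i+1)^2}\Bigg).$$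
   Context: For Dirichlet characters $\chi_1,\chi_2$ and an integer $k\ge2$, $\sigma_{\chi_1,\chi_2}^{k-1}(n)=\sum_{d\mid n}\chi_1(n/d)\chi_2(d)d^{k-1}$. For a fundamental discriminant $D_i$, the associated character is the Kronecker symbol $\chi_i(\cdot)=\left(\frac{D_i}{\cdot}\right)$. For a real number $t$, $\mathrm{sgn}(t)\in\{ -1,0,1\}$ denotes its sign, with $\mathrm{sgn}(0)=0$. -}

module Defs where

open import Data.Bool.Base using (if_then_else_)
open import Data.Fin.Base using (Fin)
open import Data.Fin.Properties using (all?)
open import Data.Integer.Base as ℤ using (ℤ; +_; -[1+_]; 0ℤ; 1ℤ; -1ℤ; ∣_∣; _%ℕ_)
import Data.Integer.Divisibility.Signed as ℤ∣
import Data.Integer.Properties as ℤₚ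
open import Data.List.Base
  using (List; map; filter; foldr; upTo; allFin; length; cartesianProduct)
open import Data.List.Membership.Propositional using (_∈_)
open import Data.List.Membership.Propositional.Properties
  using (∈-filter⁺; ∈-filter⁻; ∈-cartesianProduct⁺; ∈-map⁺; ∈-upTo⁺)
open import Data.List.Relation.Unary.Unique.Propositional using (Unique)
import Data.List.Relation.Unary.Unique.Propositional.Properties as Uniqueₚ
open import Data.Nat.Base as ℕ using (ℕ; zero; suc; _∸_; z≤n; s≤s)
open import Data.Nat.Divisibility using (_∣_; _∣?_; ∣⇒≤; divides)
open import Data.Nat.Primality.Factorisation using (factorise; factors)
import Data.Nat.Properties as ℕₚ
open import Data.Product.Base using (_×_; _,_; ∃-syntax; proj₁; proj₂)
open import Data.Rational.Base as ℚ using (ℚ; 0ℚ; 1ℚ)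
open import Data.Sum.Base using (_⊎_)
open import Function.Bundles using (_⇔_; mk⇔)
open import Relation.Binary.PropositionalEquality
  using (_≡_; _≢_; refl; sym; trans; cong; subst)
open import Relation.Nullary.Decidable
  using (Dec; yes; no; does; map′; ¬?; _×-dec_; _⊎-dec_; _→-dec_)

sgn : ℤ → ℤ
sgn (+ zero)  = 0ℤ
sgn (+ suc _) = 1ℤ
sgn -[1+ _ ]  = -1ℤ

sumℤ productℤ : List ℤ → ℤ
sumℤ     = foldr ℤ._+_ 0ℤ
productℤ = foldr ℤ._*_ 1ℤ

productℚ : List ℚ → ℚ
productℚ = foldr ℚ._*_ 1ℚ

------------------------------------------------------------------------
-- Kronecker symbol

-- (a/2): 0 for even a, 1 for a ≡ ±1 and -1 for a ≡ ±3 modulo 8.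
kronecker₂ : ℤ → ℤ
kronecker₂ a with a %ℕ 8
... | 1 = 1ℤ
... | 3 = -1ℤ
... | 5 = -1ℤ
... | 7 = 1ℤ
... | _ = 0ℤ

-- The bound b < p loses nothing, as only b modulo p matters.
IsSquareMod : ℤ → ℕ → Set
IsSquareMod a p = ∃[ b ] b ℕ.< p × (+ p) ℤ∣.∣ (+ b ℤ.* + b ℤ.- a)

isSquareMod? : ∀ a p → Dec (IsSquareMod a p)
isSquareMod? a p = ℕₚ.anyUpTo? (λ b → (+ p) ℤ∣.∣? (+ b ℤ.* + b ℤ.- a)) p

-- Meaningful for odd primes p.
legendre : ℤ → ℕ → ℤ
legendre a p =
  if does ((+ p) ℤ∣.∣? a) then 0ℤ
  else if does (isSquareMod? a p) then 1ℤ
  else -1ℤ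

kroneckerAtPrime : ℤ → ℕ → ℤ
kroneckerAtPrime a p = if does (p ℕₚ.≟ 2) then kronecker₂ a else legendre a p

-- The lower argument is restricted to n ≥ 0, since only positive arguments
-- occur in divisor sums.
kronecker : ℤ → ℕ → ℤ
kronecker a zero      = if does (∣ a ∣ ℕₚ.≟ 1) then 1ℤ else 0ℤ
kronecker a n@(suc _) = productℤ (map (kroneckerAtPrime a) (factors (factorise n)))

------------------------------------------------------------------------
-- Twisted divisor sums

-- σ χ₁ χ₂ m n = Σ_{d ∣ n} χ₁(n/d) χ₂(d) dᵐ for n ≥ 1; the list index j
-- stands for the divisor d = suc j.
σ : (χ₁ χ₂ : ℕ → ℤ) → ℕ → ℕ → ℤ
σ χ₁ χ₂ m n =
  sumℤ (map (λ j → χ₁ (n ℕ./ suc j) ℤ.* χ₂ (suc j) ℤ.* + (suc j ℕ.^ m))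
            (filter (λ j → suc j ∣? n) (upTo n)))

------------------------------------------------------------------------
-- Fundamental discriminants

Squarefree : ℕ → Set
Squarefree n = ∀ d → d ℕ.* d ∣ n → d ≡ 1

squarefree? : ∀ n → Dec (Squarefree n)
squarefree? zero = no λ sf → ℕₚ.0≢1+n (sf 0 (divides 0 refl))
squarefree? n@(suc _) =
  map′ (λ h d d²∣n → h (s≤s (d≤n d d²∣n)) d²∣n) (λ sf {d} _ → sf d)
       (ℕₚ.allUpTo? (λ d → d ℕ.* d ∣? n →-dec d ℕₚ.≟ 1) (suc n))
  where
  d≤n : ∀ d → d ℕ.* d ∣ n → d ℕ.≤ n
  d≤n zero      _    = z≤n
  d≤n d@(suc _) d²∣n = ℕₚ.≤-trans (ℕₚ.m≤m*n d d) (∣⇒≤ d²∣n)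

-- Discriminants of quadratic fields; in particular 1 is excluded.
IsFundamentalDiscriminant : ℤ → Set
IsFundamentalDiscriminant D =
    (D ≢ 1ℤ × D %ℕ 4 ≡ 1 × Squarefree ∣ D ∣)
  ⊎ (∃[ m ] D ≡ m ℤ.* + 4 × (m %ℕ 4 ≡ 2 ⊎ m %ℕ 4 ≡ 3) × Squarefree ∣ m ∣)

isFundamentalDiscriminant? : ∀ D → Dec (IsFundamentalDiscriminant D)
isFundamentalDiscriminant? D =
  (¬? (D ℤₚ.≟ 1ℤ) ×-dec D %ℕ 4 ℕₚ.≟ 1 ×-dec squarefree? ∣ D ∣) ⊎-dec even?
  where
  Q : ℤ → Set
  Q m = (m %ℕ 4 ≡ 2 ⊎ m %ℕ 4 ≡ 3) × Squarefree ∣ m ∣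

  Q? : ∀ m → Dec (Q m)
  Q? m = (m %ℕ 4 ℕₚ.≟ 2 ⊎-dec m %ℕ 4 ℕₚ.≟ 3) ×-dec squarefree? ∣ m ∣

  even? : Dec (∃[ m ] D ≡ m ℤ.* + 4 × Q m)
  even? with (+ 4) ℤ∣.∣? D
  ... | no 4∤D = no λ (m , D≡4m , _) → 4∤D (ℤ∣.divides m D≡4m)
  ... | yes (ℤ∣.divides q D≡4q) =
    map′ (λ Qq → q , D≡4q , Qq)
         (λ (m , D≡4m , Qm) →
           subst Q (ℤₚ.*-cancelʳ-≡ m q (+ 4) (trans (sym D≡4m) D≡4q)) Qm)
         (Q? q)

IsRealFundamentalDiscriminant : ℤ → Set
IsRealFundamentalDiscriminant D = 0ℤ ℤ.< D × IsFundamentalDiscriminant D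

In𝒟 : ℕ → ℤ × ℤ → Set
In𝒟 x (D₁ , D₂) =
    IsRealFundamentalDiscriminant D₁
  × IsRealFundamentalDiscriminant D₂
  × ∣ D₁ ℤ.* D₂ ∣ ℕ.≤ x

in𝒟? : ∀ x P → Dec (In𝒟 x P)
in𝒟? x (D₁ , D₂) = real? D₁ ×-dec real? D₂ ×-dec ∣ D₁ ℤ.* D₂ ∣ ℕₚ.≤? x
  where
  real? : ∀ D → Dec (IsRealFundamentalDiscriminant D)
  real? D = 0ℤ ℤₚ.<? D ×-dec isFundamentalDiscriminant? D

box : ℕ → List ℤ
box x = map +_ (upTo (suc x))

-- The set 𝒟(x) as a duplicate-free list; 0 ≤ D₁ , D₂ ≤ x holds for every
-- pair in it.  As |D₁D₂| is an integer, 𝒟(x) = 𝒟(⌊x⌋) for real x > 0, so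
-- x ranges over ℕ.
𝒟 : ℕ → List (ℤ × ℤ)
𝒟 x = filter (in𝒟? x) (cartesianProduct (box x) (box x))

∈𝒟⇔ : ∀ x P → P ∈ 𝒟 x ⇔ In𝒟 x P
∈𝒟⇔ x P = mk⇔
  (λ P∈ → proj₂ (∈-filter⁻ (in𝒟? x) {xs = cartesianProduct (box x) (box x)} P∈))
  (λ h → ∈-filter⁺ (in𝒟? x) (inBox P h) h)
  where
  ∈box : ∀ n → n ℕ.≤ x → + n ∈ box x
  ∈box n n≤x = ∈-map⁺ +_ (∈-upTo⁺ (s≤s n≤x))

  inBox : ∀ P → In𝒟 x P → P ∈ cartesianProduct (box x) (box x)
  inBox (+ zero , _)          ((ℤ.+<+ () , _) , _)
  inBox (+ suc _ , + zero)    (_ , (ℤ.+<+ () , _) , _)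
  inBox (+ suc a , + suc b)   (_ , _ , ab≤x) = ∈-cartesianProduct⁺
    (∈box (suc a) (ℕₚ.≤-trans (ℕₚ.m≤m*n (suc a) (suc b)) ab≤x))
    (∈box (suc b) (ℕₚ.≤-trans (ℕₚ.m≤n*m (suc b) (suc a)) ab≤x))

𝒟-unique : ∀ x → Unique (𝒟 x)
𝒟-unique x = Uniqueₚ.filter⁺ (in𝒟? x) (Uniqueₚ.cartesianProduct⁺ box! box!)
  where box! = Uniqueₚ.map⁺ ℤₚ.+-injective (Uniqueₚ.upTo⁺ (suc x))

------------------------------------------------------------------------
-- Sign patterns and their densities

HasSigns : ∀ {ℓ} → ℕ → (Fin ℓ → ℕ) → (Fin ℓ → ℤ) → ℤ × ℤ → Set
HasSigns k p ε (D₁ , D₂) =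
  ∀ i → sgn (σ (kronecker D₁) (kronecker D₂) (k ∸ 1) (p i)) ≡ ε i

hasSigns? : ∀ {ℓ} k (p : Fin ℓ → ℕ) ε P → Dec (HasSigns k p ε P)
hasSigns? k p ε (D₁ , D₂) =
  all? (λ i → sgn (σ (kronecker D₁) (kronecker D₂) (k ∸ 1) (p i)) ℤₚ.≟ ε i)

-- m / n, with the junk value 0 for n = 0.
ratio : ℕ → ℕ → ℚ
ratio m zero      = 0ℚ
ratio m n@(suc _) = + m ℚ./ n

-- 𝒟(x) is empty for small x, where the proportion takes the junk value 0.
proportion : ∀ {ℓ} → ℕ → (Fin ℓ → ℕ) → (Fin ℓ → ℤ) → ℕ → ℚ
proportion k p ε x = ratio (length (filter (hasSigns? k p ε) (𝒟 x))) (length (𝒟 x))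

limitingDensity : ∀ {ℓ} → (Fin ℓ → ℕ) → (Fin ℓ → ℤ) → ℚ
limitingDensity {ℓ} p ε =
  productℚ (map (λ i → + 1 ℚ./ (suc (p i) ℕ.^ 2))
                (filter (λ i → ε i ℤₚ.≟ 0ℤ) (allFin ℓ)))
  ℚ.*
  productℚ (map (λ i → + (p i ℕ.* (p i ℕ.+ 2)) ℚ./ (2 ℕ.* suc (p i) ℕ.^ 2))
                (filter (λ i → ¬? (ε i ℤₚ.≟ 0ℤ)) (allFin ℓ)))

TendsTo : (ℕ → ℚ) → ℚ → Set
TendsTo f L = ∀ δ → 0ℚ ℚ.< δ → ∃[ N ] ∀ x → N ℕ.≤ x → ℚ.∣ f x ℚ.- L ∣ ℚ.< δ

{-# OPTIONS --safe #-}

-- For a prime p the sign of σ(p) = χ₁(p) + χ₂(p) pᵏ⁻¹ is that of χ₂(p), or that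
-- of χ₁(p) if χ₂(p) = 0, so the sign conditions and the conditions "D is
-- fundamental at pᵢ" together say that (D₁ , D₂) lies in a set of residues
-- modulo some M built from 2 and the pᵢ.  Apart from D₁, D₂ ≠ 1, the remaining
-- condition is that no q² with q ∤ M prime divides D₁ or D₂.  Sieving by q ≤ Q
-- only gives a condition of period K coprime to M, and the neglected q remove at
-- most y/Q of the integers up to y; hence the sifted integers up to y are
-- equidistributed modulo M up to an error O(y/Q) + O_Q(1).  Summing over the
-- hyperbola D₁D₂ ≤ x, first in one variable and then in the other, gives the
-- error O(T/Q) + O_Q(x) with T = Σ_{d ≤ x} ⌊x/d⌋.  As T/x → ∞ and |𝒟(x)| ≫ T,
-- the proportion tends to the proportion of admissible pairs of residues modulo
-- M with the prescribed signs, which is a product over p by the Chinese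
-- remainder theorem.  At p, if z residues are ramified, then s residues are
-- split and s are inert with 2s = pz.
module Submission where

open import Defs
open import Data.Bool.Base using (if_then_else_)
open import Data.Empty using (⊥)
open import Data.Fin.Base using (Fin; zero; suc)
open import Data.Fin.Properties using (all?; any?) renaming (suc-injective to Fin-suc-injective)
import Data.Integer.Base as ℤ
open import Data.Integer.Base using (ℤ; 0ℤ; 1ℤ; -1ℤ)
import Data.Integer.Divisibility.Signed as ℤ∣
import Data.Integer.Properties as ℤₚ
open import Data.List.Base
  using (List; []; _∷_; _∷ʳ_; _++_; map; filter; upTo; applyUpTo; allFin; tabulate; length; cartesianProduct)
open import Data.List.Properties
  using (filter-++; filter-all; filter-none; filter-accept; applyUpTo-∷ʳ; length-++; map-applyUpTo; map-tabulate; map-upTo)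
open import Data.List.Relation.Binary.Permutation.Propositional.Properties using (↭-singleton-inv)
open import Data.List.Relation.Unary.All as All using ([]; _∷_)
import Data.List.Relation.Unary.All.Properties as Allₚ
open import Data.Nat.Base
open import Data.Nat.Coprimality using (Coprime; coprime-divisor; 1-coprimeTo)
  renaming (sym to coprime-sym)
open import Data.Nat.DivMod
open import Data.Nat.Divisibility
open import Data.Nat.ListAction using (product)
open import Data.Nat.Primality
  using (Prime; prime?; prime[2]; ¬prime[0]; ¬prime[1]; prime⇒irreducible; prime⇒nonZero; euclidsLemma)
open import Data.Nat.Primality.Factorisation
  using (factorise; factorisationUnique; primeFactorisation[p])
open import Data.Nat.Properties
open import Data.Nat.Tactic.RingSolver using (solve-∀)
open import Data.Product.Base using (_×_; _,_; ∃-syntax; proj₁; proj₂)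
import Data.Rational.Base as ℚ
open import Data.Rational.Base using (ℚ; 0ℚ; 1ℚ; mkℚ)
open import Data.Rational.Literals using (fromℤ)
import Data.Rational.Properties as ℚₚ
open import Data.Rational.Solver using (module +-*-Solver)
open import Data.Rational.Unnormalised.Base using (mkℚᵘ; *≡*; *≤*)
import Data.Rational.Unnormalised.Properties as ℚᵘₚ
open import Data.Sum.Base using (_⊎_; inj₁; inj₂; [_,_]′)
open import Data.Unit.Base using (tt)
open import Function.Base using (_∘_; flip; it)
open import Function.Definitions using (Injective)
open import Relation.Binary.PropositionalEquality
open import Relation.Nullary using (¬_; Dec; yes; no; contradiction)
open import Relation.Nullary.Decidable
  using (does; dec-true; dec-false; ¬?; _×-dec_; _⊎-dec_; _→-dec_)

-- Finite sums and periodic functions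

-- The density of the sifted integers is never evaluated. A count weighted by a function of the
-- residue modulo M is compared with the plain count of the same sifted integers, and in the end two
-- weighted counts are compared with each other, so the common factor cancels. What remains to be
-- excluded is a sifted set too thin for the errors. Here it helps that M is even: no q ≤ 2 sifts
-- anything, and the tail estimate at Q = 2 alone shows that at least about half of the integers
-- survive. The error O_Q(x) is one bounded error for each of the x rows of the hyperbola. It is
-- negligible only because T is of larger order than x, and Q is fixed before x grows. All estimates
-- are inequalities between natural numbers with the denominators multiplied out, and every
-- condition is a function with values 0 and 1, so that conjunctions are products and sums over
-- residues factor. Rationals enter only in the final passage to the limit.

∑ : ℕ → (ℕ → ℕ) → ℕ
∑ zero    f = 0
∑ (suc n) f = ∑ n f + f n

infix 6 ∑
syntax ∑ n (λ i → e) = ∑[ i < n ] e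

∑-cong : ∀ n {f g} → (∀ i → i < n → f i ≡ g i) → ∑ n f ≡ ∑ n g
∑-cong zero    f≗g = refl
∑-cong (suc n) f≗g = cong₂ _+_ (∑-cong n λ i i<n → f≗g i (m<n⇒m<1+n i<n)) (f≗g n ≤-refl)

∑-ext : ∀ n {f g} → (∀ i → f i ≡ g i) → ∑ n f ≡ ∑ n g
∑-ext n f≗g = ∑-cong n λ i _ → f≗g i

∑-mono : ∀ n {f g} → (∀ i → i < n → f i ≤ g i) → ∑ n f ≤ ∑ n g
∑-mono zero    f≤g = z≤n
∑-mono (suc n) f≤g = +-mono-≤ (∑-mono n λ i i<n → f≤g i (m<n⇒m<1+n i<n)) (f≤g n ≤-refl)

private
  interchange : ∀ a b c d → (a + b) + (c + d) ≡ (a + c) + (b + d)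
  interchange = solve-∀

∑-+ : ∀ n f g → (∑[ i < n ] (f i + g i)) ≡ ∑ n f + ∑ n g
∑-+ zero    f g = refl
∑-+ (suc n) f g = trans (cong (_+ (f n + g n)) (∑-+ n f g)) (interchange (∑ n f) (∑ n g) (f n) (g n))

∑-*ˡ : ∀ n c f → (∑[ i < n ] (c * f i)) ≡ c * ∑ n f
∑-*ˡ zero    c f = sym (*-zeroʳ c)
∑-*ˡ (suc n) c f = trans (cong (_+ c * f n) (∑-*ˡ n c f)) (sym (*-distribˡ-+ c (∑ n f) (f n)))

∑-*ʳ : ∀ n c f → (∑[ i < n ] (f i * c)) ≡ ∑ n f * c
∑-*ʳ n c f = begin
  (∑[ i < n ] (f i * c)) ≡⟨ ∑-ext n (λ i → *-comm (f i) c) ⟩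
  (∑[ i < n ] (c * f i)) ≡⟨ ∑-*ˡ n c f ⟩
  c * ∑ n f              ≡⟨ *-comm c (∑ n f) ⟩
  ∑ n f * c              ∎
  where open ≡-Reasoning

∑-const : ∀ n c → (∑[ i < n ] c) ≡ n * c
∑-const zero    c = refl
∑-const (suc n) c = trans (cong (_+ c) (∑-const n c)) (+-comm (n * c) c)

∑-zero : ∀ n → (∑[ i < n ] 0) ≡ 0
∑-zero n = trans (∑-const n 0) (*-zeroʳ n)

∑-split : ∀ m n f → ∑ (m + n) f ≡ ∑ m f + (∑[ i < n ] f (m + i))
∑-split m zero    f = trans (cong (λ k → ∑ k f) (+-identityʳ m)) (sym (+-identityʳ _))
∑-split m (suc n) f = begin
  ∑ (m + suc n) f                                 ≡⟨ cong (λ k → ∑ k f) (+-suc m n) ⟩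
  ∑ (m + n) f + f (m + n)                         ≡⟨ cong (_+ f (m + n)) (∑-split m n f) ⟩
  ∑ m f + (∑[ i < n ] f (m + i)) + f (m + n)      ≡⟨ +-assoc (∑ m f) _ _ ⟩
  ∑ m f + (∑[ i < suc n ] f (m + i))              ∎
  where open ≡-Reasoning

∑-≤-index : ∀ {m n} f → m ≤ n → ∑ m f ≤ ∑ n f
∑-≤-index {m} {n} f m≤n = begin
  ∑ m f            ≤⟨ m≤m+n (∑ m f) _ ⟩
  ∑ m f + _        ≡⟨ ∑-split m (n ∸ m) f ⟨
  ∑ (m + (n ∸ m)) f ≡⟨ cong (λ k → ∑ k f) (m+[n∸m]≡n m≤n) ⟩
  ∑ n f            ∎
  where open ≤-Reasoning

∑-swap : ∀ m n (F : ℕ → ℕ → ℕ) → (∑[ i < m ] ∑[ j < n ] F i j) ≡ (∑[ j < n ] ∑[ i < m ] F i j)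
∑-swap zero    n F = sym (∑-zero n)
∑-swap (suc m) n F = begin
  (∑[ i < m ] ∑[ j < n ] F i j) + ∑ n (F m)   ≡⟨ cong (_+ ∑ n (F m)) (∑-swap m n F) ⟩
  (∑[ j < n ] ∑[ i < m ] F i j) + ∑ n (F m)   ≡⟨ ∑-+ n _ (F m) ⟨
  (∑[ j < n ] ∑[ i < suc m ] F i j)           ∎
  where open ≡-Reasoning

∑-product : ∀ m n f g → (∑[ i < m ] ∑[ j < n ] (f i * g j)) ≡ ∑ m f * ∑ n g
∑-product m n f g = trans (∑-ext m λ i → ∑-*ˡ n (f i) g) (∑-*ʳ m (∑ n g) f)

∑-head : ∀ n f → ∑ (suc n) f ≡ f 0 + ∑ n (f ∘ suc)
∑-head n f = ∑-split 1 n f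

∑-distance : ∀ n f g → ∣ ∑ n f - ∑ n g ∣ ≤ (∑[ i < n ] ∣ f i - g i ∣)
∑-distance zero    f g = z≤n
∑-distance (suc n) f g = begin
  ∣ ∑ n f + f n - ∑ n g + g n ∣
    ≤⟨ ∣-∣-triangle (∑ n f + f n) (∑ n g + f n) (∑ n g + g n) ⟩
  ∣ ∑ n f + f n - ∑ n g + f n ∣ + ∣ ∑ n g + f n - ∑ n g + g n ∣
    ≡⟨ cong₂ _+_ (trans (cong₂ ∣_-_∣ (+-comm (∑ n f) (f n)) (+-comm (∑ n g) (f n))) (∣m+n-m+o∣≡∣n-o∣ (f n) (∑ n f) (∑ n g)))
                 (∣m+n-m+o∣≡∣n-o∣ (∑ n g) (f n) (g n)) ⟩
  ∣ ∑ n f - ∑ n g ∣ + ∣ f n - g n ∣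
    ≤⟨ +-monoˡ-≤ _ (∑-distance n f g) ⟩
  (∑[ i < suc n ] ∣ f i - g i ∣) ∎
  where open ≤-Reasoning

∣-∣-intro : ∀ {a b e} → a ≤ b + e → b ≤ a + e → ∣ a - b ∣ ≤ e
∣-∣-intro {a} {b} {e} a≤b+e b≤a+e with ≤-total a b
... | inj₁ a≤b = ≤-trans (≤-reflexive (m≤n⇒∣m-n∣≡n∸m a≤b)) (m≤n+o⇒m∸n≤o b a b≤a+e)
... | inj₂ b≤a = ≤-trans (≤-reflexive (m≤n⇒∣n-m∣≡n∸m b≤a)) (m≤n+o⇒m∸n≤o a b a≤b+e)

∣-∣-elimʳ : ∀ {a b e} → ∣ a - b ∣ ≤ e → b ≤ a + e
∣-∣-elimʳ {a} {b} d = ≤-trans (m≤n+∣n-m∣ b a) (+-monoʳ-≤ a d)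

ind : ∀ {p} {P : Set p} → Dec P → ℕ
ind (yes _) = 1
ind (no _)  = 0

ind≤1 : ∀ {p} {P : Set p} (P? : Dec P) → ind P? ≤ 1
ind≤1 (yes _) = ≤-refl
ind≤1 (no _)  = z≤n

ind-mono : ∀ {p q} {P : Set p} {Q : Set q} (P? : Dec P) (Q? : Dec Q) → (P → Q) → ind P? ≤ ind Q?
ind-mono (no _)  _       _   = z≤n
ind-mono (yes p) (yes _) _   = ≤-refl
ind-mono (yes p) (no ¬q) p⇒q = contradiction (p⇒q p) ¬q

ind-cong : ∀ {p q} {P : Set p} {Q : Set q} (P? : Dec P) (Q? : Dec Q) → (P → Q) → (Q → P) → ind P? ≡ ind Q?
ind-cong P? Q? f g = ≤-antisym (ind-mono P? Q? f) (ind-mono Q? P? g)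

ind-yes : ∀ {p} {P : Set p} (P? : Dec P) → P → ind P? ≡ 1
ind-yes (yes _) _ = refl
ind-yes (no ¬p) p = contradiction p ¬p

ind-no : ∀ {p} {P : Set p} (P? : Dec P) → ¬ P → ind P? ≡ 0
ind-no (yes p) ¬p = contradiction p ¬p
ind-no (no _)  _  = refl

ind-× : ∀ {p q r} {P : Set p} {Q : Set q} {R : Set r} (R? : Dec R) (P? : Dec P) (Q? : Dec Q) →
        (R → P × Q) → (P → Q → R) → ind R? ≡ ind P? * ind Q?
ind-× R? (yes p) (yes q) f g = ind-yes R? (g p q)
ind-× R? (yes p) (no ¬q) f g = ind-no R? (¬q ∘ proj₂ ∘ f)
ind-× R? (no ¬p) _       f g = ind-no R? (¬p ∘ proj₁ ∘ f)

∑-ind-≡ : ∀ n {c} → c < n → (∑[ i < n ] ind (i ≟ c)) ≡ 1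
∑-ind-≡ n {c} c<n = begin
  (∑[ i < n ] δ i)                         ≡⟨ cong (λ k → ∑ k δ) (m+[n∸m]≡n c<n) ⟨
  (∑[ i < suc c + (n ∸ suc c) ] δ i)        ≡⟨ ∑-split (suc c) (n ∸ suc c) δ ⟩
  ∑ c δ + δ c + (∑[ i < n ∸ suc c ] δ (suc c + i))
    ≡⟨ cong₂ _+_ (cong₂ _+_ below (ind-yes (c ≟ c) refl)) above ⟩
  1 ∎
  where
  open ≡-Reasoning
  δ : ℕ → ℕ
  δ i = ind (i ≟ c)
  below : ∑ c δ ≡ 0
  below = trans (∑-cong c λ i i<c → ind-no (i ≟ c) (<⇒≢ i<c)) (∑-zero c)
  above : (∑[ i < n ∸ suc c ] δ (suc c + i)) ≡ 0
  above = trans (∑-ext (n ∸ suc c) λ i → ind-no (suc c + i ≟ c) (≢-sym (<⇒≢ (m≤m+n (suc c) i)))) (∑-zero (n ∸ suc c))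

∑-ind≤1 : ∀ n {p} {P : ℕ → Set p} (P? : ∀ i → Dec (P i)) →
          (∀ {i j} → i < j → j < n → P i → P j → ⊥) → (∑[ i < n ] ind (P? i)) ≤ 1
∑-ind≤1 zero    P? uniq = z≤n
∑-ind≤1 (suc n) P? uniq with P? n
... | no _   = ≤-trans (≤-reflexive (+-identityʳ _)) (∑-ind≤1 n P? λ i<j j<n → uniq i<j (m<n⇒m<1+n j<n))
... | yes pn = ≤-reflexive (cong (_+ 1)
  (trans (∑-cong n λ i i<n → ind-no (P? i) λ pi → uniq i<n ≤-refl pi pn) (∑-zero n)))

∑-select : ∀ n (f : ℕ → ℕ) {c} → c < n → (∑[ i < n ] (ind (i ≟ c) * f i)) ≡ f c
∑-select n f {c} c<n = begin
  (∑[ i < n ] (ind (i ≟ c) * f i)) ≡⟨ ∑-ext n (λ i → at i (i ≟ c)) ⟩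
  (∑[ i < n ] (ind (i ≟ c) * f c)) ≡⟨ ∑-*ʳ n (f c) _ ⟩
  (∑[ i < n ] ind (i ≟ c)) * f c   ≡⟨ cong (_* f c) (∑-ind-≡ n c<n) ⟩
  1 * f c                          ≡⟨ *-identityˡ (f c) ⟩
  f c                              ∎
  where
  open ≡-Reasoning
  at : ∀ i (i≟c : Dec (i ≡ c)) → ind i≟c * f i ≡ ind i≟c * f c
  at i (yes refl) = refl
  at i (no _)     = refl

-- Pigeonhole: all terms but one add up to at most one less than the total, so the remaining term
-- must reach its bound 1.
∑-saturated : ∀ n {c} → (∀ i → i < n → c i ≤ 1) → ∑ n c ≡ n → ∀ i → i < n → c i ≡ 1
∑-saturated (suc n) {c} c≤1 eq i i<1+n with m≤n⇒m<n∨m≡n (s≤s⁻¹ i<1+n)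
... | inj₁ i<n  = ∑-saturated n (λ j j<n → c≤1 j (m<n⇒m<1+n j<n)) ∑≡n i i<n
  where
  ∑≤n : ∑ n c ≤ n
  ∑≤n = ≤-trans (∑-mono n λ j j<n → c≤1 j (m<n⇒m<1+n j<n)) (≤-reflexive (trans (∑-const n 1) (*-identityʳ n)))
  ∑≡n : ∑ n c ≡ n
  ∑≡n = ≤-antisym ∑≤n (+-cancelʳ-≤ 1 n (∑ n c)
    (≤-trans (≤-reflexive (trans (+-comm n 1) (sym eq))) (+-monoʳ-≤ (∑ n c) (c≤1 n ≤-refl))))
... | inj₂ refl = ≤-antisym (c≤1 n ≤-refl) (+-cancelˡ-≤ n 1 (c n)
    (≤-trans (≤-reflexive (trans (+-comm n 1) (sym eq))) (+-monoˡ-≤ (c n) ∑≤n)))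
  where
  ∑≤n : ∑ n c ≤ n
  ∑≤n = ≤-trans (∑-mono n λ j j<n → c≤1 j (m<n⇒m<1+n j<n)) (≤-reflexive (trans (∑-const n 1) (*-identityʳ n)))

-- Each value is hit at most once, and n values are hit in total.
∑-reindex : ∀ n (π : ℕ → ℕ) → (∀ i → i < n → π i < n) →
            (∀ {i j} → i < j → j < n → π i ≢ π j) → ∀ f → (∑[ i < n ] f (π i)) ≡ ∑ n f
∑-reindex n π π< π-inj f = begin
  (∑[ i < n ] f (π i))                                  ≡⟨ ∑-cong n (λ i i<n → sym (∑-select n f (π< i i<n))) ⟩
  (∑[ i < n ] ∑[ v < n ] (ind (v ≟ π i) * f v))          ≡⟨ ∑-swap n n _ ⟩
  (∑[ v < n ] ∑[ i < n ] (ind (v ≟ π i) * f v))          ≡⟨ ∑-ext n (λ v → ∑-*ʳ n (f v) _) ⟩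
  (∑[ v < n ] (hits v * f v))                           ≡⟨ ∑-cong n (λ v v<n → trans (cong (_* f v) (hits≡1 v v<n)) (*-identityˡ (f v))) ⟩
  ∑ n f                                                 ∎
  where
  open ≡-Reasoning
  hits : ℕ → ℕ
  hits v = ∑[ i < n ] ind (v ≟ π i)
  hits≡1 : ∀ v → v < n → hits v ≡ 1
  hits≡1 = ∑-saturated n
    (λ v _ → ∑-ind≤1 n (λ i → v ≟ π i) λ i<j j<n v≡πi v≡πj → π-inj i<j j<n (trans (sym v≡πi) v≡πj))
    (trans (∑-swap n n _) (trans (∑-cong n λ i i<n → ∑-ind-≡ n (π< i i<n)) (trans (∑-const n 1) (*-identityʳ n))))

Periodic : ℕ → (ℕ → ℕ) → Set
Periodic m f = ∀ n → f (m + n) ≡ f n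

periodic-* : ∀ {m f} → Periodic m f → ∀ q n → f (q * m + n) ≡ f n
periodic-* {m} {f} per zero    n = refl
periodic-* {m} {f} per (suc q) n =
  trans (cong f (+-assoc m (q * m) n)) (trans (per (q * m + n)) (periodic-* per q n))

periodic-multiple : ∀ {m f} → Periodic m f → ∀ {n} → m ∣ n → Periodic n f
periodic-multiple per (divides q refl) = periodic-* per q

periodic-% : ∀ {m f} .{{_ : NonZero m}} → Periodic m f → ∀ n → f (n % m) ≡ f n
periodic-% {m} {f} per n = begin
  f (n % m)               ≡⟨ periodic-* per (n / m) (n % m) ⟨
  f (n / m * m + n % m)   ≡⟨ cong f (+-comm (n / m * m) (n % m)) ⟩
  f (n % m + n / m * m)   ≡⟨ cong f (m≡m%n+[m/n]*n n m) ⟨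
  f n                     ∎
  where open ≡-Reasoning

∑-blocks : ∀ K m f → ∑ (K * m) f ≡ (∑[ j < K ] ∑[ i < m ] f (j * m + i))
∑-blocks zero    m f = refl
∑-blocks (suc K) m f = begin
  ∑ (m + K * m) f                            ≡⟨ cong (λ k → ∑ k f) (+-comm m (K * m)) ⟩
  ∑ (K * m + m) f                            ≡⟨ ∑-split (K * m) m f ⟩
  ∑ (K * m) f + (∑[ i < m ] f (K * m + i))   ≡⟨ cong (_+ (∑[ i < m ] f (K * m + i))) (∑-blocks K m f) ⟩
  (∑[ j < suc K ] ∑[ i < m ] f (j * m + i))  ∎
  where open ≡-Reasoning

∑-periods : ∀ {m f} → Periodic m f → ∀ q → ∑ (q * m) f ≡ q * ∑ m f
∑-periods {m} {f} per q = trans (∑-blocks q m f)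
  (trans (∑-ext q λ j → ∑-ext m λ i → periodic-* per j i) (∑-const q (∑ m f)))

-- Integers are counted from 1 to y but periods are summed from 0. The shift trades `f 0` for `f m`,
-- which periodicity makes equal.
∑-shift : ∀ {m f} → Periodic m f → ∑ m (f ∘ suc) ≡ ∑ m f
∑-shift {m} {f} per = +-cancelˡ-≡ (f 0) _ _ (begin
  f 0 + ∑ m (f ∘ suc) ≡⟨ ∑-head m f ⟨
  ∑ m f + f m         ≡⟨ cong (∑ m f +_) (trans (cong f (sym (+-identityʳ m))) (per 0)) ⟩
  ∑ m f + f 0         ≡⟨ +-comm (∑ m f) (f 0) ⟩
  f 0 + ∑ m f         ∎)
  where open ≡-Reasoning

module _ {m f} .{{_ : NonZero m}} (per : Periodic m f) where
  private
    f′ : ℕ → ℕ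
    f′ = f ∘ suc
    per′ : Periodic m f′
    per′ n = trans (cong f (sym (+-suc m n))) (per (suc n))
    whole : ∀ y → ∑ (y / m * m) f′ ≡ y / m * ∑ m f
    whole y = trans (∑-periods per′ (y / m)) (cong (y / m *_) (∑-shift per))

  ∑-periodic-lower : ∀ y → y / m * ∑ m f ≤ ∑ y f′
  ∑-periodic-lower y = ≤-trans (≤-reflexive (sym (whole y))) (∑-≤-index f′ (m/n*n≤m y m))

  -- Beyond the `y / m` complete periods fewer than m terms are left, each at most B.
  ∑-periodic-upper : ∀ {B} → (∀ n → f n ≤ B) → ∀ y → ∑ y f′ ≤ y / m * ∑ m f + m * B
  ∑-periodic-upper {B} f≤B y = begin
    ∑ y f′                                                ≡⟨ cong (λ k → ∑ k f′) (trans (m≡m%n+[m/n]*n y m) (+-comm (y % m) _)) ⟩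
    ∑ (y / m * m + y % m) f′                              ≡⟨ ∑-split (y / m * m) (y % m) f′ ⟩
    ∑ (y / m * m) f′ + (∑[ i < y % m ] f′ (y / m * m + i)) ≤⟨ +-mono-≤ (≤-reflexive (whole y)) (∑-mono (y % m) λ i _ → f≤B _) ⟩
    y / m * ∑ m f + (∑[ i < y % m ] B)                    ≡⟨ cong (y / m * ∑ m f +_) (∑-const (y % m) B) ⟩
    y / m * ∑ m f + y % m * B                             ≤⟨ +-monoʳ-≤ (y / m * ∑ m f) (*-monoˡ-≤ B (m%n≤n y m)) ⟩
    y / m * ∑ m f + m * B                                 ∎
    where open ≤-Reasoning

-- The Chinese remainder theorem

-- No order between a and b is assumed: for b ≤ a the truncated difference is 0, which n divides as
-- well.
%≡⇒∣∸ : ∀ a b n .{{_ : NonZero n}} → a % n ≡ b % n → n ∣ b ∸ a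
%≡⇒∣∸ a b n eq = divides (b / n ∸ a / n) (begin
  b ∸ a                                        ≡⟨ cong₂ _∸_ (m≡m%n+[m/n]*n b n) (m≡m%n+[m/n]*n a n) ⟩
  (b % n + b / n * n) ∸ (a % n + a / n * n)    ≡⟨ cong (λ r → (b % n + b / n * n) ∸ (r + a / n * n)) eq ⟩
  (b % n + b / n * n) ∸ (b % n + a / n * n)    ≡⟨ [m+n]∸[m+o]≡n∸o (b % n) _ _ ⟩
  b / n * n ∸ a / n * n                        ≡⟨ *-distribʳ-∸ n (b / n) (a / n) ⟨
  (b / n ∸ a / n) * n                          ∎)
  where open ≡-Reasoning

coprime-* : ∀ {m a b} → Coprime m a → Coprime m b → Coprime m (a * b)
coprime-* {m} {a} m⊥a m⊥b (d∣m , d∣ab) = m⊥b (d∣m , coprime-divisor (λ (e∣d , e∣a) → m⊥a (∣-trans e∣d d∣m , e∣a)) d∣ab)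

-- As m is invertible modulo K, the map `j ↦ j * m + i` permutes the residues modulo K.
∑-progression : ∀ {m K} .{{_ : NonZero K}} → Coprime m K → ∀ {H} → Periodic K H →
                ∀ i → (∑[ j < K ] H (j * m + i)) ≡ ∑ K H
∑-progression {m} {K} m⊥K {H} perH i = trans
  (∑-ext K λ j → sym (periodic-% perH (j * m + i)))
  (∑-reindex K π (λ j _ → m%n<n (j * m + i) K) π-inj H)
  where
  π : ℕ → ℕ
  π j = (j * m + i) % K
  π-inj : ∀ {j j′} → j < j′ → j′ < K → π j ≢ π j′
  -- A collision makes K divide `m * (j′ ∸ j)`, hence `j′ ∸ j`, which is positive and below K.
  π-inj {j} {j′} j<j′ j′<K eq = >⇒∤ {{>-nonZero (m<n⇒0<n∸m j<j′)}} (≤-<-trans (m∸n≤m j′ j) j′<K)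
    (coprime-divisor (coprime-sym m⊥K) (subst (K ∣_) diff (%≡⇒∣∸ (j * m + i) (j′ * m + i) K eq)))
    where
    diff : (j′ * m + i) ∸ (j * m + i) ≡ m * (j′ ∸ j)
    diff = begin
      (j′ * m + i) ∸ (j * m + i) ≡⟨ [m+n]∸[o+n]≡m∸o (j′ * m) i (j * m) ⟩
      j′ * m ∸ j * m             ≡⟨ *-distribʳ-∸ m j′ j ⟨
      (j′ ∸ j) * m               ≡⟨ *-comm (j′ ∸ j) m ⟩
      m * (j′ ∸ j)               ∎
      where
      open ≡-Reasoning
      [m+n]∸[o+n]≡m∸o : ∀ a b c → (a + b) ∸ (c + b) ≡ a ∸ c
      [m+n]∸[o+n]≡m∸o a b c = trans (cong₂ _∸_ (+-comm a b) (+-comm c b)) ([m+n]∸[m+o]≡n∸o b a c)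

-- Cut the range into K blocks of length m. F sees only the position i inside a block, while for
-- fixed i the block number takes H through all residues modulo K.
∑-crt : ∀ {m K} .{{_ : NonZero K}} → Coprime m K → ∀ {F H} → Periodic m F → Periodic K H →
        (∑[ n < K * m ] (F n * H n)) ≡ ∑ m F * ∑ K H
∑-crt {m} {K} m⊥K {F} {H} perF perH = begin
  (∑[ n < K * m ] (F n * H n))                             ≡⟨ ∑-blocks K m _ ⟩
  (∑[ j < K ] ∑[ i < m ] (F (j * m + i) * H (j * m + i)))  ≡⟨ ∑-ext K (λ j → ∑-ext m λ i → cong (_* H (j * m + i)) (periodic-* perF j i)) ⟩
  (∑[ j < K ] ∑[ i < m ] (F i * H (j * m + i)))            ≡⟨ ∑-swap K m _ ⟩
  (∑[ i < m ] ∑[ j < K ] (F i * H (j * m + i)))            ≡⟨ ∑-ext m (λ i → trans (∑-*ˡ K (F i) _) (cong (F i *_) (∑-progression m⊥K perH i))) ⟩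
  (∑[ i < m ] (F i * ∑ K H))                               ≡⟨ ∑-*ʳ m (∑ K H) F ⟩
  ∑ m F * ∑ K H                                            ∎
  where open ≡-Reasoning

∑∑ : ℕ → (ℕ → ℕ → ℕ) → ℕ
∑∑ n F = ∑[ i < n ] ∑[ j < n ] F i j

record Periodic₂ (m : ℕ) (F : ℕ → ℕ → ℕ) : Set where
  constructor _,ₚ_
  field
    inFirst  : ∀ b → Periodic m (λ a → F a b)
    inSecond : ∀ a → Periodic m (F a)

open Periodic₂ public

∑-periodic : ∀ {m} {F : ℕ → ℕ → ℕ} → (∀ b → Periodic m (λ a → F a b)) → ∀ n → Periodic m (λ a → ∑ n (F a))
∑-periodic per n a = ∑-ext n λ b → per b a

*-periodic : ∀ {m f g} → Periodic m f → Periodic m g → Periodic m (λ n → f n * g n)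
*-periodic perf perg n = cong₂ _*_ (perf n) (perg n)

*-periodic₂ : ∀ {m K F G} → Periodic₂ m F → Periodic₂ K G → Periodic₂ (K * m) (λ a b → F a b * G a b)
*-periodic₂ {m} {K} (F₁ ,ₚ F₂) (G₁ ,ₚ G₂) =
  (λ b → *-periodic (periodic-multiple (F₁ b) (n∣m*n K)) (periodic-multiple (G₁ b) (m∣m*n m))) ,ₚ
  (λ a → *-periodic (periodic-multiple (F₂ a) (n∣m*n K)) (periodic-multiple (G₂ a) (m∣m*n m)))

-- The one-variable statement is applied first in b; the inner sums it produces are again periodic
-- in a, so it applies once more.
∑∑-crt : ∀ {m K} .{{_ : NonZero K}} → Coprime m K → ∀ {F G} → Periodic₂ m F → Periodic₂ K G →
         ∑∑ (K * m) (λ a b → F a b * G a b) ≡ ∑∑ m F * ∑∑ K G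
∑∑-crt {m} {K} m⊥K {F} {G} (F₁ ,ₚ F₂) (G₁ ,ₚ G₂) = trans
  (∑-ext (K * m) λ a → ∑-crt m⊥K (F₂ a) (G₂ a))
  (∑-crt m⊥K (∑-periodic F₁ m) (∑-periodic G₁ K))

∏ : ∀ {n} → (Fin n → ℕ) → ℕ
∏ {zero}  f = 1
∏ {suc n} f = f zero * ∏ (f ∘ suc)

∏-nonZero : ∀ {n} (f : Fin n → ℕ) → (∀ i → NonZero (f i)) → NonZero (∏ f)
∏-nonZero {zero}  f nz = _
∏-nonZero {suc n} f nz = m*n≢0 (f zero) _ {{nz zero}} {{∏-nonZero (f ∘ suc) (nz ∘ suc)}}

coprime-∏ : ∀ {m n} (f : Fin n → ℕ) → (∀ i → Coprime m (f i)) → Coprime m (∏ f)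
coprime-∏ {n = zero}  f m⊥f = coprime-sym (1-coprimeTo _)
coprime-∏ {n = suc n} f m⊥f = coprime-* (m⊥f zero) (coprime-∏ (f ∘ suc) (m⊥f ∘ suc))

∏-∣ : ∀ {n} (f : Fin n → ℕ) i → f i ∣ ∏ f
∏-∣ f zero    = m∣m*n _
∏-∣ f (suc i) = ∣n⇒∣m*n (f zero) (∏-∣ (f ∘ suc) i)

∏-≤1 : ∀ {n} (f : Fin n → ℕ) → (∀ i → f i ≤ 1) → ∏ f ≤ 1
∏-≤1 {zero}  f f≤1 = ≤-refl
∏-≤1 {suc n} f f≤1 = *-mono-≤ (f≤1 zero) (∏-≤1 (f ∘ suc) (f≤1 ∘ suc))

∏-cong : ∀ {n} {f g : Fin n → ℕ} → (∀ i → f i ≡ g i) → ∏ f ≡ ∏ g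
∏-cong {zero}  f≗g = refl
∏-cong {suc n} f≗g = cong₂ _*_ (f≗g zero) (∏-cong (f≗g ∘ suc))

private
  interchange* : ∀ a b c d → (a * b) * (c * d) ≡ (a * c) * (b * d)
  interchange* = solve-∀

∏-* : ∀ {n} (f g : Fin n → ℕ) → ∏ (λ i → f i * g i) ≡ ∏ f * ∏ g
∏-* {zero}  f g = refl
∏-* {suc n} f g = trans (cong (f zero * g zero *_) (∏-* (f ∘ suc) (g ∘ suc))) (interchange* (f zero) (g zero) _ _)

∏-periodic₂ : ∀ {n} (m : Fin n → ℕ) (F : Fin n → ℕ → ℕ → ℕ) → (∀ i → Periodic₂ (m i) (F i)) →
              Periodic₂ (∏ m) (λ a b → ∏ λ i → F i a b)
∏-periodic₂ m F per =
  (λ b a → ∏-cong λ i → periodic-multiple (inFirst (per i) b) (∏-∣ m i) a) ,ₚ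
  (λ a b → ∏-cong λ i → periodic-multiple (inSecond (per i) a) (∏-∣ m i) b)

∑∑-∏ : ∀ {n} (m : Fin n → ℕ) (F : Fin n → ℕ → ℕ → ℕ) → (∀ i → NonZero (m i)) →
       (∀ {i j} → i ≢ j → Coprime (m i) (m j)) → (∀ i → Periodic₂ (m i) (F i)) →
       ∑∑ (∏ m) (λ a b → ∏ λ i → F i a b) ≡ ∏ λ i → ∑∑ (m i) (F i)
∑∑-∏ {zero}  m F nz cop per = refl
∑∑-∏ {suc n} m F nz cop per = begin
  ∑∑ (∏ m) (λ a b → F zero a b * ∏ λ i → F (suc i) a b)
    ≡⟨ ∑-ext (∏ m) (λ a → ∑-ext (∏ m) λ b → *-comm (F zero a b) _) ⟩
  ∑∑ (m zero * ∏ (m ∘ suc)) (λ a b → (∏ λ i → F (suc i) a b) * F zero a b)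
    ≡⟨ ∑∑-crt {{nz zero}} rest⊥head (∏-periodic₂ (m ∘ suc) (F ∘ suc) (per ∘ suc)) (per zero) ⟩
  ∑∑ (∏ (m ∘ suc)) (λ a b → ∏ λ i → F (suc i) a b) * ∑∑ (m zero) (F zero)
    ≡⟨ *-comm _ (∑∑ (m zero) (F zero)) ⟩
  ∑∑ (m zero) (F zero) * ∑∑ (∏ (m ∘ suc)) (λ a b → ∏ λ i → F (suc i) a b)
    ≡⟨ cong (∑∑ (m zero) (F zero) *_) (∑∑-∏ (m ∘ suc) (F ∘ suc) (nz ∘ suc) (λ i≢j → cop (i≢j ∘ Fin-suc-injective)) (per ∘ suc)) ⟩
  (∏ λ i → ∑∑ (m i) (F i)) ∎
  where
  open ≡-Reasoning
  rest⊥head : Coprime (∏ (m ∘ suc)) (m zero)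
  rest⊥head = coprime-sym (coprime-∏ (m ∘ suc) λ i → cop λ ())

-- Counting multiples, and summing over squares

∑-multiples : ∀ d .{{_ : NonZero d}} y → (∑[ j < y ] ind (d ∣? suc j)) ≤ y / d
∑-multiples d y with go y
  where
  count : ℕ → ℕ
  count y = ∑[ j < y ] ind (d ∣? suc j)
  -- The invariant is the division of y by d: a multiple of d is met exactly when the remainder
  -- would reach d, and it resets the remainder to 0.
  go : ∀ y → ∃[ r ] r < d × y ≡ count y * d + r
  go zero    = 0 , >-nonZero⁻¹ d , refl
  go (suc y) with go y | d ∣? suc y
  ... | r , r<d , y≡ | yes d∣1+y = 0 , >-nonZero⁻¹ d , (begin
    suc y                   ≡⟨ cong suc y≡ ⟩
    suc (count y * d + r)   ≡⟨ +-suc (count y * d) r ⟨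
    count y * d + suc r     ≡⟨ cong (count y * d +_) 1+r≡d ⟩
    count y * d + d         ≡⟨ lem (count y) d ⟩
    (count y + 1) * d + 0   ∎)
    where
    open ≡-Reasoning
    lem : ∀ c d → c * d + d ≡ (c + 1) * d + 0
    lem = solve-∀
    d∣1+r : d ∣ suc r
    d∣1+r = ∣m+n∣m⇒∣n (subst (d ∣_) (trans (cong suc y≡) (sym (+-suc (count y * d) r))) d∣1+y) (n∣m*n (count y))
    1+r≡d : suc r ≡ d
    1+r≡d = ≤-antisym r<d (∣⇒≤ d∣1+r)
  ... | r , r<d , y≡ | no d∤1+y = suc r , ≤∧≢⇒< r<d 1+r≢d , (begin
    suc y                       ≡⟨ cong suc y≡ ⟩
    suc (count y * d + r)       ≡⟨ lem (count y) d r ⟩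
    (count y + 0) * d + suc r   ∎)
    where
    open ≡-Reasoning
    lem : ∀ c d r → suc (c * d + r) ≡ (c + 0) * d + suc r
    lem = solve-∀
    1+r≢d : suc r ≢ d
    1+r≢d 1+r≡d = d∤1+y (subst (d ∣_) (trans (+-suc (count y * d) r) (cong suc (sym y≡)))
      (∣m∣n⇒∣m+n (n∣m*n (count y)) (subst (d ∣_) (sym 1+r≡d) ∣-refl)))
... | r , _ , y≡ = begin
  c            ≡⟨ m*n/n≡m c d ⟨
  c * d / d    ≤⟨ /-monoˡ-≤ d (≤-trans (m≤m+n (c * d) r) (≤-reflexive (sym y≡))) ⟩
  y / d        ∎
  where
  open ≤-Reasoning
  c = ∑[ j < y ] ind (d ∣? suc j)

square : ℕ → ℕ
square n = n * n

-- ⌊y/(d+1)²⌋ ≤ ⌊y/d⌋ − ⌊y/(d+1)⌋, which telescopes.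
∑-inverse-squares : ∀ q y t →
  (∑[ i < t ] (y / square (suc (suc q + i)))) + y / (suc q + t) ≤ y / suc q
∑-inverse-squares q y zero    = ≤-reflexive (/-congʳ {m = y} (+-identityʳ (suc q)))
∑-inverse-squares q y (suc t) = begin
  ∑ t term + term t + y / (suc q + suc t)   ≡⟨ +-assoc (∑ t term) (term t) _ ⟩
  ∑ t term + (term t + y / (suc q + suc t)) ≡⟨ cong (λ z → ∑ t term + (term t + z)) (/-congʳ {m = y} (+-suc (suc q) t)) ⟩
  ∑ t term + (term t + y / suc D)           ≤⟨ +-monoʳ-≤ (∑ t term) step ⟩
  ∑ t term + y / D                          ≤⟨ ∑-inverse-squares q y t ⟩
  y / suc q                                 ∎
  where
  open ≤-Reasoning
  D = suc q + t
  term : ℕ → ℕ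
  term i = y / square (suc (suc q + i))
  z = y / square (suc D)
  w = y / suc D
  z[1+D]≤w : z * suc D ≤ w
  z[1+D]≤w = ≤-trans (≤-reflexive (cong (_* suc D) (sym (m/n/o≡m/[n*o] y (suc D) (suc D))))) (m/n*n≤m w (suc D))
  lem₁ : ∀ z w d → (z + w) * d ≡ z * d + w * d
  lem₁ = solve-∀
  step : z + w ≤ y / D
  step = begin
    z + w             ≡⟨ m*n/n≡m (z + w) D ⟨
    (z + w) * D / D   ≤⟨ /-monoˡ-≤ D (begin
      (z + w) * D     ≡⟨ lem₁ z w D ⟩
      z * D + w * D   ≤⟨ +-monoˡ-≤ (w * D) (≤-trans (*-monoʳ-≤ z (n≤1+n D)) z[1+D]≤w) ⟩
      w + w * D       ≡⟨ *-suc w D ⟨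
      w * suc D       ≤⟨ m/n*n≤m y (suc D) ⟩
      y               ∎) ⟩
    y / D             ∎

-- The sieve

modulus-factor : ∀ {P : Set} → Dec P → ℕ → ℕ
modulus-factor (yes _) n = n
modulus-factor (no _)  n = 1

prime-∤⇒coprime : ∀ {p m} → Prime p → p ∤ m → Coprime m p
prime-∤⇒coprime pr p∤m (d∣m , d∣p) with prime⇒irreducible pr d∣p
... | inj₁ d≡1  = d≡1
... | inj₂ refl = contradiction d∣m p∤m

ind-∣-periodic : ∀ d → Periodic d (λ n → ind (d ∣? n))
ind-∣-periodic d n = ind-cong (d ∣? d + n) (d ∣? n) (λ h → ∣m+n∣m⇒∣n h ∣-refl) (∣m∣n⇒∣m+n ∣-refl)

-- The arithmetic of `equidistribution`. S and Sg count, without and with weight, what survives the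
-- sieve up to Q; A and Ag count what survives all sifting. Over k periods S and Sg have main terms
-- `k * (M * u)` and `k * (u * W)`, which agree after multiplication by W and M. What is left is the
-- incomplete period, of length at most N, and the passage from S to A, which costs `Q + y` after
-- multiplication by Q.
∣-∣-sandwich : ∀ Q M N B y k u {W S Sg A Ag} → W ≤ M * B →
  k * (M * u) ≤ S → S ≤ k * (M * u) + N * 1 → k * (u * W) ≤ Sg → Sg ≤ k * (u * W) + N * B →
  A ≤ S → Q * S ≤ Q * A + (Q + y) → Ag ≤ Sg → Q * Sg ≤ Q * Ag + (Q + y) * B →
  Q * ∣ M * Ag - W * A ∣ ≤ B * (M * y + (M * Q + Q * M * N))
∣-∣-sandwich Q M N B y k u {W} {S} {Sg} {A} {Ag} W≤MB S-lower S-upper Sg-lower Sg-upper A≤S QS≤ Ag≤Sg QSg≤ = ≤-trans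
  (≤-reflexive (*-distribˡ-∣-∣ Q (M * Ag) (W * A)))
  (∣-∣-intro upper lower)
  where
  open ≤-Reasoning
  e₁ : ∀ Q M k u W N B → Q * (M * (k * (u * W) + N * B)) ≡ W * (Q * (k * (M * u))) + Q * M * N * B
  e₁ = solve-∀
  e₂ : ∀ Q M W A N B y → W * (Q * A + (Q + y)) + Q * M * N * B ≡ Q * (W * A) + (W * (Q + y) + Q * M * N * B)
  e₂ = solve-∀
  e₃ : ∀ Q M N B y → M * B * (Q + y) + Q * M * N * B ≡ B * (M * y + (M * Q + Q * M * N))
  e₃ = solve-∀
  e₄ : ∀ Q M k u W N → Q * (W * (k * (M * u) + N * 1)) ≡ M * (Q * (k * (u * W))) + Q * W * N
  e₄ = solve-∀
  e₅ : ∀ Q M Ag N B y → M * (Q * Ag + (Q + y) * B) + Q * (M * B) * N ≡ Q * (M * Ag) + B * (M * y + (M * Q + Q * M * N))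
  e₅ = solve-∀

  upper : Q * (M * Ag) ≤ Q * (W * A) + B * (M * y + (M * Q + Q * M * N))
  upper = begin
    Q * (M * Ag)                                                ≤⟨ *-monoʳ-≤ Q (*-monoʳ-≤ M (≤-trans Ag≤Sg Sg-upper)) ⟩
    Q * (M * (k * (u * W) + N * B))                             ≡⟨ e₁ Q M k u W N B ⟩
    W * (Q * (k * (M * u))) + Q * M * N * B                     ≤⟨ +-monoˡ-≤ _ (*-monoʳ-≤ W (≤-trans (*-monoʳ-≤ Q S-lower) QS≤)) ⟩
    W * (Q * A + (Q + y)) + Q * M * N * B                       ≡⟨ e₂ Q M W A N B y ⟩
    Q * (W * A) + (W * (Q + y) + Q * M * N * B)                 ≤⟨ +-monoʳ-≤ (Q * (W * A)) (+-monoˡ-≤ _ (*-monoˡ-≤ (Q + y) W≤MB)) ⟩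
    Q * (W * A) + (M * B * (Q + y) + Q * M * N * B)             ≡⟨ cong (Q * (W * A) +_) (e₃ Q M N B y) ⟩
    Q * (W * A) + B * (M * y + (M * Q + Q * M * N))             ∎

  lower : Q * (W * A) ≤ Q * (M * Ag) + B * (M * y + (M * Q + Q * M * N))
  lower = begin
    Q * (W * A)                                                 ≤⟨ *-monoʳ-≤ Q (*-monoʳ-≤ W (≤-trans A≤S S-upper)) ⟩
    Q * (W * (k * (M * u) + N * 1))                             ≡⟨ e₄ Q M k u W N ⟩
    M * (Q * (k * (u * W))) + Q * W * N                         ≤⟨ +-mono-≤ (*-monoʳ-≤ M (≤-trans (*-monoʳ-≤ Q Sg-lower) QSg≤)) (*-monoˡ-≤ N (*-monoʳ-≤ Q W≤MB)) ⟩
    M * (Q * Ag + (Q + y) * B) + Q * (M * B) * N                ≡⟨ e₅ Q M Ag N B y ⟩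
    Q * (M * Ag) + B * (M * y + (M * Q + Q * M * N))            ∎

module Sieve (M : ℕ) .{{_ : NonZero M}} where

  Sifting : ℕ → Set
  Sifting q = Prime q × q ∤ M

  sifting? : ∀ q → Dec (Sifting q)
  sifting? q = prime? q ×-dec ¬? (q ∣? M)

  removes? : ∀ q a → Dec (Sifting q × square q ∣ a)
  removes? q a = sifting? q ×-dec square q ∣? a

  sieve : ℕ → ℕ → ℕ
  sieve zero    a = 1
  sieve (suc q) a = sieve q a * ind (¬? (removes? (suc q) a))

  modulus : ℕ → ℕ
  modulus zero    = 1
  modulus (suc q) = modulus q * modulus-factor (sifting? (suc q)) (square (suc q))

  modulus-nonZero : ∀ q → NonZero (modulus q)
  modulus-nonZero zero    = _
  modulus-nonZero (suc q) with sifting? (suc q)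
  ... | yes _ = m*n≢0 (modulus q) (square (suc q)) {{modulus-nonZero q}}
  ... | no _  = m*n≢0 (modulus q) 1 {{modulus-nonZero q}}

  modulus-coprime : ∀ q → Coprime M (modulus q)
  modulus-coprime zero    = coprime-sym (1-coprimeTo M)
  modulus-coprime (suc q) = coprime-* (modulus-coprime q) (factor-coprime (sifting? (suc q)))
    where
    factor-coprime : (s : Dec (Sifting (suc q))) → Coprime M (modulus-factor s (square (suc q)))
    factor-coprime (yes (pr , q∤M)) = coprime-* M⊥q M⊥q
      where
      M⊥q : Coprime M (suc q)
      M⊥q = prime-∤⇒coprime pr q∤M
    factor-coprime (no _)           = coprime-sym (1-coprimeTo M)

  sieve-periodic : ∀ q → Periodic (modulus q) (sieve q)
  sieve-periodic zero    a = refl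
  sieve-periodic (suc q) = *-periodic
    (periodic-multiple (sieve-periodic q) (m∣m*n _))
    (periodic-multiple factor-periodic (n∣m*n (modulus q)))
    where
    factor-periodic : Periodic (modulus-factor (sifting? (suc q)) (square (suc q))) (λ a → ind (¬? (removes? (suc q) a)))
    factor-periodic n with sifting? (suc q)
    ... | no _  = refl
    ... | yes s = ind-cong
      (¬? (yes s ×-dec square (suc q) ∣? square (suc q) + n)) (¬? (yes s ×-dec square (suc q) ∣? n))
      (λ h (_ , d) → h (s , ∣m∣n⇒∣m+n ∣-refl d)) (λ h (_ , d) → h (s , ∣m+n∣m⇒∣n d ∣-refl))

  sieve≤1 : ∀ q a → sieve q a ≤ 1
  sieve≤1 zero    a = ≤-refl
  sieve≤1 (suc q) a = *-mono-≤ (sieve≤1 q a) (ind≤1 (¬? (removes? (suc q) a)))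

  sieve-antitone : ∀ Q t a → sieve (Q + t) a ≤ sieve Q a
  sieve-antitone Q zero    a = ≤-reflexive (cong (λ k → sieve k a) (+-identityʳ Q))
  sieve-antitone Q (suc t) a = begin
    sieve (Q + suc t) a                                      ≡⟨ cong (λ k → sieve k a) (+-suc Q t) ⟩
    sieve (Q + t) a * ind (¬? (removes? (suc (Q + t)) a))    ≤⟨ *-monoʳ-≤ (sieve (Q + t) a) (ind≤1 (¬? (removes? (suc (Q + t)) a))) ⟩
    sieve (Q + t) a * 1                                      ≡⟨ *-identityʳ _ ⟩
    sieve (Q + t) a                                          ≤⟨ sieve-antitone Q t a ⟩
    sieve Q a                                                ∎
    where open ≤-Reasoning

  -- Union bound. Primality of the later sieving numbers is dropped, because the sum over all later
  -- squares is already small by `∑-inverse-squares`.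
  sieve-tail : ∀ Q t a → sieve Q a ≤ sieve (Q + t) a + (∑[ i < t ] ind (square (suc (Q + i)) ∣? a))
  sieve-tail Q zero    a = ≤-reflexive (trans (cong (λ k → sieve k a) (sym (+-identityʳ Q))) (sym (+-identityʳ _)))
  sieve-tail Q (suc t) a = begin
    sieve Q a                    ≤⟨ sieve-tail Q t a ⟩
    sieve D a + ∑ t caught       ≤⟨ +-monoˡ-≤ (∑ t caught) (step (sieve D a) (sieve≤1 D a) (removes? (suc D) a)) ⟩
    sieve D a * ind (¬? (removes? (suc D) a)) + caught t + ∑ t caught
                                 ≡⟨ trans (+-assoc (sieve (suc D) a) _ _) (cong (sieve (suc D) a +_) (+-comm (caught t) _)) ⟩
    sieve (suc D) a + ∑ (suc t) caught
                                 ≡⟨ cong (λ k → sieve k a + ∑ (suc t) caught) (sym (+-suc Q t)) ⟩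
    sieve (Q + suc t) a + ∑ (suc t) caught ∎
    where
    open ≤-Reasoning
    D = Q + t
    caught : ℕ → ℕ
    caught i = ind (square (suc (Q + i)) ∣? a)
    step : ∀ s → s ≤ 1 → (r : Dec (Sifting (suc D) × square (suc D) ∣ a)) → s ≤ s * ind (¬? r) + caught t
    step s s≤1 (no _)        = ≤-trans (≤-reflexive (sym (*-identityʳ s))) (m≤m+n (s * 1) _)
    step s s≤1 (yes (_ , d)) = ≤-trans s≤1 (≤-trans (≤-reflexive (sym (ind-yes (_ ∣? a) d))) (m≤n+m (caught t) _))

  -- The number 1 passes every local condition without being a discriminant, so it is taken out
  -- here. For 1 ≤ a ≤ X no square of a prime above X divides a, so sieving up to X is then the full
  -- sieve.
  sifted : ℕ → ℕ → ℕ
  sifted X a = ind (¬? (a ≟ 1)) * sieve X a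

  sifted≤1 : ∀ X a → sifted X a ≤ 1
  sifted≤1 X a = *-mono-≤ (ind≤1 (¬? (a ≟ 1))) (sieve≤1 X a)

  module _ (q t : ℕ) where
    private
      Q = suc q
      X = Q + t

    -- Bounds what `sieve Q` keeps and `sifted X` drops: the number 1 and the multiples of squares
    -- of integers in (Q, X].
    excess : ℕ → ℕ
    excess a = ind (a ≟ 1) + (∑[ i < t ] ind (square (suc (Q + i)) ∣? a))

    sifted≤sieve : ∀ a → sifted X a ≤ sieve Q a
    sifted≤sieve a = begin
      ind (¬? (a ≟ 1)) * sieve X a ≤⟨ *-monoˡ-≤ (sieve X a) (ind≤1 (¬? (a ≟ 1))) ⟩
      1 * sieve X a                ≡⟨ *-identityˡ (sieve X a) ⟩
      sieve X a                    ≤⟨ sieve-antitone Q t a ⟩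
      sieve Q a                    ∎
      where open ≤-Reasoning

    sieve≤sifted+excess : ∀ a → sieve Q a ≤ sifted X a + excess a
    sieve≤sifted+excess a with a ≟ 1
    ... | yes _ = ≤-trans (sieve≤1 Q a) (m≤m+n 1 _)
    ... | no _  = ≤-trans (sieve-tail Q t a) (≤-reflexive (cong (_+ (∑[ i < t ] ind (square (suc (Q + i)) ∣? a))) (sym (*-identityˡ (sieve X a)))))

    ∑-excess : ∀ y → Q * (∑[ j < y ] excess (suc j)) ≤ Q + y
    ∑-excess y = begin
      Q * (∑[ j < y ] excess (suc j))                    ≡⟨ cong (Q *_) (∑-+ y _ _) ⟩
      Q * ((∑[ j < y ] ind (suc j ≟ 1)) + (∑[ j < y ] ∑[ i < t ] ind (square (suc (Q + i)) ∣? suc j)))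
        ≤⟨ *-monoʳ-≤ Q (+-mono-≤ (∑-ind≤1 y (λ j → suc j ≟ 1) λ i<j _ i≡ j≡ → <⇒≢ i<j (suc-injective (trans i≡ (sym j≡)))) squares) ⟩
      Q * (1 + y / Q)                                    ≡⟨ *-distribˡ-+ Q 1 (y / Q) ⟩
      Q * 1 + Q * (y / Q)                                ≤⟨ +-mono-≤ (≤-reflexive (*-identityʳ Q)) (≤-trans (≤-reflexive (*-comm Q (y / Q))) (m/n*n≤m y Q)) ⟩
      Q + y                                              ∎
      where
      open ≤-Reasoning
      squares : (∑[ j < y ] ∑[ i < t ] ind (square (suc (Q + i)) ∣? suc j)) ≤ y / Q
      squares = begin
        (∑[ j < y ] ∑[ i < t ] ind (square (suc (Q + i)) ∣? suc j)) ≡⟨ ∑-swap y t _ ⟩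
        (∑[ i < t ] ∑[ j < y ] ind (square (suc (Q + i)) ∣? suc j)) ≤⟨ ∑-mono t (λ i _ → ∑-multiples (square (suc (Q + i))) y) ⟩
        (∑[ i < t ] (y / square (suc (Q + i))))                     ≤⟨ m≤m+n _ (y / X) ⟩
        (∑[ i < t ] (y / square (suc (Q + i)))) + y / X             ≤⟨ ∑-inverse-squares q y t ⟩
        y / Q ∎

    ∑-sieve≤ : ∀ {g : ℕ → ℕ} {B} → (∀ a → g a ≤ B) → ∀ y →
      Q * (∑[ j < y ] (sieve Q (suc j) * g (suc j))) ≤ Q * (∑[ j < y ] (sifted X (suc j) * g (suc j))) + (Q + y) * B
    ∑-sieve≤ {g} {B} g≤B y = begin
      Q * (∑[ j < y ] (sieve Q (suc j) * g (suc j)))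
        ≤⟨ *-monoʳ-≤ Q (∑-mono y λ j _ → pointwise (suc j)) ⟩
      Q * (∑[ j < y ] (sifted X (suc j) * g (suc j) + excess (suc j) * B))
        ≡⟨ cong (Q *_) (trans (∑-+ y _ _) (cong (Ag +_) (∑-*ʳ y B _))) ⟩
      Q * (Ag + E * B)        ≡⟨ trans (*-distribˡ-+ Q Ag (E * B)) (cong (Q * Ag +_) (sym (*-assoc Q E B))) ⟩
      Q * Ag + Q * E * B      ≤⟨ +-monoʳ-≤ (Q * Ag) (*-monoˡ-≤ B (∑-excess y)) ⟩
      Q * Ag + (Q + y) * B    ∎
      where
      open ≤-Reasoning
      Ag = ∑[ j < y ] (sifted X (suc j) * g (suc j))
      E  = ∑[ j < y ] excess (suc j)
      pointwise : ∀ a → sieve Q a * g a ≤ sifted X a * g a + excess a * B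
      pointwise a = begin
        sieve Q a * g a                      ≤⟨ *-monoˡ-≤ (g a) (sieve≤sifted+excess a) ⟩
        (sifted X a + excess a) * g a        ≡⟨ *-distribʳ-+ (g a) (sifted X a) (excess a) ⟩
        sifted X a * g a + excess a * g a    ≤⟨ +-monoʳ-≤ _ (*-monoʳ-≤ (excess a) (g≤B a)) ⟩
        sifted X a * g a + excess a * B      ∎

    -- The O_Q(1) of the sieve. `M * Q` stems from the removal of 1, the other term from an
    -- incomplete period of length `M * modulus Q`. It does not depend on `t`, hence not on the
    -- sifting bound X.
    errorConstant : ℕ
    errorConstant = M * Q + Q * M * (M * modulus Q)

    -- The weighted count is measured against the plain sifted count, so the density of the sieve
    -- appears on both sides and needs no evaluation.
    equidistribution : ∀ {g B} → Periodic M g → (∀ a → g a ≤ B) → ∀ y →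
      Q * ∣ M * (∑[ j < y ] (sifted X (suc j) * g (suc j))) - ∑ M g * (∑[ j < y ] sifted X (suc j)) ∣
        ≤ B * (M * y + errorConstant)
    equidistribution {g} {B} perg g≤B y = ∣-∣-sandwich Q M N B y (y / N) u W≤MB
      (subst (λ v → y / N * v ≤ S) full (∑-periodic-lower perS y))
      (subst (λ v → S ≤ y / N * v + N * 1) full (∑-periodic-upper perS (sieve≤1 Q) y))
      (subst (λ v → y / N * v ≤ Sg) fullg (∑-periodic-lower perSg y))
      (subst (λ v → Sg ≤ y / N * v + N * B) fullg (∑-periodic-upper perSg sg≤B y))
      (∑-mono y λ j _ → sifted≤sieve (suc j))
      QS≤
      (∑-mono y λ j _ → *-monoˡ-≤ (g (suc j)) (sifted≤sieve (suc j)))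
      (∑-sieve≤ {g} g≤B y)
      where
      open ≤-Reasoning
      K  = modulus Q
      N  = M * K
      A  = ∑[ j < y ] sifted X (suc j)
      Sg = ∑[ j < y ] (sieve Q (suc j) * g (suc j))
      S  = ∑[ j < y ] sieve Q (suc j)
      W  = ∑ M g
      u  = ∑ K (sieve Q)
      instance
        N≢0 : NonZero N
        N≢0 = m*n≢0 M K {{it}} {{modulus-nonZero Q}}

      perS : Periodic N (sieve Q)
      perS = periodic-multiple (sieve-periodic Q) (n∣m*n M)
      perSg : Periodic N (λ a → sieve Q a * g a)
      perSg = *-periodic perS (periodic-multiple perg (m∣m*n K))

      -- Over a common period N the plain and the weighted sum are in the exact ratio M : W, since
      -- `modulus Q` is coprime to M.
      full : ∑ N (sieve Q) ≡ M * u
      full = ∑-periods (sieve-periodic Q) M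
      fullg : (∑[ a < N ] (sieve Q a * g a)) ≡ u * W
      fullg = ∑-crt (coprime-sym (modulus-coprime Q)) (sieve-periodic Q) perg

      sg≤B : ∀ a → sieve Q a * g a ≤ B
      sg≤B a = ≤-trans (*-mono-≤ (sieve≤1 Q a) (g≤B a)) (≤-reflexive (*-identityˡ B))
      W≤MB : W ≤ M * B
      W≤MB = ≤-trans (∑-mono M λ a _ → g≤B a) (≤-reflexive (∑-const M B))
      QS≤ : Q * S ≤ Q * A + (Q + y)
      QS≤ = begin
        Q * S                                                   ≡⟨ cong (Q *_) (∑-ext y λ j → sym (*-identityʳ _)) ⟩
        Q * (∑[ j < y ] (sieve Q (suc j) * 1))                  ≤⟨ ∑-sieve≤ {λ _ → 1} (λ _ → ≤-refl) y ⟩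
        Q * (∑[ j < y ] (sifted X (suc j) * 1)) + (Q + y) * 1   ≡⟨ cong₂ (λ a b → Q * a + b) (∑-ext y λ j → *-identityʳ _) (*-identityʳ (Q + y)) ⟩
        Q * A + (Q + y) ∎

-- Sums over the hyperbola

hyperbola : ℕ → (ℕ → ℕ → ℕ) → ℕ
hyperbola x F = ∑[ i < x ] ∑[ j < x / suc i ] F (suc i) (suc j)

∑-ind-< : ∀ n k {p} {P : ℕ → Set p} (P? : ∀ j → Dec (P j)) → k ≤ n → (∀ j → P j → j < k) → (∀ j → j < k → P j) →
          ∀ f → (∑[ j < n ] (ind (P? j) * f j)) ≡ ∑ k f
∑-ind-< n k P? k≤n P⇒< <⇒P f = begin
  (∑[ j < n ] h j)                              ≡⟨ cong (λ m → ∑ m h) (m+[n∸m]≡n k≤n) ⟨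
  (∑[ j < k + (n ∸ k) ] h j)                     ≡⟨ ∑-split k (n ∸ k) h ⟩
  (∑[ j < k ] h j) + (∑[ j < n ∸ k ] h (k + j)) ≡⟨ cong₂ _+_ inside outside ⟩
  ∑ k f + 0                                     ≡⟨ +-identityʳ _ ⟩
  ∑ k f                                         ∎
  where
  open ≡-Reasoning
  h : ℕ → ℕ
  h j = ind (P? j) * f j
  inside : ∑ k h ≡ ∑ k f
  inside = ∑-cong k λ j j<k → trans (cong (_* f j) (ind-yes (P? j) (<⇒P j j<k))) (*-identityˡ (f j))
  outside : (∑[ j < n ∸ k ] h (k + j)) ≡ 0
  outside = trans
    (∑-ext (n ∸ k) λ j → cong (_* f (k + j)) (ind-no (P? (k + j)) λ p → <⇒≱ (P⇒< _ p) (m≤m+n k j)))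
    (∑-zero (n ∸ k))

hyperbola-box : ∀ x F → (∑[ i < x ] ∑[ j < x ] (ind (suc i * suc j ≤? x) * F (suc i) (suc j))) ≡ hyperbola x F
hyperbola-box x F = ∑-ext x λ i →
  ∑-ind-< x (x / suc i) (λ j → suc i * suc j ≤? x) (m/n≤m x (suc i)) (to i) (from i) (λ j → F (suc i) (suc j))
  where
  open ≤-Reasoning
  to : ∀ i j → suc i * suc j ≤ x → suc j ≤ x / suc i
  to i j le = begin
    suc j                   ≡⟨ m*n/n≡m (suc j) (suc i) ⟨
    suc j * suc i / suc i   ≤⟨ /-monoˡ-≤ (suc i) (≤-trans (≤-reflexive (*-comm (suc j) (suc i))) le) ⟩
    x / suc i               ∎
  from : ∀ i j → suc j ≤ x / suc i → suc i * suc j ≤ x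
  from i j le = begin
    suc i * suc j           ≡⟨ *-comm (suc i) (suc j) ⟩
    suc j * suc i           ≤⟨ *-monoˡ-≤ (suc i) le ⟩
    x / suc i * suc i       ≤⟨ m/n*n≤m x (suc i) ⟩
    x                       ∎

-- The detour through the square [1, x]² replaces the ranges, which depend on the order of
-- summation, by the symmetric condition ab ≤ x.
hyperbola-swap : ∀ x F → hyperbola x F ≡ hyperbola x (flip F)
hyperbola-swap x F = begin
  hyperbola x F
    ≡⟨ hyperbola-box x F ⟨
  (∑[ i < x ] ∑[ j < x ] (ind (suc i * suc j ≤? x) * F (suc i) (suc j)))
    ≡⟨ ∑-swap x x _ ⟩
  (∑[ j < x ] ∑[ i < x ] (ind (suc i * suc j ≤? x) * F (suc i) (suc j)))
    ≡⟨ ∑-ext x (λ j → ∑-ext x λ i → cong (_* F (suc i) (suc j)) (comm i j)) ⟩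
  (∑[ j < x ] ∑[ i < x ] (ind (suc j * suc i ≤? x) * F (suc i) (suc j)))
    ≡⟨ hyperbola-box x (flip F) ⟩
  hyperbola x (flip F)
    ∎
  where
  open ≡-Reasoning
  comm : ∀ i j → ind (suc i * suc j ≤? x) ≡ ind (suc j * suc i ≤? x)
  comm i j = ind-cong (suc i * suc j ≤? x) (suc j * suc i ≤? x)
    (subst (_≤ x) (*-comm (suc i) (suc j))) (subst (_≤ x) (*-comm (suc j) (suc i)))

hyperbola-ext : ∀ x {F G} → (∀ a b → F a b ≡ G a b) → hyperbola x F ≡ hyperbola x G
hyperbola-ext x F≗G = ∑-ext x λ i → ∑-ext (x / suc i) λ j → F≗G (suc i) (suc j)

latticePoints : ℕ → ℕ
latticePoints x = ∑[ i < x ] (x / suc i)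

-- Equidistribution of sifted pairs under the hyperbola

module TwoVariable (M : ℕ) .{{_ : NonZero M}} (q t : ℕ) where
  open Sieve M

  private
    Q = suc q
    C = errorConstant q t
    f : ℕ → ℕ
    f = sifted (Q + t)
    A : ℕ → ℕ
    A y = ∑[ j < y ] f (suc j)

  siftedPairs : ℕ → (ℕ → ℕ → ℕ) → ℕ
  siftedPairs x G = hyperbola x λ a b → f a * (f b * G a b)

  private
    T = latticePoints

    -- Equidistribution in b along each row of the hyperbola. The row lengths `x / suc i` add up to
    -- T, and the bounded errors of the x rows to `C * x`.
    oneVariable : ∀ {G : ℕ → ℕ → ℕ} {B} → (∀ a → Periodic M (G a)) → (∀ a b → G a b ≤ B) → ∀ x →
      Q * ∣ M * siftedPairs x G - (∑[ i < x ] (f (suc i) * (∑ M (G (suc i)) * A (x / suc i)))) ∣ ≤ B * (M * T x + C * x)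
    oneVariable {G} {B} perG G≤B x = begin
      Q * ∣ M * siftedPairs x G - ∑ x main ∣
        ≡⟨ cong (λ z → Q * ∣ z - ∑ x main ∣) eq ⟩
      Q * ∣ ∑ x (λ i → f (suc i) * (M * Ag i)) - ∑ x main ∣
        ≤⟨ *-monoʳ-≤ Q (∑-distance x _ main) ⟩
      Q * (∑[ i < x ] ∣ f (suc i) * (M * Ag i) - main i ∣)
        ≡⟨ ∑-*ˡ x Q _ ⟨
      (∑[ i < x ] (Q * ∣ f (suc i) * (M * Ag i) - main i ∣))
        ≤⟨ ∑-mono x (λ i _ → term i) ⟩
      (∑[ i < x ] (B * (M * (x / suc i) + C)))
        ≡⟨ trans (∑-*ˡ x B _) (cong (B *_) (trans (∑-+ x _ _) (cong₂ _+_ (∑-*ˡ x M _) (trans (∑-const x C) (*-comm x C))))) ⟩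
      B * (M * T x + C * x) ∎
      where
      open ≤-Reasoning
      main Ag : ℕ → ℕ
      main i = f (suc i) * (∑ M (G (suc i)) * A (x / suc i))
      Ag i = ∑[ j < x / suc i ] (f (suc j) * G (suc i) (suc j))
      lem : ∀ a b c → a * (b * c) ≡ b * (a * c)
      lem = solve-∀
      eq : M * siftedPairs x G ≡ ∑ x (λ i → f (suc i) * (M * Ag i))
      eq = trans (sym (∑-*ˡ x M _)) (∑-ext x λ i →
        trans (cong (M *_) (∑-*ˡ (x / suc i) (f (suc i)) _)) (lem M (f (suc i)) (Ag i)))
      term : ∀ i → Q * ∣ f (suc i) * (M * Ag i) - main i ∣ ≤ B * (M * (x / suc i) + C)
      term i = begin
        Q * ∣ f (suc i) * (M * Ag i) - main i ∣
          ≡⟨ cong (Q *_) (*-distribˡ-∣-∣ (f (suc i)) (M * Ag i) _) ⟨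
        Q * (f (suc i) * ∣ M * Ag i - ∑ M (G (suc i)) * A (x / suc i) ∣)
          ≤⟨ *-monoʳ-≤ Q (≤-trans (*-monoˡ-≤ _ (sifted≤1 (Q + t) (suc i))) (≤-reflexive (*-identityˡ _))) ⟩
        Q * ∣ M * Ag i - ∑ M (G (suc i)) * A (x / suc i) ∣
          ≤⟨ equidistribution q t (perG (suc i)) (G≤B (suc i)) (x / suc i) ⟩
        B * (M * (x / suc i) + C) ∎

  -- R is the intermediate sum in which G has been averaged over b only; a second pass averages over
  -- a. Each pass costs M times E, whence the factor `2 * M`.
  pairEquidistribution : ∀ {G} → Periodic₂ M G → (∀ a b → G a b ≤ 1) → ∀ x →
    Q * ∣ M * M * siftedPairs x G - ∑∑ M G * siftedPairs x (λ _ _ → 1) ∣ ≤ 2 * M * (M * T x + C * x)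
  pairEquidistribution {G} (per₁ ,ₚ per₂) G≤1 x = begin
    Q * ∣ M * M * S - W * S₁ ∣
      ≤⟨ *-monoʳ-≤ Q (∣-∣-triangle (M * M * S) (M * R) (W * S₁)) ⟩
    Q * (∣ M * M * S - M * R ∣ + ∣ M * R - W * S₁ ∣)
      ≡⟨ cong (λ z → Q * (z + ∣ M * R - W * S₁ ∣)) (trans (cong (∣_- M * R ∣) (*-assoc M M S)) (sym (*-distribˡ-∣-∣ M (M * S) R))) ⟩
    Q * (M * ∣ M * S - R ∣ + ∣ M * R - W * S₁ ∣)
      ≡⟨ lem₁ Q M _ _ ⟩
    M * (Q * ∣ M * S - R ∣) + Q * ∣ M * R - W * S₁ ∣
      ≤⟨ +-mono-≤ (*-monoʳ-≤ M (oneVariable {G} per₂ G≤1 x)) second ⟩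
    M * (1 * E) + M * E
      ≡⟨ lem₂ M E ⟩
    2 * M * E ∎
    where
    open ≤-Reasoning
    lem₁ : ∀ Q M a b → Q * (M * a + b) ≡ M * (Q * a) + Q * b
    lem₁ = solve-∀
    lem₂ : ∀ M E → M * (1 * E) + M * E ≡ 2 * M * E
    lem₂ = solve-∀
    lem₃ : ∀ a b c → a * (b * c) ≡ b * (a * c)
    lem₃ = solve-∀
    G′ : ℕ → ℕ
    G′ a = ∑ M (G a)
    S  = siftedPairs x G
    S₁ = siftedPairs x (λ _ _ → 1)
    W  = ∑∑ M G
    E  = M * T x + C * x
    R  = ∑[ i < x ] (f (suc i) * (G′ (suc i) * A (x / suc i)))
    G′≤M : ∀ a → G′ a ≤ M
    G′≤M a = ≤-trans (∑-mono M λ b _ → G≤1 a b) (≤-reflexive (trans (∑-const M 1) (*-identityʳ M)))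
    -- The averaged weight depends on a alone. Exchanging the variables makes a the inner one, to
    -- which `oneVariable` applies.
    R≡ : R ≡ siftedPairs x (λ _ b → G′ b)
    R≡ = trans
      (∑-ext x λ i → trans (cong (f (suc i) *_) (sym (∑-*ˡ (x / suc i) (G′ (suc i)) _))) (sym (∑-*ˡ (x / suc i) (f (suc i)) _)))
      (trans (hyperbola-swap x λ a b → f a * (G′ a * f b))
             (hyperbola-ext x λ a b → trans (lem₃ (f b) (G′ b) (f a)) (trans (*-comm (G′ b) _) (trans (cong (_* G′ b) (*-comm (f b) (f a))) (*-assoc (f a) (f b) (G′ b))))))
    R₁≡ : (∑[ i < x ] (f (suc i) * (W * A (x / suc i)))) ≡ W * S₁
    R₁≡ = trans (∑-ext x λ i → lem₃ (f (suc i)) W (A (x / suc i)))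
      (trans (∑-*ˡ x W _) (cong (W *_) (∑-ext x λ i →
        trans (sym (∑-*ˡ (x / suc i) (f (suc i)) _)) (∑-ext (x / suc i) λ j → cong (f (suc i) *_) (sym (*-identityʳ _))))))
    -- The weight `G′` is a sum of M values of G, so here the bound B is M instead of 1.
    second : Q * ∣ M * R - W * S₁ ∣ ≤ M * E
    second = subst₂ (λ r s → Q * ∣ M * r - s ∣ ≤ M * E) (sym R≡) R₁≡
      (oneVariable {λ _ → G′} (λ _ → ∑-periodic per₁ M) (λ _ → G′≤M) x)

-- Superlinear growth of the number of lattice points

m≤2*[m/n*n] : ∀ x n .{{_ : NonZero n}} → n ≤ x → x ≤ 2 * (x / n * n)
m≤2*[m/n*n] x n n≤x = begin
  x                          ≡⟨ m≡m%n+[m/n]*n x n ⟩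
  x % n + x / n * n          ≤⟨ +-monoˡ-≤ (x / n * n) (≤-trans (m%n≤n x n) n≤x/n*n) ⟩
  x / n * n + x / n * n      ≡⟨ cong (x / n * n +_) (+-identityʳ (x / n * n)) ⟨
  2 * (x / n * n)            ∎
  where
  open ≤-Reasoning
  n≤x/n*n : n ≤ x / n * n
  n≤x/n*n = ≤-trans (≤-reflexive (sym (*-identityˡ n))) (*-monoˡ-≤ n (m≥n⇒m/n>0 n≤x))

-- Oresme's argument for the harmonic series: with P a power of 2, the P divisors in (P, 2P] have
-- quotients at least ⌊x/2P⌋, and P⌊x/2P⌋ ≥ x/4, where rounding down loses at most a factor 2
-- because 2P ≤ x.
dyadic : ∀ J x → 2 ^ J ≤ x → J * x ≤ 4 * (∑[ i < 2 ^ J ] (x / suc i))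
dyadic zero    x _  = z≤n
dyadic (suc J) x le = begin
  x + J * x                                         ≤⟨ +-mono-≤ block (dyadic J x (≤-trans (m≤m+n P (P + 0)) le)) ⟩
  4 * (P * (x / (2 * P))) + 4 * ∑ P h               ≤⟨ +-monoˡ-≤ (4 * ∑ P h) (*-monoʳ-≤ 4 upper-half) ⟩
  4 * (∑[ i < P + 0 ] h (P + i)) + 4 * ∑ P h        ≡⟨ lem _ (∑ P h) ⟩
  4 * (∑ P h + (∑[ i < P + 0 ] h (P + i)))          ≡⟨ cong (4 *_) (∑-split P (P + 0) h) ⟨
  4 * ∑ (2 * P) h                                   ∎
  where
  open ≤-Reasoning
  P = 2 ^ J
  instance
    P≢0 : NonZero P
    P≢0 = m^n≢0 2 J
    2P≢0 : NonZero (2 * P)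
    2P≢0 = m*n≢0 2 P
  h : ℕ → ℕ
  h i = x / suc i
  lem : ∀ a b → 4 * a + 4 * b ≡ 4 * (b + a)
  lem = solve-∀
  lem′ : ∀ z P → 2 * (z * (2 * P)) ≡ 4 * (P * z)
  lem′ = solve-∀
  block : x ≤ 4 * (P * (x / (2 * P)))
  block = ≤-trans (m≤2*[m/n*n] x (2 * P) le) (≤-reflexive (lem′ (x / (2 * P)) P))
  upper-half : P * (x / (2 * P)) ≤ (∑[ i < P + 0 ] h (P + i))
  upper-half = begin
    P * (x / (2 * P))                 ≡⟨ cong (_* (x / (2 * P))) (+-identityʳ P) ⟨
    (P + 0) * (x / (2 * P))           ≡⟨ ∑-const (P + 0) _ ⟨
    (∑[ i < P + 0 ] (x / (2 * P)))    ≤⟨ ∑-mono (P + 0) (λ i i< → /-monoʳ-≤ x (+-monoʳ-< P i<)) ⟩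
    (∑[ i < P + 0 ] h (P + i))        ∎

-- A dyadic block is worth x/4, so 4K of them suffice.
latticePoints-superlinear : ∀ K x → 2 ^ (4 * K) ≤ x → K * x ≤ latticePoints x
latticePoints-superlinear K x le = *-cancelˡ-≤ 4 (begin
  4 * (K * x)                               ≡⟨ *-assoc 4 K x ⟨
  4 * K * x                                 ≤⟨ dyadic (4 * K) x le ⟩
  4 * (∑[ i < 2 ^ (4 * K) ] (x / suc i))    ≤⟨ *-monoʳ-≤ 4 (∑-≤-index _ le) ⟩
  4 * latticePoints x                       ∎)
  where open ≤-Reasoning

-- Proportions of weighted sifted pairs as x grows

module Asymptotics (M : ℕ) .{{_ : NonZero M}} (2∣M : 2 ∣ M) where
  open Sieve M

  pairs : ℕ → (ℕ → ℕ → ℕ) → ℕ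
  pairs x G = hyperbola x λ a b → sifted x a * (sifted x b * G a b)

  private
    T = latticePoints
    C : ℕ → ℕ
    C q = errorConstant q 0

    -- The sifting bound is x itself, written as Q + t with t = x - Q, so any fixed Q may be used
    -- once x ≥ Q. The hypothesis on `C q * x` merges the second error term into the first.
    equidistributed : ∀ q {G} → Periodic₂ M G → (∀ a b → G a b ≤ 1) → ∀ {x} → suc q ≤ x → C q * x ≤ T x →
      suc q * ∣ M * M * pairs x G - ∑∑ M G * pairs x (λ _ _ → 1) ∣ ≤ 2 * M * (suc M * T x)
    equidistributed q {G} per G≤1 {x} q<x Cx≤T = begin
      suc q * ∣ M * M * pairs x G - ∑∑ M G * pairs x (λ _ _ → 1) ∣
        ≡⟨ cong (λ X → suc q * ∣ M * M * pairs′ X G - ∑∑ M G * pairs′ X (λ _ _ → 1) ∣) (m+[n∸m]≡n q<x) ⟨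
      suc q * ∣ M * M * pairs′ (suc q + (x ∸ suc q)) G - ∑∑ M G * pairs′ (suc q + (x ∸ suc q)) (λ _ _ → 1) ∣
        ≤⟨ TwoVariable.pairEquidistribution M q (x ∸ suc q) per G≤1 x ⟩
      2 * M * (M * T x + C q * x)
        ≤⟨ *-monoʳ-≤ (2 * M) (≤-trans (+-monoʳ-≤ (M * T x) Cx≤T) (≤-reflexive (+-comm (M * T x) (T x)))) ⟩
      2 * M * (suc M * T x) ∎
      where
      open ≤-Reasoning
      pairs′ : ℕ → (ℕ → ℕ → ℕ) → ℕ
      pairs′ X G = hyperbola x λ a b → sifted X a * (sifted X b * G a b)

    sieve-2 : ∀ a → sieve 2 a ≡ 1
    sieve-2 a = cong₂ (λ u v → 1 * u * v)
      (ind-yes (¬? (removes? 1 a)) λ ((pr , _) , _) → ¬prime[1] pr)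
      (ind-yes (¬? (removes? 2 a)) λ ((_ , 2∤M) , _) → 2∤M 2∣M)

    -- The tail estimate at Q = 2, that is q = 1: by `sieve-2` nothing is sifted up to 2, later
    -- squares remove at most y/2 integers, and the number 1 accounts for the constant.
    sifted-dense : ∀ {x} → 2 ≤ x → ∀ y → y ≤ 2 * (∑[ j < y ] sifted x (suc j)) + 2
    sifted-dense {x} 2≤x y = subst (λ X → y ≤ 2 * (∑[ j < y ] sifted X (suc j)) + 2) (m+[n∸m]≡n 2≤x)
      (+-cancelʳ-≤ y y _ (begin
        y + y                                               ≡⟨ lem₁ y ⟩
        2 * (y * 1)                                         ≡⟨ cong (2 *_) (trans (∑-ext y λ j → trans (*-identityʳ _) (sieve-2 (suc j))) (∑-const y 1)) ⟨
        2 * (∑[ j < y ] (sieve 2 (suc j) * 1))              ≤⟨ ∑-sieve≤ 1 (x ∸ 2) {λ _ → 1} (λ _ → ≤-refl) y ⟩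
        2 * (∑[ j < y ] (sifted X (suc j) * 1)) + (2 + y) * 1 ≡⟨ cong (λ z → 2 * z + (2 + y) * 1) (∑-ext y λ j → *-identityʳ _) ⟩
        2 * A + (2 + y) * 1                                 ≡⟨ lem₂ A y ⟩
        2 * A + 2 + y                                       ∎))
      where
      open ≤-Reasoning
      X = 2 + (x ∸ 2)
      A = ∑[ j < y ] sifted X (suc j)
      lem₁ : ∀ y → y + y ≡ 2 * (y * 1)
      lem₁ = solve-∀
      lem₂ : ∀ A y → 2 * A + (2 + y) * 1 ≡ 2 * A + 2 + y
      lem₂ = solve-∀

    -- The density bound is used once in each variable, with an exchange of the variables in
    -- between; every use loses a factor 2 and a multiple of x.
    pairs-dense : ∀ {x} → 2 ≤ x → T x ≤ 4 * pairs x (λ _ _ → 1) + 6 * x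
    pairs-dense {x} 2≤x = begin
      T x                                    ≤⟨ ∑-mono x (λ i _ → sifted-dense 2≤x (x / suc i)) ⟩
      (∑[ i < x ] (2 * A (x / suc i) + 2))   ≡⟨ linear (λ i → A (x / suc i)) ⟩
      2 * (∑[ i < x ] A (x / suc i)) + 2 * x ≡⟨ cong (λ z → 2 * z + 2 * x) swapped ⟩
      2 * (∑[ i < x ] (f (suc i) * (x / suc i))) + 2 * x
        ≤⟨ +-monoˡ-≤ (2 * x) (*-monoʳ-≤ 2 (∑-mono x λ i _ → term i)) ⟩
      2 * (∑[ i < x ] (2 * (f (suc i) * A (x / suc i)) + 2)) + 2 * x
        ≡⟨ cong (λ z → 2 * z + 2 * x) (linear _) ⟩
      2 * (2 * (∑[ i < x ] (f (suc i) * A (x / suc i))) + 2 * x) + 2 * x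
        ≡⟨ cong (λ z → 2 * (2 * z + 2 * x) + 2 * x) (∑-ext x λ i → trans (sym (∑-*ˡ (x / suc i) (f (suc i)) _)) (∑-ext (x / suc i) λ j → cong (f (suc i) *_) (sym (*-identityʳ _)))) ⟩
      2 * (2 * S + 2 * x) + 2 * x            ≡⟨ lem S x ⟩
      4 * S + 6 * x                          ∎
      where
      open ≤-Reasoning
      f : ℕ → ℕ
      f = sifted x
      A : ℕ → ℕ
      A y = ∑[ j < y ] f (suc j)
      S = pairs x (λ _ _ → 1)
      lem : ∀ S x → 2 * (2 * S + 2 * x) + 2 * x ≡ 4 * S + 6 * x
      lem = solve-∀
      linear : ∀ h → (∑[ i < x ] (2 * h i + 2)) ≡ 2 * ∑ x h + 2 * x
      linear h = trans (∑-+ x _ _) (cong₂ _+_ (∑-*ˡ x 2 h) (trans (∑-const x 2) (*-comm x 2)))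
      swapped : (∑[ i < x ] A (x / suc i)) ≡ (∑[ i < x ] (f (suc i) * (x / suc i)))
      swapped = trans (hyperbola-swap x λ _ b → f b)
        (∑-ext x λ i → trans (∑-const (x / suc i) (f (suc i))) (*-comm (x / suc i) _))
      term : ∀ i → f (suc i) * (x / suc i) ≤ 2 * (f (suc i) * A (x / suc i)) + 2
      term i = begin
        f (suc i) * (x / suc i)                       ≤⟨ *-monoʳ-≤ (f (suc i)) (sifted-dense 2≤x (x / suc i)) ⟩
        f (suc i) * (2 * A (x / suc i) + 2)           ≡⟨ lem′ (f (suc i)) (A (x / suc i)) ⟩
        2 * (f (suc i) * A (x / suc i)) + f (suc i) * 2 ≤⟨ +-monoʳ-≤ _ (*-monoˡ-≤ 2 (sifted≤1 x (suc i))) ⟩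
        2 * (f (suc i) * A (x / suc i)) + 1 * 2       ∎
        where
        lem′ : ∀ f a → f * (2 * a + 2) ≡ 2 * (f * a) + f * 2
        lem′ = solve-∀

    -- In `pairs-lower` the equidistribution error becomes 8 · 2M(M+1) · T = q₀T, against Q₀T on the
    -- left. As Q₀ = q₀ + 1, exactly one T survives the cancellation.
    q₀ Q₀ c₀ : ℕ
    q₀ = 16 * M * suc M
    Q₀ = suc q₀
    c₀ = 8 * Q₀ * (M * M)

  module _ {G} (perG : Periodic₂ M G) (G≤1 : ∀ a b → G a b ≤ 1) .{{W≢0 : NonZero (∑∑ M G)}} where
    private
      W = ∑∑ M G

      -- The bound |𝒟(x)| ≫ T. Unweighted pairs are dense by `pairs-dense`; equidistribution at the
      -- fixed level Q₀ passes this on to the weight G, of which only W ≥ 1 is used.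
      pairs-lower : ∀ {x} → Q₀ ≤ x → C q₀ * x ≤ T x → 12 * x ≤ T x → T x ≤ c₀ * pairs x G
      pairs-lower {x} Q₀≤x Cx≤T 12x≤T = +-cancelʳ-≤ (q₀ * T x) (T x) _ (begin
        Q₀ * T x                                       ≤⟨ *-monoʳ-≤ Q₀ T≤8S₁ ⟩
        Q₀ * (8 * S₁)                                  ≤⟨ *-monoʳ-≤ Q₀ (*-monoʳ-≤ 8 (≤-trans (≤-reflexive (sym (*-identityˡ S₁))) (*-monoˡ-≤ S₁ (>-nonZero⁻¹ W)))) ⟩
        Q₀ * (8 * (W * S₁))                            ≡⟨ lem₁ Q₀ (W * S₁) ⟩
        8 * (Q₀ * (W * S₁))                            ≤⟨ *-monoʳ-≤ 8 (∣-∣-elimʳ {Q₀ * (M * M * S)} {Q₀ * (W * S₁)} (≤-trans (≤-reflexive (sym (*-distribˡ-∣-∣ Q₀ (M * M * S) (W * S₁)))) (equidistributed q₀ perG G≤1 Q₀≤x Cx≤T))) ⟩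
        8 * (Q₀ * (M * M * S) + 2 * M * (suc M * T x)) ≡⟨ lem₂ Q₀ (M * M) S M (suc M) (T x) ⟩
        c₀ * S + q₀ * T x                              ∎)
        where
        open ≤-Reasoning
        S  = pairs x G
        S₁ = pairs x (λ _ _ → 1)
        lem₁ : ∀ q w → q * (8 * w) ≡ 8 * (q * w)
        lem₁ = solve-∀
        lem₂ : ∀ q m s M M⁺ t → 8 * (q * (m * s) + 2 * M * (M⁺ * t)) ≡ 8 * q * m * s + 16 * M * M⁺ * t
        lem₂ = solve-∀
        2≤x : 2 ≤ x
        2≤x = ≤-trans (s≤s (>-nonZero⁻¹ q₀ {{m*n≢0 (16 * M) (suc M) {{m*n≢0 16 M}}}})) Q₀≤x
        T≤8S₁ : T x ≤ 8 * S₁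
        T≤8S₁ = +-cancelʳ-≤ (T x) (T x) (8 * S₁) (begin
          T x + T x                 ≡⟨ cong (T x +_) (+-identityʳ (T x)) ⟨
          2 * T x                   ≤⟨ *-monoʳ-≤ 2 (pairs-dense 2≤x) ⟩
          2 * (4 * S₁ + 6 * x)      ≡⟨ lem₃ S₁ x ⟩
          8 * S₁ + 12 * x           ≤⟨ +-monoʳ-≤ (8 * S₁) 12x≤T ⟩
          8 * S₁ + T x              ∎)
          where
          lem₃ : ∀ s x → 2 * (4 * s + 6 * x) ≡ 8 * s + 12 * x
          lem₃ = solve-∀

    -- After multiplication by M², both `W * pairs x H` and `V * pairs x G` are close to W · V times
    -- the unweighted count, which therefore drops out.
    pairs-ratio : ∀ {H} → Periodic₂ M H → (∀ a b → H a b ≤ 1) → ∀ n →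
      ∃[ N ] ∀ x → N ≤ x → 1 ≤ pairs x G × n * ∣ W * pairs x H - ∑∑ M H * pairs x G ∣ ≤ pairs x G
    pairs-ratio {H} perH H≤1 n = N , λ x N≤x → eventually x N≤x
      where
      V  = ∑∑ M H
      -- D adds up the two equidistribution errors, and `D * (suc M * c₀)` expresses the total error
      -- in units of `pairs x G`. Z is a successor so that it can be cancelled, and q has the
      -- further factor n that the conclusion asks for.
      D  = (W + V) * (2 * M)
      Z  = suc (D * (suc M * c₀))
      q  = n * Z
      -- One K for which T ≥ Kx dominates `C q * x`, `C q₀ * x` and `12 * x` together.
      K  = C q + C q₀ + 12
      N  = 2 ^ (4 * K) + suc q + Q₀
      eventually : ∀ x → N ≤ x → 1 ≤ pairs x G × n * ∣ W * pairs x H - V * pairs x G ∣ ≤ pairs x G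
      eventually x N≤x = 1≤S , *-cancelˡ-≤ Z (begin
        Z * (n * δ)                     ≡⟨ trans (sym (*-assoc Z n δ)) (cong (_* δ) (*-comm Z n)) ⟩
        q * δ                           ≤⟨ *-monoˡ-≤ δ (n≤1+n q) ⟩
        suc q * δ                       ≤⟨ m≤n*m (suc q * δ) (M * M) {{m*n≢0 M M}} ⟩
        M * M * (suc q * δ)             ≡⟨ lem₁ (M * M) (suc q) δ ⟩
        suc q * (M * M * δ)             ≡⟨ cong (suc q *_) (*-distribˡ-∣-∣ (M * M) (W * SH) (V * S)) ⟩
        suc q * ∣ M * M * (W * SH) - M * M * (V * S) ∣
          ≤⟨ *-monoʳ-≤ (suc q) (∣-∣-triangle (M * M * (W * SH)) (W * (V * S₁)) (M * M * (V * S))) ⟩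
        suc q * (∣ M * M * (W * SH) - W * (V * S₁) ∣ + ∣ W * (V * S₁) - M * M * (V * S) ∣)
          ≡⟨ cong₂ (λ u v → suc q * (u + v)) (to-H) (to-G) ⟩
        suc q * (W * ∣ M * M * SH - V * S₁ ∣ + V * ∣ M * M * S - W * S₁ ∣)
          ≡⟨ lem₂ (suc q) W V _ _ ⟩
        W * (suc q * ∣ M * M * SH - V * S₁ ∣) + V * (suc q * ∣ M * M * S - W * S₁ ∣)
          ≤⟨ +-mono-≤ (*-monoʳ-≤ W (equidistributed q perH H≤1 q<x Cq≤)) (*-monoʳ-≤ V (equidistributed q perG G≤1 q<x Cq≤)) ⟩
        W * (2 * M * (suc M * T x)) + V * (2 * M * (suc M * T x))
          ≡⟨ lem₃ W V (2 * M) (suc M) (T x) ⟩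
        D * (suc M * T x)               ≤⟨ *-monoʳ-≤ D (*-monoʳ-≤ (suc M) T≤c₀S) ⟩
        D * (suc M * (c₀ * S))          ≡⟨ trans (cong (D *_) (sym (*-assoc (suc M) c₀ S))) (sym (*-assoc D _ S)) ⟩
        D * (suc M * c₀) * S            ≤⟨ *-monoˡ-≤ S (n≤1+n (D * (suc M * c₀))) ⟩
        Z * S                           ∎)
        where
        open ≤-Reasoning
        S  = pairs x G
        SH = pairs x H
        S₁ = pairs x (λ _ _ → 1)
        δ  = ∣ W * SH - V * S ∣
        lem₁ : ∀ a b c → a * (b * c) ≡ b * (a * c)
        lem₁ = solve-∀
        lem₂ : ∀ q W V a b → q * (W * a + V * b) ≡ W * (q * a) + V * (q * b)
        lem₂ = solve-∀
        lem₃ : ∀ W V a b t → W * (a * (b * t)) + V * (a * (b * t)) ≡ (W + V) * a * (b * t)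
        lem₃ = solve-∀
        to-H : ∣ M * M * (W * SH) - W * (V * S₁) ∣ ≡ W * ∣ M * M * SH - V * S₁ ∣
        to-H = trans (cong (∣_- W * (V * S₁) ∣) (lem₁ (M * M) W SH)) (sym (*-distribˡ-∣-∣ W _ _))
        to-G : ∣ W * (V * S₁) - M * M * (V * S) ∣ ≡ V * ∣ M * M * S - W * S₁ ∣
        to-G = trans (∣-∣-comm (W * (V * S₁)) _)
          (trans (cong₂ ∣_-_∣ (lem₁ (M * M) V S) (lem₁ W V S₁)) (sym (*-distribˡ-∣-∣ V _ _)))
        K≤ : K * x ≤ T x
        K≤ = latticePoints-superlinear K x (≤-trans (≤-trans (m≤m+n (2 ^ (4 * K)) (suc q)) (m≤m+n _ Q₀)) N≤x)
        q<x : suc q ≤ x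
        q<x = ≤-trans (≤-trans (m≤n+m (suc q) (2 ^ (4 * K))) (m≤m+n _ Q₀)) N≤x
        Q₀≤x : Q₀ ≤ x
        Q₀≤x = ≤-trans (m≤n+m Q₀ _) N≤x
        Cq≤ : C q * x ≤ T x
        Cq≤ = ≤-trans (*-monoˡ-≤ x (≤-trans (m≤m+n (C q) (C q₀)) (m≤m+n _ 12))) K≤
        Cq₀≤ : C q₀ * x ≤ T x
        Cq₀≤ = ≤-trans (*-monoˡ-≤ x (≤-trans (m≤n+m (C q₀) (C q)) (m≤m+n _ 12))) K≤
        12≤ : 12 * x ≤ T x
        12≤ = ≤-trans (*-monoˡ-≤ x (m≤n+m 12 (C q + C q₀))) K≤
        T≤c₀S : T x ≤ c₀ * S
        T≤c₀S = pairs-lower Q₀≤x Cq₀≤ 12≤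
        -- Keeps the later ratio away from its default value at denominator 0. If S vanished, so
        -- would T by `T≤c₀S`, although T ≥ 12x.
        1≤S : 1 ≤ S
        1≤S with S in S≡
        ... | suc _ = s≤s z≤n
        ... | zero  = contradiction (begin
          1          ≤⟨ s≤s z≤n ⟩
          Q₀         ≤⟨ Q₀≤x ⟩
          x          ≤⟨ m≤n*m x 12 ⟩
          12 * x     ≤⟨ 12≤ ⟩
          T x        ≤⟨ T≤c₀S ⟩
          c₀ * S     ≡⟨ trans (cong (c₀ *_) S≡) (*-zeroʳ c₀) ⟩
          0          ∎) λ ()

-- Residues modulo one prime

%≡-∸ : ∀ a b n .{{_ : NonZero n}} → a ≤ b → n ∣ b ∸ a → a % n ≡ b % n
%≡-∸ a b n a≤b n∣b∸a = trans (sym (%-remove-+ʳ a n∣b∸a)) (cong (_% n) (m+[n∸m]≡n a≤b))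

-- Translates the signed divisibility in `IsSquareMod` into equality of remainders in ℕ; the order
-- of m and n decides the sign of the difference.
∣-⇔%≡ : ∀ p .{{_ : NonZero p}} m n →
  ((ℤ.+ p) ℤ∣.∣ (ℤ.+ m ℤ.- ℤ.+ n) → m % p ≡ n % p) × (m % p ≡ n % p → (ℤ.+ p) ℤ∣.∣ (ℤ.+ m ℤ.- ℤ.+ n))
∣-⇔%≡ p m n with ≤-total n m
... | inj₁ n≤m = (λ d → sym (%≡-∸ n m p n≤m (ℤ∣.∣⇒∣ᵤ (subst (ℤ.+ p ℤ∣.∣_) diff d))))
               , (λ eq → subst (ℤ.+ p ℤ∣.∣_) (sym diff) (ℤ∣.∣ᵤ⇒∣ (%≡⇒∣∸ n m p (sym eq))))
  where
  diff : ℤ.+ m ℤ.- ℤ.+ n ≡ ℤ.+ (m ∸ n)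
  diff = trans (ℤₚ.m-n≡m⊖n m n) (ℤₚ.⊖-≥ n≤m)
... | inj₂ m≤n = (λ d → %≡-∸ m n p m≤n (subst (p ∣_) (trans (cong ℤ.∣_∣ diff) (ℤₚ.∣-i∣≡∣i∣ (ℤ.+ (n ∸ m)))) (ℤ∣.∣⇒∣ᵤ d)))
               , (λ eq → ℤ∣.∣ᵤ⇒∣ (subst (p ∣_) (sym (trans (cong ℤ.∣_∣ diff) (ℤₚ.∣-i∣≡∣i∣ (ℤ.+ (n ∸ m))))) (%≡⇒∣∸ m n p eq)))
  where
  diff : ℤ.+ m ℤ.- ℤ.+ n ≡ ℤ.- ℤ.+ (n ∸ m)
  diff = trans (ℤₚ.m-n≡m⊖n m n) (ℤₚ.⊖-≤ m≤n)

χ : ℕ → ℕ → ℤ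
χ p n = kroneckerAtPrime (ℤ.+ n) p

IsSign : ℤ → Set
IsSign x = x ≡ 0ℤ ⊎ x ≡ 1ℤ ⊎ x ≡ -1ℤ

dominant : ℤ → ℤ → ℤ
dominant x y with y ℤₚ.≟ 0ℤ
... | yes _ = x
... | no _  = y

-- The classes 8 and 12 modulo 16 are the numbers 4m with m ≡ 2 and m ≡ 3 modulo 4. Each class also
-- contains the squarefreeness at 2 of n or of m.
OkAt2 : ℕ → Set
OkAt2 n = n % 4 ≡ 1 ⊎ n % 16 ≡ 8 ⊎ n % 16 ≡ 12

LocallyFundamental : ℕ → ℕ → Set
LocallyFundamental p n = (p ≡ 2 → OkAt2 n) × (p ≢ 2 → square p ∤ n)

locallyFundamental? : ∀ p n → Dec (LocallyFundamental p n)
locallyFundamental? p n =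
  (p ≟ 2 →-dec (n % 4 ≟ 1 ⊎-dec n % 16 ≟ 8 ⊎-dec n % 16 ≟ 12)) ×-dec (¬? (p ≟ 2) →-dec ¬? (square p ∣? n))

lf : ℕ → ℕ → ℕ
lf p n = ind (locallyFundamental? p n)

[χ_≡_] : ℕ → ℤ → ℕ → ℕ
[χ p ≡ v ] n = ind (χ p n ℤₚ.≟ v)

-- 16 is a common period of `OkAt2` and of the Kronecker symbol at 2, which has period 8.
localModulus : ℕ → ℕ
localModulus p = if does (p ≟ 2) then 16 else square p

localModulus-odd : ∀ {p} → p ≢ 2 → localModulus p ≡ square p
localModulus-odd {p} p≢2 rewrite dec-false (p ≟ 2) p≢2 = refl

-- z counts the ramified residues, s the split ones and also the inert ones.
record LocalCounts (p : ℕ) : Set where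
  field
    χ-sign      : ∀ n → IsSign (χ p n)
    χ-periodic  : ∀ n → χ p (localModulus p + n) ≡ χ p n
    lf-periodic : Periodic (localModulus p) (lf p)
    z s         : ℕ
    z-nonZero   : NonZero z
    2s≡pz       : 2 * s ≡ p * z
    ramified    : (∑[ n < localModulus p ] (lf p n * [χ p ≡ 0ℤ ] n)) ≡ z
    split       : (∑[ n < localModulus p ] (lf p n * [χ p ≡ 1ℤ ] n)) ≡ s
    inert       : (∑[ n < localModulus p ] (lf p n * [χ p ≡ -1ℤ ] n)) ≡ s

localCounts-2 : LocalCounts 2
localCounts-2 = record
  { χ-sign      = sign
  ; χ-periodic  = periodic
  ; lf-periodic = λ n → ind-cong (locallyFundamental? 2 (16 + n)) (locallyFundamental? 2 n)
      (λ (h , _) → h , contradiction refl) (λ (h , _) → h , contradiction refl)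
  -- Modulo 16 the ramified residues are 8 and 12, the split ones 1 and 9, the inert ones 5 and 13.
  ; z = 2 ; s = 2 ; z-nonZero = _ ; 2s≡pz = refl
  ; ramified = refl ; split = refl ; inert = refl
  }
  where
  sign : ∀ n → IsSign (kronecker₂ (ℤ.+ n))
  sign n with n % 8
  ... | 0 = inj₁ refl
  ... | 1 = inj₂ (inj₁ refl)
  ... | 2 = inj₁ refl
  ... | 3 = inj₂ (inj₂ refl)
  ... | 4 = inj₁ refl
  ... | 5 = inj₂ (inj₂ refl)
  ... | 6 = inj₁ refl
  ... | 7 = inj₂ (inj₁ refl)
  ... | suc (suc (suc (suc (suc (suc (suc (suc _))))))) = inj₁ refl
  periodic : ∀ n → kronecker₂ (ℤ.+ (16 + n)) ≡ kronecker₂ (ℤ.+ n)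
  -- `(16 + n) % 8` reduces to `n % 8`, so both symbols are determined by the same case.
  periodic n with n % 8
  ... | 0 = refl
  ... | 1 = refl
  ... | 2 = refl
  ... | 3 = refl
  ... | 4 = refl
  ... | 5 = refl
  ... | 6 = refl
  ... | 7 = refl
  ... | suc (suc (suc (suc (suc (suc (suc (suc _))))))) = refl

∑-ind-∣ : ∀ d .{{_ : NonZero d}} → (∑[ n < d ] ind (d ∣? n)) ≡ 1
∑-ind-∣ d = trans
  (∑-cong d λ n n<d → ind-cong (d ∣? n) (n ≟ 0) (λ d∣n → only-0 n n<d d∣n) (λ where refl → d ∣0))
  (∑-ind-≡ d (>-nonZero⁻¹ d))
  where
  only-0 : ∀ n → n < d → d ∣ n → n ≡ 0
  only-0 zero    _   _   = refl
  only-0 (suc n) n<d d∣n = contradiction d∣n (>⇒∤ n<d)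

-- Squares modulo an odd prime

difference-of-squares : ∀ {b c} → b ≤ c → square c ∸ square b ≡ (c ∸ b) * (c + b)
difference-of-squares {b} {c} b≤c = begin
  square c ∸ square b                         ≡⟨ cong (λ x → square x ∸ square b) (m+[n∸m]≡n b≤c) ⟨
  square (b + d) ∸ square b                   ≡⟨ cong (_∸ square b) (lem b d) ⟩
  square b + d * (b + d + b) ∸ square b       ≡⟨ m+n∸m≡n (square b) _ ⟩
  d * (b + d + b)                             ≡⟨ cong (λ x → d * (x + b)) (m+[n∸m]≡n b≤c) ⟩
  d * (c + b)                                 ∎
  where
  open ≡-Reasoning
  d = c ∸ b
  lem : ∀ b d → (b + d) * (b + d) ≡ b * b + d * (b + d + b)
  lem = solve-∀

module OddPrime {p′ : ℕ} (pr : Prime (suc p′)) (odd : suc p′ ≢ 2) where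
  private
    p = suc p′

    p≢2c : ∀ c → p ≢ c + c
    p≢2c c eq = [ (λ ()) , odd ∘ sym ]′ (prime⇒irreducible pr (divides c (trans eq (lem c))))
      where
      lem : ∀ c → c + c ≡ c * 2
      lem = solve-∀

    -- p divides (c - b)(c + b). The first factor is below p, so divisibility makes it 0; the second
    -- is below 2p, so it is 0 or p.
    root-≤ : ∀ {b c} → b ≤ c → c < p → square b % p ≡ square c % p → b ≡ c ⊎ c + b ≡ p
    root-≤ {b} {c} b≤c c<p eq with euclidsLemma (c ∸ b) (c + b) pr
      (subst (p ∣_) (difference-of-squares b≤c) (%≡⇒∣∸ (square b) (square c) p eq))
    root-≤ {b} {c} b≤c c<p eq | inj₁ p∣c∸b with c ∸ b in c∸b≡
    ... | zero  = inj₁ (≤-antisym b≤c (m∸n≡0⇒m≤n c∸b≡))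
    ... | suc d = contradiction p∣c∸b (>⇒∤ (subst (_< p) c∸b≡ (≤-<-trans (m∸n≤m c b) c<p)))
    root-≤ {b} {c} b≤c c<p eq | inj₂ (divides zero eq₀) = inj₁ (trans (m+n≡0⇒n≡0 c eq₀) (sym (m+n≡0⇒m≡0 c eq₀)))
    root-≤ {b} {c} b≤c c<p eq | inj₂ (divides 1 eq₁) = inj₂ (trans eq₁ (*-identityˡ p))
    root-≤ {b} {c} b≤c c<p eq | inj₂ (divides (suc (suc k)) eq₂) = contradiction eq₂ (<⇒≢ (begin-strict
      c + b         <⟨ +-mono-<-≤ c<p (≤-trans b≤c (<⇒≤ c<p)) ⟩
      p + p         ≤⟨ m≤m+n (p + p) (k * p) ⟩
      p + p + k * p ≡⟨ +-assoc p p (k * p) ⟩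
      suc (suc k) * p ∎))
      where open ≤-Reasoning

    roots-± : ∀ {b c} → b < p → c < p → square b % p ≡ square c % p → b ≡ c ⊎ b + c ≡ p
    roots-± {b} {c} b<p c<p eq with ≤-total b c
    ... | inj₁ b≤c = [ inj₁ , inj₂ ∘ trans (+-comm b c) ]′ (root-≤ b≤c c<p eq)
    ... | inj₂ c≤b = [ inj₁ ∘ sym , inj₂ ]′ (root-≤ c≤b b<p (sym eq))

    opposite : ∀ {b c} → b + c ≡ p → square b % p ≡ square c % p
    opposite {b} {c} b+c≡p with ≤-total b c
    ... | inj₁ b≤c = %≡-∸ (square b) (square c) p (*-mono-≤ b≤c b≤c)
      (subst (p ∣_) (sym (difference-of-squares b≤c)) (∣n⇒∣m*n (c ∸ b) (∣-reflexive (trans (sym b+c≡p) (+-comm b c)))))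
    ... | inj₂ c≤b = sym (%≡-∸ (square c) (square b) p (*-mono-≤ c≤b c≤b)
      (subst (p ∣_) (sym (difference-of-squares c≤b)) (∣n⇒∣m*n (b ∸ c) (∣-reflexive (sym b+c≡p)))))

    square≡0 : ∀ {b} → b < p → square b % p ≡ 0 → b ≡ 0
    square≡0 {zero}  _   _  = refl
    square≡0 {suc b} b<p eq = contradiction
      ([ (λ d → d) , (λ d → d) ]′ (euclidsLemma (suc b) (suc b) pr (m%n≡0⇒n∣m (square (suc b)) p eq))) (>⇒∤ b<p)

  Square : ℕ → Set
  Square n = IsSquareMod (ℤ.+ n) p

  square? : ∀ n → Dec (Square n)
  square? n = isSquareMod? (ℤ.+ n) p

  private
    square⇒root : ∀ {n} → Square n → ∃[ b ] b < p × square b % p ≡ n % p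
    square⇒root {n} (b , b<p , d) = b , b<p , proj₁ (∣-⇔%≡ p (square b) n)
      (subst (λ x → (ℤ.+ p) ℤ∣.∣ (x ℤ.- ℤ.+ n)) (sym (ℤₚ.pos-* b b)) d)

    root⇒square : ∀ {n} b → b < p → square b % p ≡ n % p → Square n
    root⇒square {n} b b<p eq = b , b<p ,
      subst (λ x → (ℤ.+ p) ℤ∣.∣ (x ℤ.- ℤ.+ n)) (ℤₚ.pos-* b b) (proj₂ (∣-⇔%≡ p (square b) n) eq)

    roots : ℕ → ℕ
    roots n = ∑[ b < p ] ind (square b % p ≟ n % p)

    n%p : ∀ {n} → n < p → n % p ≡ n
    n%p = m<n⇒m%n≡m

    -- Double counting: every b below p is a root of exactly one residue.
    ∑-roots : ∑ p roots ≡ p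
    ∑-roots = begin
      (∑[ n < p ] ∑[ b < p ] ind (square b % p ≟ n % p))   ≡⟨ ∑-swap p p _ ⟩
      (∑[ b < p ] ∑[ n < p ] ind (square b % p ≟ n % p))   ≡⟨ ∑-ext p (λ b → trans (∑-cong p λ n n<p → rephrase b n n<p) (∑-ind-≡ p (m%n<n (square b) p))) ⟩
      (∑[ b < p ] 1)                                       ≡⟨ trans (∑-const p 1) (*-identityʳ p) ⟩
      p                                                    ∎
      where
      open ≡-Reasoning
      rephrase : ∀ b n → n < p → ind (square b % p ≟ n % p) ≡ ind (n ≟ square b % p)
      rephrase b n n<p = ind-cong (square b % p ≟ n % p) (n ≟ square b % p)
        (λ eq → trans (sym (n%p n<p)) (sym eq)) (λ eq → trans (sym eq) (sym (n%p n<p)))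

    roots-0 : roots 0 ≡ 1
    roots-0 = trans
      (∑-cong p λ b b<p → ind-cong (square b % p ≟ 0) (b ≟ 0) (square≡0 b<p) (λ where refl → refl))
      (∑-ind-≡ p z<s)

    -- A root b comes with p - b, which differs from b because p is odd, and `roots-±` leaves no
    -- third root.
    roots-nonzero : ∀ {n} → suc n < p → roots (suc n) ≡ 2 * ind (square? (suc n))
    roots-nonzero {n} n<p with square? (suc n)
    ... | no ¬sq = trans
      (∑-cong p λ b b<p → ind-no (square b % p ≟ suc n % p) (¬sq ∘ root⇒square b b<p)) (∑-zero p)
    ... | yes sq with square⇒root sq
    ...   | zero  , _   , eq = contradiction (trans eq (n%p n<p)) λ ()
    ...   | suc b , b<p , eq = begin
      roots (suc n)                                       ≡⟨ ∑-cong p either ⟩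
      (∑[ c < p ] (ind (c ≟ suc b) + ind (c ≟ b̄)))        ≡⟨ ∑-+ p _ _ ⟩
      (∑[ c < p ] ind (c ≟ suc b)) + (∑[ c < p ] ind (c ≟ b̄)) ≡⟨ cong₂ _+_ (∑-ind-≡ p b<p) (∑-ind-≡ p (s≤s (m∸n≤m p′ b))) ⟩
      2                                                   ∎
      where
      open ≡-Reasoning
      -- The root is `suc b`, so this is p minus the root.
      b̄ = p′ ∸ b
      b+b̄ : suc b + b̄ ≡ p
      b+b̄ = cong suc (m+[n∸m]≡n (s≤s⁻¹ (<⇒≤ b<p)))
      b≢b̄ : suc b ≢ b̄
      b≢b̄ b≡b̄ = p≢2c b̄ (trans (sym b+b̄) (cong (_+ b̄) b≡b̄))
      either : ∀ c → c < p → ind (square c % p ≟ suc n % p) ≡ ind (c ≟ suc b) + ind (c ≟ b̄)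
      either c c<p with c ≟ suc b | c ≟ b̄
      ... | yes c≡b | yes c≡b̄ = contradiction (trans (sym c≡b) c≡b̄) b≢b̄
      ... | yes refl | no _   = ind-yes (square c % p ≟ suc n % p) eq
      ... | no _ | yes refl   = ind-yes (square c % p ≟ suc n % p) (trans (sym (opposite {suc b} b+b̄)) eq)
      ... | no c≢b | no c≢b̄  = ind-no (square c % p ≟ suc n % p) λ c²≡ →
        [ c≢b , (λ c+b≡p → c≢b̄ (+-cancelʳ-≡ (suc b) c b̄ (trans c+b≡p (trans (sym b+b̄) (+-comm (suc b) b̄))))) ]′
          (roots-± c<p b<p (trans c²≡ (sym eq)))

    squares nonsquares : ℕ
    squares    = ∑[ n < p′ ] ind (square? (suc n))
    nonsquares = ∑[ n < p′ ] ind (¬? (square? (suc n)))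

    -- The p roots of `∑-roots` without the single root of 0, two for each nonzero square.
    2*squares : 2 * squares ≡ p′
    2*squares = begin
      2 * squares                              ≡⟨ ∑-*ˡ p′ 2 _ ⟨
      (∑[ n < p′ ] (2 * ind (square? (suc n)))) ≡⟨ ∑-cong p′ (λ n n<p′ → roots-nonzero (s≤s n<p′)) ⟨
      (∑[ n < p′ ] roots (suc n))              ≡⟨ suc-injective (trans (cong (_+ ∑ p′ (roots ∘ suc)) (sym roots-0)) (trans (sym (∑-head p′ roots)) ∑-roots)) ⟩
      p′                                       ∎
      where open ≡-Reasoning

    nonsquares≡squares : nonsquares ≡ squares
    nonsquares≡squares = +-cancelˡ-≡ squares nonsquares squares (begin
      squares + nonsquares    ≡⟨ ∑-+ p′ _ _ ⟨
      (∑[ n < p′ ] (ind (square? (suc n)) + ind (¬? (square? (suc n))))) ≡⟨ ∑-ext p′ (λ n → total (square? (suc n))) ⟩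
      (∑[ n < p′ ] 1)         ≡⟨ trans (∑-const p′ 1) (*-identityʳ p′) ⟩
      p′                      ≡⟨ 2*squares ⟨
      2 * squares             ≡⟨ cong (squares +_) (+-identityʳ squares) ⟩
      squares + squares       ∎)
      where
      open ≡-Reasoning
      total : ∀ {P : Set} (P? : Dec P) → ind P? + ind (¬? P?) ≡ 1
      total (yes _) = refl
      total (no _)  = refl

    χ≡legendre : ∀ n → χ p n ≡ legendre (ℤ.+ n) p
    χ≡legendre n rewrite dec-false (p ≟ 2) odd = refl

    χ-divisible : ∀ {n} → p ∣ n → χ p n ≡ 0ℤ
    χ-divisible {n} p∣n rewrite χ≡legendre n | dec-true ((ℤ.+ p) ℤ∣.∣? (ℤ.+ n)) (ℤ∣.∣ᵤ⇒∣ p∣n) = refl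

    χ-square : ∀ {n} → p ∤ n → Square n → χ p n ≡ 1ℤ
    χ-square {n} p∤n sq rewrite χ≡legendre n | dec-false ((ℤ.+ p) ℤ∣.∣? (ℤ.+ n)) (p∤n ∘ ℤ∣.∣⇒∣ᵤ) | dec-true (isSquareMod? (ℤ.+ n) p) sq = refl

    χ-nonsquare : ∀ {n} → p ∤ n → ¬ Square n → χ p n ≡ -1ℤ
    χ-nonsquare {n} p∤n ¬sq rewrite χ≡legendre n | dec-false ((ℤ.+ p) ℤ∣.∣? (ℤ.+ n)) (p∤n ∘ ℤ∣.∣⇒∣ᵤ) | dec-false (isSquareMod? (ℤ.+ n) p) ¬sq = refl

    data χ-View (n : ℕ) : Set where
      divisible : p ∣ n → χ p n ≡ 0ℤ → χ-View n
      residue   : p ∤ n → Square n → χ p n ≡ 1ℤ → χ-View n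
      nonresidue : p ∤ n → ¬ Square n → χ p n ≡ -1ℤ → χ-View n

    χ-view : ∀ n → χ-View n
    χ-view n with p ∣? n | square? n
    ... | yes p∣n | _       = divisible p∣n (χ-divisible p∣n)
    ... | no p∤n  | yes sq  = residue p∤n sq (χ-square p∤n sq)
    ... | no p∤n  | no ¬sq  = nonresidue p∤n ¬sq (χ-nonsquare p∤n ¬sq)

    sign : ∀ n → IsSign (χ p n)
    sign n with χ-view n
    ... | divisible _ eq    = inj₁ eq
    ... | residue _ _ eq    = inj₂ (inj₁ eq)
    ... | nonresidue _ _ eq = inj₂ (inj₂ eq)

    %-shift : ∀ n → (p + n) % p ≡ n % p
    %-shift n = %-remove-+ˡ n ∣-refl

    χ-periodic-p : ∀ n → χ p (p + n) ≡ χ p n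
    χ-periodic-p n with χ-view n
    ... | divisible d eq = trans (χ-divisible (∣m∣n⇒∣m+n ∣-refl d)) (sym eq)
    ... | residue ∤ sq eq = trans (χ-square (λ d → ∤ (∣m+n∣m⇒∣n d ∣-refl)) sq′) (sym eq)
      where
      sq′ : Square (p + n)
      sq′ with square⇒root sq
      ... | b , b<p , e = root⇒square b b<p (trans e (sym (%-shift n)))
    ... | nonresidue ∤ ¬sq eq = trans (χ-nonsquare (λ d → ∤ (∣m+n∣m⇒∣n d ∣-refl)) ¬sq′) (sym eq)
      where
      ¬sq′ : ¬ Square (p + n)
      ¬sq′ sq with square⇒root sq
      ... | b , b<p , e = ¬sq (root⇒square b b<p (trans e (%-shift n)))

    [χ]-periodic : ∀ v → Periodic p [χ p ≡ v ]
    [χ]-periodic v n = cong (λ x → ind (x ℤₚ.≟ v)) (χ-periodic-p n)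

    lf≡ : ∀ n → lf p n ≡ ind (¬? (square p ∣? n))
    lf≡ n = ind-cong (locallyFundamental? p n) (¬? (square p ∣? n))
      (λ h → proj₂ h odd) (λ h → (λ p≡2 → contradiction p≡2 odd) , λ _ → h)

    -- A nonzero symbol already forces p ∤ n, so the condition p² ∤ n is automatic, and what remains
    -- has period p.
    unit-count : ∀ v → v ≢ 0ℤ → (∑[ n < square p ] (lf p n * [χ p ≡ v ] n)) ≡ p * (∑[ n < p′ ] [χ p ≡ v ] (suc n))
    unit-count v v≢0 = begin
      (∑[ n < square p ] (lf p n * [χ p ≡ v ] n))  ≡⟨ ∑-ext (square p) at ⟩
      ∑ (square p) [χ p ≡ v ]                      ≡⟨ ∑-periods ([χ]-periodic v) p ⟩
      p * ∑ p [χ p ≡ v ]                           ≡⟨ cong (p *_) (trans (∑-head p′ [χ p ≡ v ]) (cong (_+ ∑ p′ ([χ p ≡ v ] ∘ suc)) at-0)) ⟩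
      p * (∑[ n < p′ ] [χ p ≡ v ] (suc n))         ∎
      where
      open ≡-Reasoning
      at-0 : [χ p ≡ v ] 0 ≡ 0
      at-0 = ind-no (χ p 0 ℤₚ.≟ v) λ eq → v≢0 (trans (sym eq) (χ-divisible {0} (p ∣0)))
      at : ∀ n → lf p n * [χ p ≡ v ] n ≡ [χ p ≡ v ] n
      at n with χ p n ℤₚ.≟ v
      ... | no _   = *-zeroʳ (lf p n)
      ... | yes eq = trans (*-identityʳ (lf p n)) (trans (lf≡ n)
        (ind-yes (¬? (square p ∣? n)) λ p²∣n → v≢0 (trans (sym eq) (χ-divisible (m*n∣⇒m∣ p p p²∣n)))))

    split-odd : (∑[ n < square p ] (lf p n * [χ p ≡ 1ℤ ] n)) ≡ p * squares
    split-odd = trans (unit-count 1ℤ λ ()) (cong (p *_) (∑-cong p′ λ n n<p′ → at n n<p′))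
      where
      at : ∀ n → n < p′ → [χ p ≡ 1ℤ ] (suc n) ≡ ind (square? (suc n))
      at n n<p′ = ind-cong (χ p (suc n) ℤₚ.≟ 1ℤ) (square? (suc n)) to (χ-square (>⇒∤ (s≤s n<p′)))
        where
        to : χ p (suc n) ≡ 1ℤ → Square (suc n)
        to eq with χ-view (suc n)
        ... | divisible d _     = contradiction d (>⇒∤ (s≤s n<p′))
        ... | residue _ sq _    = sq
        ... | nonresidue _ _ e = contradiction (trans (sym eq) e) λ ()

    inert-odd : (∑[ n < square p ] (lf p n * [χ p ≡ -1ℤ ] n)) ≡ p * squares
    inert-odd = trans (unit-count -1ℤ λ ()) (cong (p *_) (trans (∑-cong p′ λ n n<p′ → at n n<p′) nonsquares≡squares))
      where
      at : ∀ n → n < p′ → [χ p ≡ -1ℤ ] (suc n) ≡ ind (¬? (square? (suc n)))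
      at n n<p′ = ind-cong (χ p (suc n) ℤₚ.≟ -1ℤ) (¬? (square? (suc n))) to (χ-nonsquare (>⇒∤ (s≤s n<p′)))
        where
        to : χ p (suc n) ≡ -1ℤ → ¬ Square (suc n)
        to eq sq = contradiction (trans (sym eq) (χ-square (>⇒∤ (s≤s n<p′)) sq)) λ ()

    -- Of the p multiples of p below p², only 0 is divisible by p².
    ramified-odd : (∑[ n < square p ] (lf p n * [χ p ≡ 0ℤ ] n)) ≡ p′
    ramified-odd = +-cancelʳ-≡ 1 _ p′ (begin
      (∑[ n < square p ] (lf p n * [χ p ≡ 0ℤ ] n)) + 1
        ≡⟨ cong ((∑[ n < square p ] (lf p n * [χ p ≡ 0ℤ ] n)) +_) (∑-ind-∣ (square p)) ⟨
      (∑[ n < square p ] (lf p n * [χ p ≡ 0ℤ ] n)) + (∑[ n < square p ] ind (square p ∣? n))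
        ≡⟨ ∑-+ (square p) _ _ ⟨
      (∑[ n < square p ] (lf p n * [χ p ≡ 0ℤ ] n + ind (square p ∣? n)))
        ≡⟨ ∑-ext (square p) at ⟩
      (∑[ n < square p ] ind (p ∣? n))
        ≡⟨ ∑-periods (ind-∣-periodic p) p ⟩
      p * (∑[ n < p ] ind (p ∣? n))
        ≡⟨ trans (cong (p *_) (∑-ind-∣ p)) (*-identityʳ p) ⟩
      p ≡⟨ +-comm 1 p′ ⟩
      p′ + 1 ∎)
      where
      open ≡-Reasoning
      [χ≡0] : ∀ n → [χ p ≡ 0ℤ ] n ≡ ind (p ∣? n)
      [χ≡0] n = ind-cong (χ p n ℤₚ.≟ 0ℤ) (p ∣? n) to χ-divisible
        where
        to : χ p n ≡ 0ℤ → p ∣ n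
        to eq with χ-view n
        ... | divisible d _     = d
        ... | residue _ _ e    = contradiction (trans (sym eq) e) λ ()
        ... | nonresidue _ _ e = contradiction (trans (sym eq) e) λ ()
      at : ∀ n → lf p n * [χ p ≡ 0ℤ ] n + ind (square p ∣? n) ≡ ind (p ∣? n)
      at n = trans (cong₂ (λ u v → u * v + ind (square p ∣? n)) (lf≡ n) ([χ≡0] n)) (cases (square p ∣? n))
        where
        cases : (d : Dec (square p ∣ n)) → ind (¬? d) * ind (p ∣? n) + ind d ≡ ind (p ∣? n)
        cases (yes p²∣n) = sym (ind-yes (p ∣? n) (m*n∣⇒m∣ p p p²∣n))
        cases (no _)     = trans (+-identityʳ _) (*-identityˡ _)

  localCounts-odd : LocalCounts p
  localCounts-odd = record
    { χ-sign      = sign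
    ; χ-periodic  = λ n → trans (cong (λ m → χ p (m + n)) m≡) (χ-periodic-* p n)
    ; lf-periodic = subst (λ m → Periodic m (lf p)) (sym m≡) λ n → trans (lf≡ (square p + n)) (trans
        (ind-cong (¬? (square p ∣? square p + n)) (¬? (square p ∣? n))
          (λ h d → h (∣m∣n⇒∣m+n ∣-refl d)) (λ h d → h (∣m+n∣m⇒∣n d ∣-refl)))
        (sym (lf≡ n)))
    -- Here z = p - 1 and s = p(p - 1)/2, as half of the nonzero residues are squares and each lifts
    -- to p residues modulo p².
    ; z = p′
    ; s = p * squares
    ; z-nonZero = ≢-nonZero λ p′≡0 → ¬prime[1] (subst (Prime ∘ suc) p′≡0 pr)
    ; 2s≡pz = trans (lem 2 p squares) (cong (p *_) 2*squares)
    ; ramified = trans (cong (λ m → ∑[ n < m ] (lf p n * [χ p ≡ 0ℤ ] n)) m≡) ramified-odd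
    ; split = trans (cong (λ m → ∑[ n < m ] (lf p n * [χ p ≡ 1ℤ ] n)) m≡) split-odd
    ; inert = trans (cong (λ m → ∑[ n < m ] (lf p n * [χ p ≡ -1ℤ ] n)) m≡) inert-odd
    }
    where
    m≡ = localModulus-odd odd
    lem : ∀ a b c → a * (b * c) ≡ b * (a * c)
    lem = solve-∀
    χ-periodic-* : ∀ k n → χ p (k * p + n) ≡ χ p n
    χ-periodic-* zero    n = refl
    χ-periodic-* (suc k) n = trans (cong (χ p) (+-assoc p (k * p) n))
      (trans (χ-periodic-p (k * p + n)) (χ-periodic-* k n))

localCounts : ∀ {p} → Prime p → LocalCounts p
localCounts {zero}  pr = contradiction pr ¬prime[0]
localCounts {suc p′} pr with suc p′ ≟ 2
... | yes refl = localCounts-2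
... | no odd   = OddPrime.localCounts-odd pr odd

-- Pairs of residues modulo one prime

dominant-0 : ∀ {x y} → dominant x y ≡ 0ℤ → x ≡ 0ℤ × y ≡ 0ℤ
dominant-0 {x} {y} eq with y ℤₚ.≟ 0ℤ
... | yes y≡0 = eq , y≡0
... | no y≢0  = contradiction eq y≢0

module LocalPairs {p : ℕ} (pr : Prime p) where
  open LocalCounts (localCounts pr)

  private
    m = localModulus p

  admissible : ℕ → ℕ → ℕ
  admissible a b = lf p a * lf p b

  withSign : ℤ → ℕ → ℕ → ℕ
  withSign ε a b = admissible a b * ind (dominant (χ p a) (χ p b) ℤₚ.≟ ε)

  lf-ext : ∀ n → lf p n ≡ lf p n * [χ p ≡ 0ℤ ] n + lf p n * [χ p ≡ 1ℤ ] n + lf p n * [χ p ≡ -1ℤ ] n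
  lf-ext n with χ p n | χ-sign n
  ... | _ | inj₁ refl        = lem (lf p n)
    where
    lem : ∀ u → u ≡ u * 1 + u * 0 + u * 0
    lem = solve-∀
  ... | _ | inj₂ (inj₁ refl) = lem (lf p n)
    where
    lem : ∀ u → u ≡ u * 0 + u * 1 + u * 0
    lem = solve-∀
  ... | _ | inj₂ (inj₂ refl) = lem (lf p n)
    where
    lem : ∀ u → u ≡ u * 0 + u * 0 + u * 1
    lem = solve-∀

  ∑-lf : ∑ m (lf p) ≡ z + s + s
  ∑-lf = begin
    ∑ m (lf p) ≡⟨ ∑-ext m lf-ext ⟩
    (∑[ n < m ] (lf p n * [χ p ≡ 0ℤ ] n + lf p n * [χ p ≡ 1ℤ ] n + lf p n * [χ p ≡ -1ℤ ] n))
      ≡⟨ trans (∑-+ m _ _) (cong (_+ (∑[ n < m ] (lf p n * [χ p ≡ -1ℤ ] n))) (∑-+ m _ _)) ⟩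
    (∑[ n < m ] (lf p n * [χ p ≡ 0ℤ ] n)) + (∑[ n < m ] (lf p n * [χ p ≡ 1ℤ ] n)) + (∑[ n < m ] (lf p n * [χ p ≡ -1ℤ ] n))
      ≡⟨ cong₂ _+_ (cong₂ _+_ ramified split) inert ⟩
    z + s + s ∎
    where open ≡-Reasoning

  ∑∑-admissible : ∑∑ m admissible ≡ (z + s + s) * (z + s + s)
  ∑∑-admissible = trans (∑-product m m (lf p) (lf p)) (cong₂ _*_ ∑-lf ∑-lf)

  admissible-nonZero : NonZero (∑∑ m admissible)
  admissible-nonZero = subst NonZero (sym ∑∑-admissible) (m*n≢0 _ _ {{nz}} {{nz}})
    where
    nz : NonZero (z + s + s)
    nz = >-nonZero (≤-trans (>-nonZero⁻¹ z {{z-nonZero}}) (≤-trans (m≤m+n z s) (m≤m+n (z + s) s)))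

  ∑∑-zero : ∑∑ m (withSign 0ℤ) ≡ z * z
  ∑∑-zero = trans (∑-ext m λ a → ∑-ext m λ b → at a b)
    (trans (∑-product m m _ _) (cong₂ _*_ ramified ramified))
    where
    lem : ∀ u v x y → u * v * (x * y) ≡ (u * x) * (v * y)
    lem = solve-∀
    at : ∀ a b → withSign 0ℤ a b ≡ (lf p a * [χ p ≡ 0ℤ ] a) * (lf p b * [χ p ≡ 0ℤ ] b)
    at a b = trans
      (cong (admissible a b *_) (ind-× (dominant (χ p a) (χ p b) ℤₚ.≟ 0ℤ) (χ p a ℤₚ.≟ 0ℤ) (χ p b ℤₚ.≟ 0ℤ)
        dominant-0 λ x≡0 y≡0 → subst₂ (λ x y → dominant x y ≡ 0ℤ) (sym x≡0) (sym y≡0) refl))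
      (lem (lf p a) (lf p b) _ _)

  -- Either χ(b) = ε with a arbitrary, or χ(b) = 0 and χ(a) = ε. These cases exclude each other and
  -- give the two summands.
  ∑∑-nonzero : ∀ {ε} → ε ≢ 0ℤ → (∑[ n < m ] (lf p n * [χ p ≡ ε ] n)) ≡ s →
               ∑∑ m (withSign ε) ≡ (z + s + s) * s + s * z
  ∑∑-nonzero {ε} ε≢0 count = begin
    ∑∑ m (withSign ε)
      ≡⟨ ∑-ext m (λ a → trans (∑-ext m λ b → at a b) (∑-+ m _ _)) ⟩
    (∑[ a < m ] ((∑[ b < m ] (lf p a * (lf p b * [χ p ≡ ε ] b))) + (∑[ b < m ] ((lf p a * [χ p ≡ ε ] a) * (lf p b * [χ p ≡ 0ℤ ] b)))))
      ≡⟨ ∑-+ m _ _ ⟩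
    (∑[ a < m ] ∑[ b < m ] (lf p a * (lf p b * [χ p ≡ ε ] b))) + (∑[ a < m ] ∑[ b < m ] ((lf p a * [χ p ≡ ε ] a) * (lf p b * [χ p ≡ 0ℤ ] b)))
      ≡⟨ cong₂ _+_ (∑-product m m (lf p) _) (∑-product m m _ _) ⟩
    ∑ m (lf p) * (∑[ b < m ] (lf p b * [χ p ≡ ε ] b)) + (∑[ a < m ] (lf p a * [χ p ≡ ε ] a)) * (∑[ b < m ] (lf p b * [χ p ≡ 0ℤ ] b))
      ≡⟨ cong₂ _+_ (cong₂ _*_ ∑-lf count) (cong₂ _*_ count ramified) ⟩
    (z + s + s) * s + s * z ∎
    where
    open ≡-Reasoning
    indicator : ∀ x y → ind (dominant x y ℤₚ.≟ ε) ≡ ind (y ℤₚ.≟ ε) + ind (x ℤₚ.≟ ε) * ind (y ℤₚ.≟ 0ℤ)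
    indicator x y with y ℤₚ.≟ 0ℤ
    ... | yes refl = sym (trans (cong (_+ ind (x ℤₚ.≟ ε) * 1) (ind-no (0ℤ ℤₚ.≟ ε) (ε≢0 ∘ sym))) (*-identityʳ _))
    ... | no _     = sym (trans (cong (ind (y ℤₚ.≟ ε) +_) (*-zeroʳ (ind (x ℤₚ.≟ ε)))) (+-identityʳ _))
    lem : ∀ u v x y y₀ → u * v * (y + x * y₀) ≡ u * (v * y) + (u * x) * (v * y₀)
    lem = solve-∀
    at : ∀ a b → withSign ε a b ≡ lf p a * (lf p b * [χ p ≡ ε ] b) + (lf p a * [χ p ≡ ε ] a) * (lf p b * [χ p ≡ 0ℤ ] b)
    at a b = trans (cong (admissible a b *_) (indicator (χ p a) (χ p b)))
      (lem (lf p a) (lf p b) ([χ p ≡ ε ] a) ([χ p ≡ ε ] b) ([χ p ≡ 0ℤ ] b))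

  private
    total≡ : z + s + s ≡ suc p * z
    total≡ = trans (+-assoc z s s) (cong (z +_) (trans (cong (s +_) (sym (+-identityʳ s))) 2s≡pz))

  zero-density : ∑∑ m (withSign 0ℤ) * suc p ^ 2 ≡ 1 * ∑∑ m admissible
  zero-density = begin
    ∑∑ m (withSign 0ℤ) * suc p ^ 2       ≡⟨ cong (_* suc p ^ 2) ∑∑-zero ⟩
    z * z * (suc p * (suc p * 1))        ≡⟨ lem z (suc p) ⟩
    1 * ((suc p * z) * (suc p * z))      ≡⟨ cong (λ t → 1 * (t * t)) total≡ ⟨
    1 * ((z + s + s) * (z + s + s))      ≡⟨ cong (1 *_) ∑∑-admissible ⟨
    1 * ∑∑ m admissible                  ∎
    where
    open ≡-Reasoning
    lem : ∀ z q → z * z * (q * (q * 1)) ≡ 1 * ((q * z) * (q * z))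
    lem = solve-∀

  -- By `total≡` the favourable pairs number (p+1)zs + sz = (p+2)zs out of ((p+1)z)². Replacing 2s
  -- by pz makes the quotient independent of z.
  nonzero-density : ∀ {ε} → ε ≡ 1ℤ ⊎ ε ≡ -1ℤ →
    ∑∑ m (withSign ε) * (2 * suc p ^ 2) ≡ p * (p + 2) * ∑∑ m admissible
  nonzero-density {ε} ε≡±1 = begin
    ∑∑ m (withSign ε) * (2 * suc p ^ 2)                  ≡⟨ cong (_* (2 * suc p ^ 2)) (count ε≡±1) ⟩
    ((z + s + s) * s + s * z) * (2 * (suc p * (suc p * 1))) ≡⟨ cong (λ t → (t * s + s * z) * (2 * (suc p * (suc p * 1)))) total≡ ⟩
    (suc p * z * s + s * z) * (2 * (suc p * (suc p * 1)))    ≡⟨ lem₁ z s p ⟩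
    2 * s * (p + 2) * ((1 + p) * z) * (1 + p)            ≡⟨ cong (λ t → t * (p + 2) * ((1 + p) * z) * (1 + p)) 2s≡pz ⟩
    p * z * (p + 2) * ((1 + p) * z) * (1 + p)            ≡⟨ lem₂ z p ⟩
    p * (p + 2) * ((suc p * z) * (suc p * z))            ≡⟨ cong (λ t → p * (p + 2) * (t * t)) total≡ ⟨
    p * (p + 2) * ((z + s + s) * (z + s + s))            ≡⟨ cong (p * (p + 2) *_) ∑∑-admissible ⟨
    p * (p + 2) * ∑∑ m admissible                        ∎
    where
    open ≡-Reasoning
    count : ε ≡ 1ℤ ⊎ ε ≡ -1ℤ → ∑∑ m (withSign ε) ≡ (z + s + s) * s + s * z
    count (inj₁ refl) = ∑∑-nonzero (λ ()) split
    count (inj₂ refl) = ∑∑-nonzero (λ ()) inert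
    lem₁ : ∀ z s p → ((1 + p) * z * s + s * z) * (2 * ((1 + p) * ((1 + p) * 1))) ≡ 2 * s * (p + 2) * ((1 + p) * z) * (1 + p)
    lem₁ = solve-∀
    lem₂ : ∀ z p → p * z * (p + 2) * ((1 + p) * z) * (1 + p) ≡ p * (p + 2) * (((1 + p) * z) * ((1 + p) * z))
    lem₂ = solve-∀

  admissible-periodic : Periodic₂ m admissible
  admissible-periodic = (λ b a → cong (_* lf p b) (lf-periodic a)) ,ₚ (λ a b → cong (lf p a *_) (lf-periodic b))

  withSign-periodic : ∀ ε → Periodic₂ m (withSign ε)
  withSign-periodic ε =
    (λ b a → cong₂ (λ u x → u * lf p b * ind (dominant x (χ p b) ℤₚ.≟ ε)) (lf-periodic a) (χ-periodic a)) ,ₚ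
    (λ a b → cong₂ (λ u y → lf p a * u * ind (dominant (χ p a) y ℤₚ.≟ ε)) (lf-periodic b) (χ-periodic b))

  admissible≤1 : ∀ a b → admissible a b ≤ 1
  admissible≤1 a b = *-mono-≤ (ind≤1 (locallyFundamental? p a)) (ind≤1 (locallyFundamental? p b))

  withSign≤1 : ∀ ε a b → withSign ε a b ≤ 1
  withSign≤1 ε a b = *-mono-≤ (admissible≤1 a b) (ind≤1 (dominant (χ p a) (χ p b) ℤₚ.≟ ε))

-- The sign of σ and the local description of fundamental discriminants

-- By unique factorisation the list of prime factors of p is a permutation of the singleton p, hence
-- equal to it.
kronecker-prime : ∀ D {p} → Prime p → kronecker D p ≡ kroneckerAtPrime D p
kronecker-prime D {zero}      pr = contradiction pr ¬prime[0]
kronecker-prime D {p@(suc _)} pr = trans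
  (cong (productℤ ∘ map (kroneckerAtPrime D))
    (↭-singleton-inv (factorisationUnique (factorise p) (primeFactorisation[p] pr))))
  (ℤₚ.*-identityʳ (kroneckerAtPrime D p))

divisor-indices : ∀ {p} → Prime p → filter (λ j → suc j ∣? p) (upTo p) ≡ 0 ∷ pred p ∷ []
divisor-indices {0} pr = contradiction pr ¬prime[0]
divisor-indices {1} pr = contradiction pr ¬prime[1]
divisor-indices {p@(suc (suc n))} pr = begin
  filter divides? (0 ∷ applyUpTo suc (suc n))          ≡⟨ cong (λ xs → filter divides? (0 ∷ xs)) (applyUpTo-∷ʳ suc n) ⟨
  filter divides? (0 ∷ (applyUpTo suc n ∷ʳ suc n))     ≡⟨ filter-accept divides? (1∣ p) ⟩
  0 ∷ filter divides? (applyUpTo suc n ∷ʳ suc n)       ≡⟨ cong (0 ∷_) (filter-++ divides? (applyUpTo suc n) (suc n ∷ [])) ⟩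
  0 ∷ (filter divides? (applyUpTo suc n) ++ filter divides? (suc n ∷ []))
    ≡⟨ cong (0 ∷_) (cong₂ _++_ (filter-none divides? (Allₚ.applyUpTo⁺₁ suc n middle)) (filter-accept divides? {suc n} ∣-refl)) ⟩
  0 ∷ suc n ∷ []                                       ∎
  where
  open ≡-Reasoning
  divides? : ∀ j → Dec (suc j ∣ p)
  divides? j = suc j ∣? p
  middle : ∀ {i} → i < n → suc (suc i) ∤ p
  middle i<n d = [ (λ ()) , (λ eq → <⇒≢ i<n (suc-injective (suc-injective eq))) ]′ (prime⇒irreducible pr d)

-- |χ₂(p) p^(k-1)| exceeds |χ₁(p)| unless χ₂(p) = 0.
sgn-dominant : ∀ {x y} → IsSign x → IsSign y → ∀ n → 2 ≤ n → sgn (x ℤ.+ y ℤ.* ℤ.+ n) ≡ dominant x y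
sgn-dominant (inj₁ refl)        (inj₁ refl)        (suc (suc n)) _ = refl
sgn-dominant (inj₂ (inj₁ refl)) (inj₁ refl)        (suc (suc n)) _ = refl
sgn-dominant (inj₂ (inj₂ refl)) (inj₁ refl)        (suc (suc n)) _ = refl
sgn-dominant (inj₁ refl)        (inj₂ (inj₁ refl)) (suc (suc n)) _ = refl
sgn-dominant (inj₂ (inj₁ refl)) (inj₂ (inj₁ refl)) (suc (suc n)) _ = refl
sgn-dominant (inj₂ (inj₂ refl)) (inj₂ (inj₁ refl)) (suc (suc n)) _ = refl
sgn-dominant (inj₁ refl)        (inj₂ (inj₂ refl)) (suc (suc n)) _ = refl
sgn-dominant (inj₂ (inj₁ refl)) (inj₂ (inj₂ refl)) (suc (suc n)) _ = refl
sgn-dominant (inj₂ (inj₂ refl)) (inj₂ (inj₂ refl)) (suc (suc n)) _ = refl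
sgn-dominant _ _ (suc zero) (s≤s ())

sgn-σ : ∀ {k p} → 2 ≤ k → Prime p → ∀ a b →
  sgn (σ (kronecker (ℤ.+ a)) (kronecker (ℤ.+ b)) (k ∸ 1) p) ≡ dominant (χ p a) (χ p b)
sgn-σ {suc (suc k)} {0} _ pr = contradiction pr ¬prime[0]
sgn-σ {suc (suc k)} {1} _ pr = contradiction pr ¬prime[1]
sgn-σ {suc zero} (s≤s ())
sgn-σ {suc (suc k)} {p@(suc (suc n))} _ pr a b = trans (cong sgn value)
  -- Since k ≥ 2 the exponent is positive, so the power of p is at least 2, as domination requires.
  (sgn-dominant (χ-sign a) (χ-sign b) (p ^ suc k) (≤-trans (s≤s (s≤s z≤n)) (m≤m*n p (p ^ k) {{m^n≢0 p k}})))
  where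
  open LocalCounts (localCounts pr)
  χ₁ χ₂ : ℕ → ℤ
  χ₁ = kronecker (ℤ.+ a)
  χ₂ = kronecker (ℤ.+ b)
  term : ℕ → ℤ
  term j = χ₁ (p / suc j) ℤ.* χ₂ (suc j) ℤ.* ℤ.+ (suc j ^ suc k)
  term-1 : term 0 ≡ χ p a
  term-1 = begin
    -- At 1 the Kronecker symbol is an empty product and reduces to `1ℤ`.
    χ₁ (p / 1) ℤ.* 1ℤ ℤ.* ℤ.+ (1 ^ suc k) ≡⟨ cong₂ (λ u v → χ₁ u ℤ.* 1ℤ ℤ.* ℤ.+ v) (n/1≡n p) (^-zeroˡ (suc k)) ⟩
    χ₁ p ℤ.* 1ℤ ℤ.* 1ℤ                     ≡⟨ trans (ℤₚ.*-identityʳ _) (ℤₚ.*-identityʳ _) ⟩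
    χ₁ p                                  ≡⟨ kronecker-prime (ℤ.+ a) pr ⟩
    χ p a                                 ∎
    where open ≡-Reasoning
  term-p : term (suc n) ≡ χ p b ℤ.* ℤ.+ (p ^ suc k)
  term-p = begin
    χ₁ (p / p) ℤ.* χ₂ p ℤ.* ℤ.+ (p ^ suc k) ≡⟨ cong (λ u → χ₁ u ℤ.* χ₂ p ℤ.* ℤ.+ (p ^ suc k)) (n/n≡1 p) ⟩
    1ℤ ℤ.* χ₂ p ℤ.* ℤ.+ (p ^ suc k)         ≡⟨ cong (ℤ._* ℤ.+ (p ^ suc k)) (ℤₚ.*-identityˡ (χ₂ p)) ⟩
    χ₂ p ℤ.* ℤ.+ (p ^ suc k)               ≡⟨ cong (ℤ._* ℤ.+ (p ^ suc k)) (kronecker-prime (ℤ.+ b) pr) ⟩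
    χ p b ℤ.* ℤ.+ (p ^ suc k)              ∎
    where open ≡-Reasoning
  value : σ χ₁ χ₂ (suc k) p ≡ χ p a ℤ.+ χ p b ℤ.* ℤ.+ (p ^ suc k)
  value = trans (cong (sumℤ ∘ map term) (divisor-indices pr))
    (cong₂ ℤ._+_ term-1 (trans (ℤₚ.+-identityʳ _) term-p))

-- Fundamental discriminants by conditions at each prime

primeDivisor : ∀ n → n ≢ 1 → ∃[ q ] Prime q × q ∣ n
primeDivisor zero      _   = 2 , prime[2] , 2 ∣0
primeDivisor n@(suc _) n≢1 with factorise n
... | record { factors = []    ; isFactorisation = eq } = contradiction eq n≢1
... | record { factors = q ∷ qs ; isFactorisation = eq ; factorsPrime = pr ∷ _ } =
  q , pr , subst (q ∣_) (sym eq) (m∣m*n (product qs))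

noPrimeSquare⇒squarefree : ∀ n → (∀ {q} → Prime q → square q ∤ n) → Squarefree n
noPrimeSquare⇒squarefree n free d d²∣n with d ≟ 1
... | yes d≡1 = d≡1
... | no d≢1 with primeDivisor d d≢1
...   | q , pr , q∣d = contradiction (∣-trans (*-pres-∣ q∣d q∣d) d²∣n) (free pr)

squarefree⇒noPrimeSquare : ∀ {n} → Squarefree n → ∀ {q} → Prime q → square q ∤ n
squarefree⇒noPrimeSquare sf pr q²∣n = ¬prime[1] (subst Prime (sf _ q²∣n) pr)

prime-∣-prime : ∀ {p q} → Prime p → Prime q → q ∣ p → q ≡ p
prime-∣-prime prp prq q∣p with prime⇒irreducible prp q∣p
... | inj₁ refl = contradiction prq ¬prime[1]
... | inj₂ q≡p  = q≡p

prime-∣-square : ∀ {q} m → Prime q → q ∣ square m → q ∣ m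
prime-∣-square m pr d = [ (λ d → d) , (λ d → d) ]′ (euclidsLemma m m pr d)

4∣⇒%4≡0 : ∀ {n} → 4 ∣ n → n % 4 ≡ 0
4∣⇒%4≡0 {n} = n∣m⇒m%n≡0 n 4

*4-%16 : ∀ {r} m → m % 4 ≡ r → m * 4 % 16 ≡ r * 4
*4-%16 m refl = sym (m%n*o≡m*o%[n*o] m 4 4)

odd-square-∣-*4 : ∀ {q} m → Prime q → q ≢ 2 → square q ∣ m * 4 → square q ∣ m
odd-square-∣-*4 {q} m pr q≢2 d = coprime-divisor (coprime-sym (coprime-* 4⊥q 4⊥q)) (subst (square q ∣_) (*-comm m 4) d)
  where
  4⊥q : Coprime 4 q
  4⊥q = prime-∤⇒coprime pr λ q∣4 → q≢2 (prime-∣-prime prime[2] pr (prime-∣-square 2 pr q∣4))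

-- For n = 4m an odd q² cannot see the factor 4, and m ≡ 2, 3 modulo 4 turns into n ≡ 8, 12 modulo
-- 16.
fundamental⇒locallyFundamental : ∀ {n} → IsRealFundamentalDiscriminant (ℤ.+ n) →
  n ≢ 1 × (∀ {q} → Prime q → LocallyFundamental q n)
fundamental⇒locallyFundamental (_ , inj₁ (n≢1 , n%4≡1 , sf)) =
  n≢1 ∘ cong (λ m → ℤ.+ m) , λ pr → (λ _ → inj₁ n%4≡1) , λ _ → squarefree⇒noPrimeSquare sf pr
fundamental⇒locallyFundamental {zero}  (ℤ.+<+ () , _)
fundamental⇒locallyFundamental {suc n} (_ , inj₂ (ℤ.-[1+ m ] , () , _))
fundamental⇒locallyFundamental {suc n} (_ , inj₂ (ℤ.+ m , eq , m%4 , sf)) =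
  (λ n≡1 → contradiction (trans (cong (_% 4) n≡) (m*n%n≡0 m 4)) (λ 0≡ → 1≢0′ (trans (sym (cong (_% 4) n≡1)) 0≡))) ,
  λ {q} pr → (λ _ → subst OkAt2 (sym n≡) (inj₂ (at2 m%4))) ,
         (λ q≢2 q²∣n → squarefree⇒noPrimeSquare sf pr (odd-square-∣-*4 m pr q≢2 (subst (square q ∣_) n≡ q²∣n)))
  where
  n≡ : suc n ≡ m * 4
  n≡ = ℤₚ.+-injective (trans eq (sym (ℤₚ.pos-* m 4)))
  1≢0′ : 1 ≢ 0
  1≢0′ ()
  at2 : m % 4 ≡ 2 ⊎ m % 4 ≡ 3 → m * 4 % 16 ≡ 8 ⊎ m * 4 % 16 ≡ 12
  at2 (inj₁ m%4≡2) = inj₁ (*4-%16 m m%4≡2)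
  at2 (inj₂ m%4≡3) = inj₂ (*4-%16 m m%4≡3)

-- The condition at 2 selects the kind of discriminant and excludes the square of 2; the conditions
-- at odd primes supply the rest of squarefreeness.
locallyFundamental⇒fundamental : ∀ {n} → 0 < n → n ≢ 1 → (∀ {q} → Prime q → LocallyFundamental q n) →
  IsRealFundamentalDiscriminant (ℤ.+ n)
locallyFundamental⇒fundamental {n} 0<n n≢1 local = ℤ.+<+ 0<n , cases (proj₁ (local prime[2]) refl)
  where
  fourfold : ∀ r → r % 4 ≡ 2 ⊎ r % 4 ≡ 3 → n % 16 ≡ r * 4 → IsFundamentalDiscriminant (ℤ.+ n)
  fourfold r r%4 n%16 = inj₂ (ℤ.+ m , trans (cong (λ k → ℤ.+ k) n≡) (ℤₚ.pos-* m 4) ,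
    subst (λ k → k ≡ 2 ⊎ k ≡ 3) (sym m%4) r%4 , noPrimeSquare⇒squarefree m free)
    where
    -- This is n/4, written so that its residue modulo 4 can be read off.
    m = r + n / 16 * 4
    m%4 : m % 4 ≡ r % 4
    m%4 = [m+kn]%n≡m%n r (n / 16) 4
    r≢0 : r % 4 ≢ 0
    r≢0 r≡0 = [ (λ eq → contradiction (trans (sym r≡0) eq) λ ()) , (λ eq → contradiction (trans (sym r≡0) eq) λ ()) ]′ r%4
    lem : ∀ r k → r * 4 + k * 16 ≡ (r + k * 4) * 4
    lem = solve-∀
    n≡ : n ≡ m * 4
    n≡ = trans (m≡m%n+[m/n]*n n 16) (trans (cong (_+ n / 16 * 16) n%16) (lem r (n / 16)))
    free : ∀ {q} → Prime q → square q ∤ m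
    free {q} pr q²∣m with q ≟ 2
    ... | yes refl = r≢0 (trans (sym m%4) (4∣⇒%4≡0 q²∣m))
    ... | no q≢2   = proj₂ (local pr) q≢2 (subst (square q ∣_) (sym n≡) (∣m⇒∣m*n 4 q²∣m))
  cases : OkAt2 n → IsFundamentalDiscriminant (ℤ.+ n)
  cases (inj₁ n%4≡1) = inj₁ (n≢1 ∘ ℤₚ.+-injective , n%4≡1 , noPrimeSquare⇒squarefree n free)
    where
    free : ∀ {q} → Prime q → square q ∤ n
    free {q} pr q²∣n with q ≟ 2
    ... | yes refl = contradiction (trans (sym n%4≡1) (4∣⇒%4≡0 q²∣n)) λ ()
    ... | no q≢2   = proj₂ (local pr) q≢2 q²∣n
  cases (inj₂ (inj₁ n%16≡8))  = fourfold 2 (inj₁ refl) n%16≡8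
  cases (inj₂ (inj₂ n%16≡12)) = fourfold 3 (inj₂ refl) n%16≡12

-- Products of indicators, and the global modulus

ind≢0 : ∀ {P : Set} (P? : Dec P) → ind P? ≢ 0 → P
ind≢0 (yes p) _ = p
ind≢0 (no _)  h = contradiction refl h

*≢0ˡ : ∀ a b → a * b ≢ 0 → a ≢ 0
*≢0ˡ a b h refl = h refl

*≢0ʳ : ∀ a b → a * b ≢ 0 → b ≢ 0
*≢0ʳ a b h refl = h (*-zeroʳ a)

∏≢0 : ∀ {n} (f : Fin n → ℕ) → ∏ f ≢ 0 → ∀ i → f i ≢ 0
∏≢0 f h zero    = *≢0ˡ (f zero) _ h
∏≢0 f h (suc i) = ∏≢0 (f ∘ suc) (*≢0ʳ (f zero) _ h) i

∏-1 : ∀ {n} (f : Fin n → ℕ) → (∀ i → f i ≡ 1) → ∏ f ≡ 1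
∏-1 {zero}  f f≡1 = refl
∏-1 {suc n} f f≡1 = cong₂ _*_ (f≡1 zero) (∏-1 (f ∘ suc) (f≡1 ∘ suc))

ind-all : ∀ {n} {R : Set} {P : Fin n → Set} (R? : Dec R) (P? : ∀ i → Dec (P i)) →
          (R → ∀ i → P i) → ((∀ i → P i) → R) → ind R? ≡ ∏ λ i → ind (P? i)
ind-all {zero}  R? P? f g = ind-yes R? (g λ ())
ind-all {suc n} {P = P} R? P? f g = trans
  (ind-× R? (P? zero) (all? (P? ∘ suc)) (λ r → f r zero , f r ∘ suc) λ p₀ ps → g (both p₀ ps))
  (cong (ind (P? zero) *_) (ind-all (all? (P? ∘ suc)) (P? ∘ suc) (λ h → h) (λ h → h)))
  where
  both : P zero → (∀ i → P (suc i)) → ∀ i → P i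
  both p₀ ps zero    = p₀
  both p₀ ps (suc i) = ps i

prime-∣-∏ : ∀ {n q} → Prime q → (f : Fin n → ℕ) → q ∣ ∏ f → ∃[ i ] q ∣ f i
prime-∣-∏ {zero}  pr f d = contradiction (subst Prime (∣1⇒≡1 d) pr) ¬prime[1]
prime-∣-∏ {suc n} pr f d with euclidsLemma (f zero) _ pr d
... | inj₁ d₀ = zero , d₀
... | inj₂ ds with prime-∣-∏ pr (f ∘ suc) ds
...   | i , dᵢ = suc i , dᵢ

prime-∣-16 : ∀ {q} → Prime q → q ∣ 16 → q ≡ 2
prime-∣-16 pr q∣16 = prime-∣-prime prime[2] pr (prime-∣-square 2 pr (prime-∣-square 4 pr q∣16))

prime-∣-localModulus : ∀ {p q} → Prime p → Prime q → q ∣ localModulus p → q ≡ p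
prime-∣-localModulus {p} prp prq d with p ≟ 2
... | yes refl = prime-∣-16 prq d
... | no p≢2   = prime-∣-prime prp prq (prime-∣-square p prq (subst (_ ∣_) (localModulus-odd p≢2) d))

∣-localModulus : ∀ p → p ∣ localModulus p
∣-localModulus p with p ≟ 2
... | yes refl = divides 8 refl
... | no p≢2   = subst (p ∣_) (sym (localModulus-odd p≢2)) (m∣m*n p)

coprime-localModulus : ∀ {m p} → Prime p → p ∤ m → Coprime m (localModulus p)
coprime-localModulus {m} {p} pr p∤m with p ≟ 2
... | yes refl = coprime-* (coprime-* m⊥2 m⊥2) (coprime-* m⊥2 m⊥2)
  where
  m⊥2 : Coprime m 2
  m⊥2 = prime-∤⇒coprime pr p∤m
... | no p≢2   = subst (Coprime m) (sym (localModulus-odd p≢2)) (coprime-* m⊥p m⊥p)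
  where
  m⊥p : Coprime m p
  m⊥p = prime-∤⇒coprime pr p∤m

localModulus-nonZero : ∀ {p} → Prime p → NonZero (localModulus p)
localModulus-nonZero {p} pr with p ≟ 2
... | yes refl = _
... | no p≢2   = subst NonZero (sym (localModulus-odd p≢2)) (m*n≢0 p p {{prime⇒nonZero pr}} {{prime⇒nonZero pr}})

module Pattern {ℓ} (p : Fin ℓ → ℕ) (pr : ∀ i → Prime (p i)) (p-inj : Injective _≡_ _≡_ p) where

  With2 : Set
  With2 = ∃[ i ] p i ≡ 2

  -- The condition at 2 is part of being a discriminant even if 2 is not among the pᵢ.
  extraModulus : Dec With2 → ℕ
  extraModulus (yes _) = 1
  extraModulus (no _)  = localModulus 2

  extraCondition : Dec With2 → ℕ → ℕ
  extraCondition (yes _) n = 1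
  extraCondition (no _)  n = lf 2 n

  with2? : Dec With2
  with2? = any? λ i → p i ≟ 2

  private
    e : ℕ
    e = extraModulus with2?

    E : ℕ → ℕ
    E = extraCondition with2?

    m : Fin ℓ → ℕ
    m i = localModulus (p i)

  modulus : ℕ
  modulus = ∏ m * e

  private
    M = modulus

    e-nonZero : (d : Dec With2) → NonZero (extraModulus d)
    e-nonZero (yes _) = _
    e-nonZero (no _)  = _

    ∏m-nonZero : NonZero (∏ m)
    ∏m-nonZero = ∏-nonZero m λ i → localModulus-nonZero (pr i)

  modulus-nonZero : NonZero modulus
  modulus-nonZero = m*n≢0 (∏ m) e {{∏m-nonZero}} {{e-nonZero with2?}}

  private
    p∣M : ∀ i → p i ∣ M
    p∣M i = ∣-trans (∣-localModulus (p i)) (∣-trans (∏-∣ m i) (m∣m*n e))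

  2∣modulus : 2 ∣ modulus
  2∣modulus with with2? in eq
  ... | yes (i , pᵢ≡2) = subst₂ (λ q d → q ∣ ∏ m * extraModulus d) pᵢ≡2 eq (p∣M i)
  ... | no _           = ∣n⇒∣m*n (∏ m) (∣-localModulus 2)

  private
    prime-∣-M : ∀ {q} → Prime q → q ∣ M → (∃[ i ] p i ≡ q) ⊎ (q ≡ 2 × ¬ With2)
    prime-∣-M {q} prq d with euclidsLemma (∏ m) e prq d
    ... | inj₁ d∏ with prime-∣-∏ prq m d∏
    ...   | i , dᵢ = inj₁ (i , sym (prime-∣-localModulus (pr i) prq dᵢ))
    prime-∣-M {q} prq d | inj₂ dₑ = inj₂ (at with2? dₑ)
      where
      at : (w : Dec With2) → q ∣ extraModulus w → q ≡ 2 × ¬ With2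
      at (yes _) d = contradiction (subst Prime (∣1⇒≡1 d) prq) ¬prime[1]
      at (no ¬w) d = prime-∣-16 prq d , ¬w

    E⇐ : (w : Dec With2) → ∀ {n} → LocallyFundamental 2 n → extraCondition w n ≡ 1
    E⇐ (yes _) _ = refl
    E⇐ (no _)  h = ind-yes (locallyFundamental? 2 _) h

    E⇒ : (w : Dec With2) → ¬ With2 → ∀ {n} → extraCondition w n ≢ 0 → LocallyFundamental 2 n
    E⇒ (yes w) ¬w _ = contradiction w ¬w
    E⇒ (no _)  _  h = ind≢0 (locallyFundamental? 2 _) h

    E≤1 : (w : Dec With2) → ∀ n → extraCondition w n ≤ 1
    E≤1 (yes _) n = ≤-refl
    E≤1 (no _)  n = ind≤1 (locallyFundamental? 2 n)

    E-periodic : (w : Dec With2) → Periodic (extraModulus w) (extraCondition w)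
    E-periodic (yes _) n = refl
    E-periodic (no _)  n = LocalCounts.lf-periodic localCounts-2 n

    E²-periodic : Periodic₂ e (λ a b → E a * E b)
    E²-periodic = (λ b a → cong (_* E b) (E-periodic with2? a)) ,ₚ (λ a b → cong (E a *_) (E-periodic with2? b))

    instance
      M-nonZero : NonZero M
      M-nonZero = modulus-nonZero

    open Sieve M using (sieve; sifted; sifted≤1; Sifting; removes?)

    sieve-free : ∀ Q {n} → sieve Q n ≢ 0 → ∀ {q} → 1 ≤ q → q ≤ Q → Sifting q → square q ∤ n
    sieve-free zero    h 1≤q q≤Q s d = contradiction (≤-trans 1≤q q≤Q) λ ()
    sieve-free (suc Q) {n} h 1≤q q≤Q s d with m≤n⇒m<n∨m≡n q≤Q
    ... | inj₁ q<1+Q = sieve-free Q (*≢0ˡ (sieve Q n) _ h) 1≤q (s≤s⁻¹ q<1+Q) s d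
    ... | inj₂ refl  = ind≢0 (¬? (removes? (suc Q) n)) (*≢0ʳ (sieve Q n) _ h) (s , d)

    free-sieve : ∀ Q {n} → (∀ {q} → Sifting q → square q ∤ n) → sieve Q n ≡ 1
    free-sieve zero    h = refl
    free-sieve (suc Q) {n} h = cong₂ _*_ (free-sieve Q h) (ind-yes (¬? (removes? (suc Q) n)) λ (s , d) → h s d)

  real? : ∀ n → Dec (IsRealFundamentalDiscriminant (ℤ.+ n))
  real? n = 0ℤ ℤₚ.<? ℤ.+ n ×-dec isFundamentalDiscriminant? (ℤ.+ n)

  -- Every prime is accounted for once: those outside M by the sieve, the pᵢ by their own factors,
  -- and 2 by `E` if it is not among them. The exclusion of 1 is part of `sifted`.
  real-factors : ∀ {x n} → 0 < n → n ≤ x → ind (real? n) ≡ sifted x n * (E n * ∏ λ i → lf (p i) n)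
  real-factors {x} {n} 0<n n≤x with real? n
  ... | yes fd = sym (cong₂ _*_ sifted≡1 (cong₂ _*_ (E⇐ with2? (local prime[2])) (∏-1 _ λ i → ind-yes (locallyFundamental? (p i) n) (local (pr i)))))
    where
    n≢1 : n ≢ 1
    n≢1 = proj₁ (fundamental⇒locallyFundamental fd)
    local : ∀ {q} → Prime q → LocallyFundamental q n
    local = proj₂ (fundamental⇒locallyFundamental fd)
    sifted≡1 : sifted x n ≡ 1
    sifted≡1 = cong₂ _*_ (ind-yes (¬? (n ≟ 1)) n≢1)
      (free-sieve x λ (prq , q∤M) → proj₂ (local prq) (λ q≡2 → q∤M (subst (_∣ M) (sym q≡2) 2∣modulus)))
  ... | no ¬fd with sifted x n * (E n * ∏ λ i → lf (p i) n) ≟ 0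
  ...   | yes ≡0 = sym ≡0
  ...   | no ≢0  = contradiction (locallyFundamental⇒fundamental 0<n n≢1 local) ¬fd
    where
    S≢0 : sifted x n ≢ 0
    S≢0 = *≢0ˡ (sifted x n) _ ≢0
    EL≢0 : E n * (∏ λ i → lf (p i) n) ≢ 0
    EL≢0 = *≢0ʳ (sifted x n) _ ≢0
    n≢1 : n ≢ 1
    n≢1 = ind≢0 (¬? (n ≟ 1)) (*≢0ˡ (ind (¬? (n ≟ 1))) (sieve x n) S≢0)
    local : ∀ {q} → Prime q → LocallyFundamental q n
    local {q} prq with q ∣? M
    ... | no q∤M = (λ q≡2 → contradiction (subst (_∣ M) (sym q≡2) 2∣modulus) q∤M) , λ _ q²∣n →
      -- If q² divides n ≤ x then q ≤ x, so the sieve up to x has tested q.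
      sieve-free x (*≢0ʳ (ind (¬? (n ≟ 1))) (sieve x n) S≢0) (>-nonZero⁻¹ q {{prime⇒nonZero prq}})
        (≤-trans (≤-trans (m≤m*n q q {{prime⇒nonZero prq}}) (∣⇒≤ {{>-nonZero 0<n}} q²∣n)) n≤x) (prq , q∤M) q²∣n
    ... | yes q∣M with prime-∣-M prq q∣M
    ...   | inj₁ (i , refl)   = ind≢0 (locallyFundamental? (p i) n) (∏≢0 (λ i → lf (p i) n) (*≢0ʳ (E n) _ EL≢0) i)
    ...   | inj₂ (refl , ¬w2) = E⇒ with2? ¬w2 (*≢0ˡ (E n) _ EL≢0)

  pairWeight : (Fin ℓ → ℕ → ℕ → ℕ) → ℕ → ℕ → ℕ
  pairWeight F a b = (E a * E b) * ∏ λ i → F i a b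

  pairWeight-periodic : ∀ {F} → (∀ i → Periodic₂ (m i) (F i)) → Periodic₂ M (pairWeight F)
  pairWeight-periodic {F} per = *-periodic₂ E²-periodic (∏-periodic₂ m F per)

  pairWeight≤1 : ∀ {F} → (∀ i a b → F i a b ≤ 1) → ∀ a b → pairWeight F a b ≤ 1
  pairWeight≤1 F≤1 a b = *-mono-≤ (*-mono-≤ (E≤1 with2? a) (E≤1 with2? b)) (∏-≤1 _ λ i → F≤1 i a b)

  extraTotal : ℕ
  extraTotal = ∑∑ e (λ a b → E a * E b)

  extraTotal-nonZero : NonZero extraTotal
  extraTotal-nonZero = go with2?
    where
    go : (w : Dec With2) → NonZero (∑∑ (extraModulus w) (λ a b → extraCondition w a * extraCondition w b))
    go (yes _) = _
    go (no _)  = LocalPairs.admissible-nonZero prime[2]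

  -- The factor `extraTotal` is the same for every F, so a possible extra condition at 2 cancels
  -- from the proportion.
  ∑∑-pairWeight : ∀ {F} → (∀ i → Periodic₂ (m i) (F i)) →
    ∑∑ M (pairWeight F) ≡ extraTotal * ∏ λ i → ∑∑ (m i) (F i)
  ∑∑-pairWeight {F} per = trans
    (∑∑-crt {{∏m-nonZero}} e⊥∏m E²-periodic (∏-periodic₂ m F per))
    (cong (extraTotal *_) (∑∑-∏ m F (λ i → localModulus-nonZero (pr i)) pairwise per))
    where
    e⊥∏m : Coprime e (∏ m)
    e⊥∏m = go with2?
      where
      go : (w : Dec With2) → Coprime (extraModulus w) (∏ m)
      go (yes _)  = 1-coprimeTo (∏ m)
      go (no ¬w)  = coprime-∏ m λ i → coprime-localModulus (pr i) λ d → ¬w (i , prime-∣-16 (pr i) d)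
    pairwise : ∀ {i j} → i ≢ j → Coprime (m i) (m j)
    pairwise {i} {j} i≢j = coprime-localModulus (pr j) λ d → i≢j (sym (p-inj (prime-∣-localModulus (pr i) (pr j) d)))

-- From filtered lists to sums over the hyperbola

module _ {A : Set} {P : A → Set} (P? : ∀ x → Dec (P x)) where

  length-filter-∷ : ∀ x xs → length (filter P? (x ∷ xs)) ≡ ind (P? x) + length (filter P? xs)
  length-filter-∷ x xs with P? x
  ... | yes _ = refl
  ... | no _  = refl

  length-filter-applyUpTo : ∀ f n → length (filter P? (applyUpTo f n)) ≡ (∑[ i < n ] ind (P? (f i)))
  length-filter-applyUpTo f zero    = refl
  length-filter-applyUpTo f (suc n) = begin
    length (filter P? (f 0 ∷ applyUpTo (f ∘ suc) n))                ≡⟨ length-filter-∷ (f 0) _ ⟩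
    ind (P? (f 0)) + length (filter P? (applyUpTo (f ∘ suc) n))     ≡⟨ cong (ind (P? (f 0)) +_) (length-filter-applyUpTo (f ∘ suc) n) ⟩
    ind (P? (f 0)) + (∑[ i < n ] ind (P? (f (suc i))))              ≡⟨ ∑-head n (λ i → ind (P? (f i))) ⟨
    (∑[ i < suc n ] ind (P? (f i)))                                 ∎
    where open ≡-Reasoning

  length-filter-filter : ∀ {Q : A → Set} (Q? : ∀ x → Dec (Q x)) xs →
    length (filter Q? (filter P? xs)) ≡ length (filter (λ x → P? x ×-dec Q? x) xs)
  length-filter-filter Q? []       = refl
  length-filter-filter Q? (x ∷ xs) with P? x | Q? x
  ... | no _  | _     = length-filter-filter Q? xs
  ... | yes _ | yes q rewrite dec-true (Q? x) q = cong suc (length-filter-filter Q? xs)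
  ... | yes _ | no ¬q rewrite dec-false (Q? x) ¬q = length-filter-filter Q? xs

length-filter-grid : ∀ {P : ℤ × ℤ → Set} (P? : ∀ x → Dec (P x)) f g m n →
  length (filter P? (cartesianProduct (applyUpTo f m) (applyUpTo g n))) ≡ (∑[ i < m ] ∑[ j < n ] ind (P? (f i , g j)))
length-filter-grid P? f g zero    n = refl
length-filter-grid P? f g (suc m) n = begin
  length (filter P? (map (f 0 ,_) (applyUpTo g n) ++ rest))
    ≡⟨ trans (cong length (filter-++ P? (map (f 0 ,_) (applyUpTo g n)) rest)) (length-++ (filter P? (map (f 0 ,_) (applyUpTo g n)))) ⟩
  length (filter P? (map (f 0 ,_) (applyUpTo g n))) + length (filter P? rest)
    ≡⟨ cong₂ _+_ (trans (cong (length ∘ filter P?) (map-applyUpTo g (f 0 ,_) n)) (length-filter-applyUpTo P? (λ j → f 0 , g j) n))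
                 (length-filter-grid P? (f ∘ suc) g m n) ⟩
  (∑[ j < n ] ind (P? (f 0 , g j))) + (∑[ i < m ] ∑[ j < n ] ind (P? (f (suc i) , g j)))
    ≡⟨ ∑-head m (λ i → ∑[ j < n ] ind (P? (f i , g j))) ⟨
  (∑[ i < suc m ] ∑[ j < n ] ind (P? (f i , g j))) ∎
  where
  open ≡-Reasoning
  rest = cartesianProduct (applyUpTo (f ∘ suc) m) (applyUpTo g n)

module Counting {ℓ} (p : Fin ℓ → ℕ) (pr : ∀ i → Prime (p i)) (p-inj : Injective _≡_ _≡_ p) where
  open Pattern p pr p-inj

  private
    instance
      M-nonZero : NonZero modulus
      M-nonZero = modulus-nonZero

  open Sieve modulus using (sifted)
  open Asymptotics modulus 2∣modulus using (pairs)

  module _ {S : ℤ × ℤ → Set} (S? : ∀ P → Dec (S P)) (t : Fin ℓ → ℕ → ℕ → ℕ)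
           (S≡t : ∀ a b → ind (S? (ℤ.+ a , ℤ.+ b)) ≡ ∏ λ i → t i a b) where
    private
      weight : ℕ → ℕ → ℕ
      weight = pairWeight λ i a b → LocalPairs.admissible (pr i) a b * t i a b

      counted? : ∀ x P → Dec (In𝒟 x P × S P)
      counted? x P = in𝒟? x P ×-dec S? P

      summand : ∀ x a b → 0 < a → a ≤ x → 0 < b → b ≤ x →
        ind (counted? x (ℤ.+ a , ℤ.+ b)) ≡ ind (a * b ≤? x) * (sifted x a * (sifted x b * weight a b))
      summand x a b 0<a a≤x 0<b b≤x = begin
        ind (counted? x (ℤ.+ a , ℤ.+ b))
          ≡⟨ ind-× (counted? x (ℤ.+ a , ℤ.+ b)) (a * b ≤? x) rest?
               (λ ((ra , rb , ab≤x) , s) → subst (_≤ x) (ℤₚ.abs-* (ℤ.+ a) (ℤ.+ b)) ab≤x , ra , rb , s)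
               (λ ab≤x (ra , rb , s) → (ra , rb , subst (_≤ x) (sym (ℤₚ.abs-* (ℤ.+ a) (ℤ.+ b))) ab≤x) , s) ⟩
        ind (a * b ≤? x) * ind rest?
          ≡⟨ cong (ind (a * b ≤? x) *_) (trans (ind-× rest? (real? a) (real? b ×-dec S? (ℤ.+ a , ℤ.+ b)) (λ h → h) _,_)
               (cong (ind (real? a) *_) (ind-× (real? b ×-dec S? (ℤ.+ a , ℤ.+ b)) (real? b) (S? (ℤ.+ a , ℤ.+ b)) (λ h → h) _,_))) ⟩
        ind (a * b ≤? x) * (ind (real? a) * (ind (real? b) * ind (S? (ℤ.+ a , ℤ.+ b))))
          ≡⟨ cong (ind (a * b ≤? x) *_) (cong₂ _*_ (real-factors 0<a a≤x) (cong₂ _*_ (real-factors 0<b b≤x) (S≡t a b))) ⟩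
        ind (a * b ≤? x) * (sifted x a * (E a * La) * (sifted x b * (E b * Lb) * ∏ λ i → t i a b))
          ≡⟨ cong (ind (a * b ≤? x) *_) (lem (sifted x a) (E a) La (sifted x b) (E b) Lb _) ⟩
        ind (a * b ≤? x) * (sifted x a * (sifted x b * (E a * E b * (La * Lb * ∏ λ i → t i a b))))
          ≡⟨ cong (λ w → ind (a * b ≤? x) * (sifted x a * (sifted x b * (E a * E b * w))))
               (trans (cong (_* ∏ λ i → t i a b) (sym (∏-* (λ i → lf (p i) a) (λ i → lf (p i) b)))) (sym (∏-* (λ i → lf (p i) a * lf (p i) b) (λ i → t i a b)))) ⟩
        ind (a * b ≤? x) * (sifted x a * (sifted x b * weight a b)) ∎
        where
        open ≡-Reasoning
        E : ℕ → ℕ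
        E = extraCondition with2?
        La = ∏ λ i → lf (p i) a
        Lb = ∏ λ i → lf (p i) b
        rest? = real? a ×-dec real? b ×-dec S? (ℤ.+ a , ℤ.+ b)
        lem : ∀ sa ea la sb eb lb t → sa * (ea * la) * (sb * (eb * lb) * t) ≡ sa * (sb * (ea * eb * (la * lb * t)))
        lem = solve-∀

    -- Serves both the numerator, with S the sign pattern, and the denominator, with S trivial. The
    -- assumption `S≡t` lets the condition join the local factors at the pᵢ.
    length-filter-𝒟 : ∀ x → length (filter S? (𝒟 x)) ≡ pairs x weight
    length-filter-𝒟 x = begin
      length (filter S? (𝒟 x))
        ≡⟨ length-filter-filter (in𝒟? x) S? (cartesianProduct (box x) (box x)) ⟩
      length (filter (counted? x) (cartesianProduct (box x) (box x)))
        ≡⟨ cong (λ xs → length (filter (counted? x) (cartesianProduct xs xs))) (map-upTo (λ n → ℤ.+ n) (suc x)) ⟩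
      length (filter (counted? x) (cartesianProduct (applyUpTo (λ n → ℤ.+ n) (suc x)) (applyUpTo (λ n → ℤ.+ n) (suc x))))
        ≡⟨ length-filter-grid (counted? x) _ _ (suc x) (suc x) ⟩
      (∑[ a < suc x ] ∑[ b < suc x ] c a b)
        ≡⟨ ∑-head x (λ a → ∑[ b < suc x ] c a b) ⟩
      (∑[ b < suc x ] c 0 b) + (∑[ i < x ] ∑[ b < suc x ] c (suc i) b)
        -- The box starts at 0 and the hyperbola at 1; row and column 0 vanish because discriminants
        -- in 𝒟 are positive.
        ≡⟨ cong₂ _+_ (trans (∑-ext (suc x) λ b → ind-no (counted? x (0ℤ , ℤ.+ b)) λ (((0<0 , _) , _) , _) → 0≮0 0<0) (∑-zero (suc x)))
             (∑-ext x λ i → trans (∑-head x (c (suc i))) (cong (_+ (∑[ j < x ] c (suc i) (suc j)))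
               (ind-no (counted? x (ℤ.+ suc i , 0ℤ)) λ ((_ , (0<0 , _) , _) , _) → 0≮0 0<0))) ⟩
      (∑[ i < x ] ∑[ j < x ] c (suc i) (suc j))
        ≡⟨ ∑-cong x (λ i i<x → ∑-cong x λ j j<x → summand x (suc i) (suc j) z<s i<x z<s j<x) ⟩
      (∑[ i < x ] ∑[ j < x ] (ind (suc i * suc j ≤? x) * (sifted x (suc i) * (sifted x (suc j) * weight (suc i) (suc j)))))
        ≡⟨ hyperbola-box x (λ a b → sifted x a * (sifted x b * weight a b)) ⟩
      pairs x weight ∎
      where
      open ≡-Reasoning
      c : ℕ → ℕ → ℕ
      c a b = ind (counted? x (ℤ.+ a , ℤ.+ b))
      0≮0 : ¬ (0ℤ ℤ.< 0ℤ)
      0≮0 (ℤ.+<+ ())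

-- Passage to rational limits

ι : ℕ → ℚ
ι n = fromℤ (ℤ.+ n)

ι-* : ∀ m n → ι (m * n) ≡ ι m ℚ.* ι n
ι-* m n = ℚₚ.toℚᵘ-injective (ℚᵘₚ.≃-trans
  (*≡* (cong (ℤ._* 1ℤ) (ℤₚ.pos-* m n)))
  (ℚᵘₚ.≃-sym (ℚₚ.toℚᵘ-homo-* (ι m) (ι n))))

ι-+ : ∀ m n → ι (m + n) ≡ ι m ℚ.+ ι n
ι-+ m n = ℚₚ.toℚᵘ-injective (ℚᵘₚ.≃-trans
  (*≡* (cong (ℤ._* 1ℤ) (trans (ℤₚ.pos-+ m n) (sym (cong₂ ℤ._+_ (ℤₚ.*-identityʳ (ℤ.+ m)) (ℤₚ.*-identityʳ (ℤ.+ n)))))))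
  (ℚᵘₚ.≃-sym (ℚₚ.toℚᵘ-homo-+ (ι m) (ι n))))

ι-mono-≤ : ∀ {m n} → m ≤ n → ι m ℚ.≤ ι n
ι-mono-≤ m≤n = ℚ.*≤* (ℤₚ.*-monoʳ-≤-nonNeg 1ℤ (ℤ.+≤+ m≤n))

ι-cancel-≤ : ∀ {m n} → ι m ℚ.≤ ι n → m ≤ n
ι-cancel-≤ {m} {n} (ℚ.*≤* le) = ℤₚ.drop‿+≤+ (subst₂ ℤ._≤_ (ℤₚ.*-identityʳ (ℤ.+ m)) (ℤₚ.*-identityʳ (ℤ.+ n)) le)

∣ι∣ : ∀ n → ℚ.∣ ι n ∣ ≡ ι n
∣ι∣ n = ℚₚ.0≤p⇒∣p∣≡p (ι-mono-≤ (z≤n {n}))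

∣ι-ι∣-≤ : ∀ {m n} → m ≤ n → ℚ.∣ ι n ℚ.- ι m ∣ ≡ ι (n ∸ m)
∣ι-ι∣-≤ {m} {n} m≤n = trans (cong ℚ.∣_∣ (begin
  ι n ℚ.- ι m                       ≡⟨ cong (λ k → ι k ℚ.- ι m) (m+[n∸m]≡n m≤n) ⟨
  ι (m + (n ∸ m)) ℚ.- ι m           ≡⟨ cong (ℚ._- ι m) (ι-+ m (n ∸ m)) ⟩
  ι m ℚ.+ ι (n ∸ m) ℚ.- ι m         ≡⟨ solve 2 (λ a b → a :+ b :- a := b) refl (ι m) (ι (n ∸ m)) ⟩
  ι (n ∸ m)                         ∎)) (∣ι∣ (n ∸ m))
  where
  open ≡-Reasoning
  open +-*-Solver

∣ι-ι∣ : ∀ m n → ℚ.∣ ι m ℚ.- ι n ∣ ≡ ι ∣ m - n ∣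
∣ι-ι∣ m n with ≤-total n m
... | inj₁ n≤m = trans (∣ι-ι∣-≤ n≤m) (cong ι (sym (m≤n⇒∣n-m∣≡n∸m n≤m)))
... | inj₂ m≤n = trans (trans (sym (ℚₚ.∣-p∣≡∣p∣ (ι m ℚ.- ι n)))
    (cong ℚ.∣_∣ (solve 2 (λ a b → :- (a :- b) := b :- a) refl (ι m) (ι n))))
  (trans (∣ι-ι∣-≤ m≤n) (cong ι (sym (m≤n⇒∣m-n∣≡n∸m m≤n))))
  where open +-*-Solver

-- Carries the cross-multiplied local densities over ℕ to rational numbers.
fraction-* : ∀ {v w} num den .{{_ : NonZero den}} → v * den ≡ num * w → (ℤ.+ num ℚ./ den) ℚ.* ι w ≡ ι v
fraction-* {v} {w} num (suc d) eq = ℚₚ.toℚᵘ-injective (ℚᵘₚ.≃-trans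
  (ℚₚ.toℚᵘ-homo-* (ℤ.+ num ℚ./ suc d) (ι w))
  (ℚᵘₚ.≃-trans (ℚᵘₚ.*-congʳ (ℚₚ.toℚᵘ-fromℚᵘ (mkℚᵘ (ℤ.+ num) d)))
  (*≡* (begin
    ℤ.+ num ℤ.* ℤ.+ w ℤ.* 1ℤ   ≡⟨ trans (ℤₚ.*-identityʳ _) (sym (ℤₚ.pos-* num w)) ⟩
    ℤ.+ (num * w)              ≡⟨ cong (λ k → ℤ.+ k) eq ⟨
    ℤ.+ (v * suc d)            ≡⟨ ℤₚ.pos-* v (suc d) ⟩
    ℤ.+ v ℤ.* ℤ.+ suc d        ≡⟨ cong (λ k → ℤ.+ v ℤ.* ℤ.+ k) (*-identityʳ (suc d)) ⟨
    ℤ.+ v ℤ.* ℤ.+ (suc d * 1)  ∎))))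
  where open ≡-Reasoning

ratio-* : ∀ m n .{{_ : NonZero n}} → ratio m n ℚ.* ι n ≡ ι m
ratio-* m (suc n) = fraction-* {m} {suc n} m (suc n) refl

-- The denominator of δ serves as n, because the numerator is at least 1.
archimedean : ∀ {δ} → 0ℚ ℚ.< δ → ∃[ n ] 1ℚ ℚ.≤ ι n ℚ.* δ
archimedean {δ@(mkℚ (ℤ.+ suc a) d _)} _ = suc d , ℚₚ.toℚᵘ-cancel-≤ (ℚᵘₚ.≤-respʳ-≃
  (ℚᵘₚ.≃-sym (ℚₚ.toℚᵘ-homo-* (ι (suc d)) δ))
  (*≤* (subst₂ ℤ._≤_ refl (trans (ℤₚ.pos-* (suc d) (suc a)) (sym (ℤₚ.*-identityʳ (ℤ.+ suc d ℤ.* ℤ.+ suc a))))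
    (ℤ.+≤+ (≤-trans (≤-reflexive (lem (suc d))) (m≤m*n (suc d) (suc a)))))))
  where
  lem : ∀ d → 1 * d + 0 ≡ d
  lem = solve-∀
archimedean {mkℚ (ℤ.+ zero) d _}   (ℚ.*<* (ℤ.+<+ ()))
archimedean {mkℚ ℤ.-[1+ a ] d _} (ℚ.*<* ())

module _ {W V : ℕ} {L : ℚ} (L≡ : L ℚ.* ι W ≡ ι V) .{{_ : NonZero W}} where

  -- The factor sW clears both denominators, and the distance becomes the natural number that
  -- `pairs-ratio` bounds.
  fraction-distance : ∀ s t .{{_ : NonZero s}} →
    ℚ.∣ ratio t s ℚ.- L ∣ ℚ.* ι (s * W) ≡ ι ∣ W * t - V * s ∣
  fraction-distance s t = begin
    ℚ.∣ r ℚ.- L ∣ ℚ.* ι (s * W)                  ≡⟨ cong (ℚ.∣ r ℚ.- L ∣ ℚ.*_) (∣ι∣ (s * W)) ⟨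
    ℚ.∣ r ℚ.- L ∣ ℚ.* ℚ.∣ ι (s * W) ∣            ≡⟨ ℚₚ.∣p*q∣≡∣p∣*∣q∣ (r ℚ.- L) (ι (s * W)) ⟨
    ℚ.∣ (r ℚ.- L) ℚ.* ι (s * W) ∣                ≡⟨ cong (λ z → ℚ.∣ (r ℚ.- L) ℚ.* z ∣) (ι-* s W) ⟩
    ℚ.∣ (r ℚ.- L) ℚ.* (ι s ℚ.* ι W) ∣            ≡⟨ cong ℚ.∣_∣ (solve 4 (λ r L s W → (r :- L) :* (s :* W) := W :* (r :* s) :- (L :* W) :* s) refl r L (ι s) (ι W)) ⟩
    ℚ.∣ ι W ℚ.* (r ℚ.* ι s) ℚ.- (L ℚ.* ι W) ℚ.* ι s ∣ ≡⟨ cong₂ (λ u v → ℚ.∣ ι W ℚ.* u ℚ.- v ℚ.* ι s ∣) (ratio-* t s) L≡ ⟩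
    ℚ.∣ ι W ℚ.* ι t ℚ.- ι V ℚ.* ι s ∣            ≡⟨ cong₂ (λ u v → ℚ.∣ u ℚ.- v ∣) (ι-* W t) (ι-* V s) ⟨
    ℚ.∣ ι (W * t) ℚ.- ι (V * s) ∣                ≡⟨ ∣ι-ι∣ (W * t) (V * s) ⟩
    ι ∣ W * t - V * s ∣                          ∎
    where
    open ≡-Reasoning
    open +-*-Solver
    r = ratio t s

  ratio-tendsTo : ∀ (s t : ℕ → ℕ) →
    (∀ n → ∃[ N ] ∀ x → N ≤ x → 1 ≤ s x × n * ∣ W * t x - V * s x ∣ ≤ s x) →
    TendsTo (λ x → ratio (t x) (s x)) L
  ratio-tendsTo s t approx δ 0<δ with archimedean 0<δ
  -- The factor 2 yields strictness: a distance of at least δ would give 2sW ≤ s with s and W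
  -- positive.
  ... | n , 1≤nδ with approx (2 * n)
  ...   | N , close = N , λ x N≤x → near x (close x N≤x)
    where
    near : ∀ x → 1 ≤ s x × 2 * n * ∣ W * t x - V * s x ∣ ≤ s x → ℚ.∣ ratio (t x) (s x) ℚ.- L ∣ ℚ.< δ
    near x (1≤s , le) = ℚₚ.≰⇒> λ δ≤X → <⇒≱ s<2sW (ι-cancel-≤ (begin
      ι (2 * (s x * W))                    ≡⟨ trans (ι-* 2 (s x * W)) (sym (cong (ℚ._* ι (s x * W)) (ℚₚ.*-identityʳ (ι 2)))) ⟩
      ι 2 ℚ.* 1ℚ ℚ.* ι (s x * W)           ≤⟨ ℚₚ.*-monoʳ-≤-nonNeg (ι (s x * W)) {{ι-nonNeg (s x * W)}} (ℚₚ.*-monoˡ-≤-nonNeg (ι 2) (ℚₚ.≤-trans 1≤nδ (ℚₚ.*-monoˡ-≤-nonNeg (ι n) {{ι-nonNeg n}} δ≤X))) ⟩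
      ι 2 ℚ.* (ι n ℚ.* X) ℚ.* ι (s x * W)  ≡⟨ solve 4 (λ a b c d → a :* (b :* c) :* d := (a :* b) :* (c :* d)) refl (ι 2) (ι n) X (ι (s x * W)) ⟩
      ι 2 ℚ.* ι n ℚ.* (X ℚ.* ι (s x * W))  ≡⟨ cong₂ ℚ._*_ (sym (ι-* 2 n)) (fraction-distance (s x) (t x)) ⟩
      ι (2 * n) ℚ.* ι D                    ≡⟨ ι-* (2 * n) D ⟨
      ι (2 * n * D)                        ≤⟨ ι-mono-≤ le ⟩
      ι (s x)                              ∎))
      where
      open ℚₚ.≤-Reasoning
      open +-*-Solver using (solve; _:*_; _:=_)
      ι-nonNeg : ∀ n → ℚ.NonNegative (ι n)
      ι-nonNeg n = ℚ.nonNegative (ι-mono-≤ (z≤n {n}))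
      instance
        s≢0 : NonZero (s x)
        s≢0 = >-nonZero 1≤s
      X = ℚ.∣ ratio (t x) (s x) ℚ.- L ∣
      D = ∣ W * t x - V * s x ∣
      s<2sW : s x < 2 * (s x * W)
      s<2sW = ≤-trans (+-mono-≤ 1≤s (≤-reflexive (sym (+-identityʳ (s x)))))
        (*-monoʳ-≤ 2 (m≤m*n (s x) W))

-- Merges the two products of `limitingDensity` into one over all indices, which can then be matched
-- with `∏` factor by factor.
productℚ-partition : ∀ {A : Set} {P : A → Set} (P? : ∀ x → Dec (P x)) (f g : A → ℚ) xs →
  productℚ (map f (filter P? xs)) ℚ.* productℚ (map g (filter (λ x → ¬? (P? x)) xs)) ≡
  productℚ (map (λ x → if does (P? x) then f x else g x) xs)
productℚ-partition P? f g []       = refl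
productℚ-partition P? f g (x ∷ xs) with P? x | productℚ-partition P? f g xs
... | yes _ | ih = trans (ℚₚ.*-assoc (f x) _ _) (cong (f x ℚ.*_) ih)
... | no _  | ih = trans (solve 3 (λ a b c → a :* (b :* c) := b :* (a :* c)) refl
    (productℚ (map f (filter P? xs))) (g x) (productℚ (map g (filter (λ x → ¬? (P? x)) xs)))) (cong (g x ℚ.*_) ih)
  where open +-*-Solver

productℚ-∏ : ∀ {n} (d : Fin n → ℚ) (w v : Fin n → ℕ) → (∀ i → d i ℚ.* ι (w i) ≡ ι (v i)) →
             productℚ (tabulate d) ℚ.* ι (∏ w) ≡ ι (∏ v)
productℚ-∏ {zero}  d w v eq = refl
productℚ-∏ {suc n} d w v eq = begin
  d zero ℚ.* D ℚ.* ι (w zero * ∏ (w ∘ suc))       ≡⟨ cong (d zero ℚ.* D ℚ.*_) (ι-* (w zero) _) ⟩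
  d zero ℚ.* D ℚ.* (ι (w zero) ℚ.* ι (∏ (w ∘ suc))) ≡⟨ solve 4 (λ a b c e → a :* b :* (c :* e) := (a :* c) :* (b :* e)) refl (d zero) D (ι (w zero)) (ι (∏ (w ∘ suc))) ⟩
  d zero ℚ.* ι (w zero) ℚ.* (D ℚ.* ι (∏ (w ∘ suc))) ≡⟨ cong₂ ℚ._*_ (eq zero) (productℚ-∏ (d ∘ suc) (w ∘ suc) (v ∘ suc) (eq ∘ suc)) ⟩
  ι (v zero) ℚ.* ι (∏ (v ∘ suc))                  ≡⟨ ι-* (v zero) _ ⟨
  ι (∏ v)                                         ∎
  where
  open ≡-Reasoning
  open +-*-Solver
  D = productℚ (tabulate (d ∘ suc))

-- Assembling the local densities into the limit

theorem4p3 : (k : ℕ) → 2 ≤ k →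
    (ℓ : ℕ) (p : Fin ℓ → ℕ) → (∀ i → Prime (p i)) → Injective _≡_ _≡_ p →
    (ε : Fin ℓ → ℤ) → (∀ i → ε i ≡ 0ℤ ⊎ ε i ≡ 1ℤ ⊎ ε i ≡ -1ℤ) →
    TendsTo (proportion k p ε) (limitingDensity p ε)
theorem4p3 k 2≤k ℓ p pr p-inj ε ε-sign =
  ratio-tendsTo density (λ x → length (𝒟 x)) (λ x → length (filter (hasSigns? k p ε) (𝒟 x))) λ n →
    let N , close = ratioApprox n in
    N , λ x N≤x → subst₂ (λ s t → 1 ≤ s × n * ∣ W * t - V * s ∣ ≤ s) (sym (all≡ x)) (sym (signed≡ x)) (close x N≤x)
  where
  open Pattern p pr p-inj
  open Counting p pr p-inj
  instance
    M≢0 : NonZero modulus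
    M≢0 = modulus-nonZero
  open Asymptotics modulus 2∣modulus

  admissible signed : Fin ℓ → ℕ → ℕ → ℕ
  admissible i = LocalPairs.admissible (pr i)
  signed i     = LocalPairs.withSign (pr i) (ε i)

  w v : Fin ℓ → ℕ
  w i = ∑∑ (localModulus (p i)) (admissible i)
  v i = ∑∑ (localModulus (p i)) (signed i)

  W V : ℕ
  W = ∑∑ modulus (pairWeight admissible)
  V = ∑∑ modulus (pairWeight signed)

  perA : ∀ i → Periodic₂ (localModulus (p i)) (admissible i)
  perA i = LocalPairs.admissible-periodic (pr i)
  perS : ∀ i → Periodic₂ (localModulus (p i)) (signed i)
  perS i = LocalPairs.withSign-periodic (pr i) (ε i)

  W≡ : W ≡ extraTotal * ∏ w
  W≡ = ∑∑-pairWeight perA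
  V≡ : V ≡ extraTotal * ∏ v
  V≡ = ∑∑-pairWeight perS

  instance
    W≢0 : NonZero W
    W≢0 = subst NonZero (sym W≡) (m*n≢0 extraTotal (∏ w) {{extraTotal-nonZero}} {{∏-nonZero w λ i → LocalPairs.admissible-nonZero (pr i)}})

  all≡ : ∀ x → length (𝒟 x) ≡ pairs x (pairWeight admissible)
  all≡ x = begin
    -- The trivial condition is written as a product of factors 1 over the pᵢ, so that the same
    -- counting lemma applies.
    length (𝒟 x)                                  ≡⟨ cong length (filter-all (λ _ → yes tt) {𝒟 x} (All.universal (λ _ → tt) (𝒟 x))) ⟨
    length (filter (λ _ → yes tt) (𝒟 x))          ≡⟨ length-filter-𝒟 (λ _ → yes tt) (λ _ _ _ → 1) (λ _ _ → sym (∏-1 {ℓ} (λ _ → 1) λ _ → refl)) x ⟩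
    pairs x (pairWeight λ i a b → admissible i a b * 1) ≡⟨ hyperbola-ext x (λ a b → cong (λ u → sifted x a * (sifted x b * (extraCondition with2? a * extraCondition with2? b * u))) (∏-cong λ i → *-identityʳ (admissible i a b))) ⟩
    pairs x (pairWeight admissible)               ∎
    where
    open ≡-Reasoning
    open Sieve modulus using (sifted)

  signed≡ : ∀ x → length (filter (hasSigns? k p ε) (𝒟 x)) ≡ pairs x (pairWeight signed)
  signed≡ = length-filter-𝒟 (hasSigns? k p ε) (λ i a b → ind (dominant (χ (p i) a) (χ (p i) b) ℤₚ.≟ ε i))
    λ a b → ind-all (hasSigns? k p ε (ℤ.+ a , ℤ.+ b)) (λ i → dominant (χ (p i) a) (χ (p i) b) ℤₚ.≟ ε i)
      (λ h i → trans (sym (sgn-σ 2≤k (pr i) a b)) (h i))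
      (λ h i → trans (sgn-σ 2≤k (pr i) a b) (h i))

  ratioApprox : ∀ n → ∃[ N ] ∀ x → N ≤ x →
    1 ≤ pairs x (pairWeight admissible) × n * ∣ W * pairs x (pairWeight signed) - V * pairs x (pairWeight admissible) ∣ ≤ pairs x (pairWeight admissible)
  ratioApprox = pairs-ratio
    (pairWeight-periodic perA) (pairWeight≤1 λ i → LocalPairs.admissible≤1 (pr i))
    (pairWeight-periodic perS) (pairWeight≤1 λ i → LocalPairs.withSign≤1 (pr i) (ε i))

  localDensity : Fin ℓ → ℚ
  localDensity i = if does (ε i ℤₚ.≟ 0ℤ)
    then ℤ.+ 1 ℚ./ (suc (p i) ^ 2)
    else ℤ.+ (p i * (p i + 2)) ℚ./ (2 * suc (p i) ^ 2)

  localDensity-* : ∀ i → localDensity i ℚ.* ι (w i) ≡ ι (v i)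
  localDensity-* i with ε i ℤₚ.≟ 0ℤ
  ... | yes ε≡0 = fraction-* 1 (suc (p i) ^ 2)
    (subst (λ e → ∑∑ (localModulus (p i)) (LocalPairs.withSign (pr i) e) * suc (p i) ^ 2 ≡ 1 * w i) (sym ε≡0)
      (LocalPairs.zero-density (pr i)))
  ... | no ε≢0  = fraction-* (p i * (p i + 2)) (2 * suc (p i) ^ 2)
    (LocalPairs.nonzero-density (pr i) ([ (λ ε≡0 → contradiction ε≡0 ε≢0) , (λ h → h) ]′ (ε-sign i)))

  -- W and V share the factor `extraTotal`, so V/W is the product of the local quotients `v i` /
  -- `w i`.
  density : limitingDensity p ε ℚ.* ι W ≡ ι V
  density = begin
    limitingDensity p ε ℚ.* ι W
      ≡⟨ cong₂ ℚ._*_ (trans (productℚ-partition (λ i → ε i ℤₚ.≟ 0ℤ) _ _ (allFin ℓ)) (cong productℚ (map-tabulate (λ i → i) localDensity)))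
                     (trans (cong ι W≡) (ι-* extraTotal (∏ w))) ⟩
    productℚ (tabulate localDensity) ℚ.* (ι extraTotal ℚ.* ι (∏ w))
      ≡⟨ solve 3 (λ a b c → a :* (b :* c) := b :* (a :* c)) refl (productℚ (tabulate localDensity)) (ι extraTotal) (ι (∏ w)) ⟩
    ι extraTotal ℚ.* (productℚ (tabulate localDensity) ℚ.* ι (∏ w))
      ≡⟨ cong (ι extraTotal ℚ.*_) (productℚ-∏ localDensity w v localDensity-*) ⟩
    ι extraTotal ℚ.* ι (∏ v)
      ≡⟨ trans (cong ι V≡) (ι-* extraTotal (∏ v)) ⟨
    ι V ∎
    where
    open ≡-Reasoning
    open +-*-Solver
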